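{- Let $G$ be a finite Abelian group of order $v=p_1^{2k_1}p_2^{2k_2}\cdots p_n^{2k_n}$, where $n\ge 2$, $p_1,\dots,p_n$ are distinct odd primes and $k_1,\dots,k_n$ are positive integers. If there is a regular Paley type partial difference set in $G$, then for every $1\le i\le n$ with $k_i$ odd we have $p_i\equiv 3 \pmod 4$.
   Context: For a finite Abelian group $G$ of order $v$ with identity $e$, a subset $D\subseteq G$ of size $k$ is a $(v,k,\lambda,\mu)$-partial difference set (PDS) if the expressions $gh^{ -1}$ with $g,h\in D$, $g\neq h$, represent each non-identity element of $D$ exactly $\lambda$ times and each non-identity element of $G\setminus D$ exactly $\mu$ times. It is regular if $D^{(-1)}=\{g^{ -1}:g\in D\}=D$ and $e\notin D$. A Paley type PDS is a PDS with parameters $(v,(v-1)/2,(v-5)/4,(v-1)/4)$. -}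

module Defs where

open import Level using (Level; _⊔_) renaming (suc to lsuc)
open import Data.Nat using (ℕ; zero; suc; _+_; _*_; _^_; _∸_; _/_)
open import Data.Fin using (Fin)
open import Data.List using (List; map; allFin)
open import Data.Nat.ListAction using (sum; product)
open import Data.Bool using (Bool; true; false; if_then_else_)
open import Data.Product using (Σ; _×_; _,_)
open import Relation.Nullary using (¬_; Dec; yes; no)
open import Relation.Nullary.Decidable using (⌊_⌋)
open import Relation.Binary.PropositionalEquality using (_≡_)
open import Algebra.Bundles using (AbelianGroup)

count : {v : ℕ} → (Fin v → Bool) → ℕ
count {v} f = sum (map (λ i → if f i then 1 else 0) (allFin v))

count2 : {v : ℕ} → (Fin v → Fin v → Bool) → ℕ
count2 {v} f = sum (map (λ i → count (f i)) (allFin v))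

prodFin : (n : ℕ) → (Fin n → ℕ) → ℕ
prodFin n f = product (map f (allFin n))

module _ {c ℓ : Level} (G : AbelianGroup c ℓ) where
  open AbelianGroup G

  record FiniteOfOrder (v : ℕ) : Set (c ⊔ ℓ) where
    field
      enum      : Fin v → Carrier
      enum-inj  : ∀ i j → enum i ≈ enum j → i ≡ j
      enum-surj : ∀ g → Σ (Fin v) (λ i → enum i ≈ g)
      _≈?_      : ∀ g h → Dec (g ≈ h)

  record Subset : Set (lsuc (c ⊔ ℓ)) where
    field
      mem      : Carrier → Set (c ⊔ ℓ)
      mem?     : ∀ g → Dec (mem g)
      mem-resp : ∀ {g h} → g ≈ h → mem g → mem h

  module _ {v : ℕ} (F : FiniteOfOrder v) (D : Subset) where
    open FiniteOfOrder F
    open Subset D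

    size : ℕ
    size = count (λ i → ⌊ mem? (enum i) ⌋)

    reps : Carrier → ℕ
    reps x = count2 (λ i j →
               ⌊ mem? (enum i) ⌋ Data.Bool.∧ ⌊ mem? (enum j) ⌋
               Data.Bool.∧ Data.Bool.not ⌊ enum i ≈? enum j ⌋
               Data.Bool.∧ ⌊ (enum i ∙ enum j ⁻¹) ≈? x ⌋)

    IsPDS : (k lam mu : ℕ) → Set (c ⊔ ℓ)
    IsPDS k lam mu =
      (size ≡ k) ×
      (∀ x → ¬ (x ≈ ε) → mem x → reps x ≡ lam) ×
      (∀ x → ¬ (x ≈ ε) → ¬ mem x → reps x ≡ mu)

    IsRegular : Set (c ⊔ ℓ)
    IsRegular = (∀ g → mem g → mem (g ⁻¹)) × (∀ g → mem (g ⁻¹) → mem g) × ¬ mem ε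

    IsPaleyPDS : Set (c ⊔ ℓ)
    IsPaleyPDS = IsPDS ((v ∸ 1) / 2) ((v ∸ 5) / 4) ((v ∸ 1) / 4)

    IsRegularPaleyPDS : Set (c ⊔ ℓ)
    IsRegularPaleyPDS = IsRegular × IsPaleyPDS

{-# OPTIONS --safe #-}

-- Put W = 2 D + 1 − G in ℤ[G], so that W has entries 0, ±1 and W ⋆ W = v − G. As v is a square, Frobenius
-- modulo a prime q not dividing 2 v shows that W is congruent modulo q to its image under g ↦ q g. Entries 0, ±1
-- are determined by their residues, so D is invariant under every multiplier prime to v.
--
-- Let a = p^2k be the full power of p in v and let Y be the image of W under g ↦ a g. Then Y ⋆ Y is divisible by
-- a, and since the group algebra of aG over 𝔽ₚ has no nilpotents, p^k divides Y. The entries of Y on aG ∖ 0 are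
-- odd and the sum of the squares of all entries is v − a, which leaves only the values ±p^k on aG ∖ 0. Hence every
-- fibre of g ↦ a g over a non-zero point of aG meets D in (p^2k ± p^k) / 2 elements.
--
-- On the other hand the multipliers that are 1 modulo v / a and Teichmüller representatives modulo a fix one point
-- of such a fibre and permute the others freely, so this number is 0 or 1 modulo p − 1. For odd k this forces
-- p − 1 to divide 2, so p = 3.

module Submission where

open import Defs
open import Level using (Level; 0ℓ)
open import Data.Nat
  using (ℕ; zero; suc; _+_; _*_; _^_; _∸_; _/_; _%_; _!; _≤_; _<_; z≤n; s≤s; NonZero; ≢-nonZero; ≢-nonZero⁻¹)
import Data.Nat as ℕ
import Data.Nat.Properties as ℕ
import Data.Nat.Divisibility as ℕ
import Data.Nat.DivMod as ℕ
open import Data.Nat.Combinatorics using (_C_; nCk≡n!/k![n-k]!; k![n∸k]!∣n!; nCn≡1)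
open import Data.Nat.Coprimality as Coprime using (Coprime; coprime-divisor; coprime-Bézout)
open import Data.Nat.GCD using (module Bézout)
open import Data.Nat.Primality using (Prime; prime[2]; prime⇒nonZero; prime⇒nonTrivial; prime⇒irreducible; euclidsLemma)
open import Data.Nat.Primality.Factorisation using (factorise; PrimeFactorisation)
open import Data.Nat.ListAction as List using (product)
open import Data.Nat.Tactic.RingSolver using () renaming (solve-∀ to solveℕ)
open import Data.Integer as ℤ using (ℤ; 0ℤ; 1ℤ)
import Data.Integer.Properties as ℤ
open import Data.Integer.Divisibility.Signed
  using (_∣_; divides; ∣ᵤ⇒∣; ∣⇒∣ᵤ; ∣-refl; ∣-trans;
         ∣m⇒∣-m; ∣m⇒∣m*n; ∣n⇒∣m*n; ∣m∣n⇒∣m+n; ∣m∣n⇒∣m-n; ∣m+n∣m⇒∣n; *-cancelˡ-∣)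
open import Data.Integer.Tactic.RingSolver using (solve-∀)
open import Data.Fin as Fin using (Fin; zero; suc; toℕ; fromℕ; fromℕ<; inject₁)
import Data.Fin.Properties as Fin
import Data.Fin.Permutation as Perm
open import Data.Bool using (Bool; true; false; if_then_else_; _∧_; not)
open import Data.List using ([]; _∷_; allFin; map; tabulate)
open import Data.List.Relation.Unary.All using (All; []; _∷_)
open import Data.Product using (Σ; ∃; _,_; _×_; proj₁; proj₂)
open import Data.Sum using (_⊎_; inj₁; inj₂; [_,_]′)
open import Function using (_∘_; case_of_)
open import Function.Definitions using (Injective)
open import Relation.Nullary using (¬_; Dec; yes; no; contradiction)
open import Relation.Nullary.Decidable using (⌊_⌋)
open import Relation.Binary.PropositionalEquality
  using (_≡_; _≢_; _≗_; isEquivalence; refl; sym; trans; cong; cong₂; subst; subst₂; module ≡-Reasoning)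
open import Algebra.Core using (Op₁; Op₂)
open import Algebra.Structures using (IsAbelianGroup; IsCommutativeMonoid)
open import Algebra.Structures.Biased using (isCommutativeMonoidˡ; isCommutativeSemiringˡ)
open import Algebra.Bundles using (AbelianGroup; CommutativeSemiring)
open import Algebra.Morphism.Structures using (IsGroupMonomorphism)
import Algebra.Morphism.GroupMonomorphism as GroupMonomorphism
import Algebra.Construct.Pointwise as Pointwise
import Algebra.Properties.Group
import Algebra.Properties.CommutativeMonoid.Mult
import Algebra.Properties.CommutativeMonoid.Sum
import Algebra.Properties.Semiring.Exp
import Algebra.Properties.Semiring.Mult
import Algebra.Properties.Semiring.Sum
import Algebra.Properties.CommutativeMonoid.Sum ℕ.*-1-commutativeMonoid as Prod
import Algebra.Properties.Semiring.Sum ℤ.+-*-semiring as Sum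

-- Every step is a congruence between integers; no characters or cyclotomic integers appear. From W
-- ⋆ W = v - G and G ⋆ W = 0 follows W³ = v W, so the q-th power of W is v^((q - 1)/2) W. Modulo q
-- this coefficient is in general the Legendre symbol of v; a square v makes it 1. The parity of k
-- matters as follows. Put P = p^k, so that a fibre meets D in (P² ± P)/2 points. For even k, P is 1
-- modulo 2 (p - 1), and the two counts are 1 and 0 modulo p - 1, which is just what the multipliers
-- allow. For odd k, P is p modulo 2 (p - 1), and both counts are shifted by (p - 1)/2; the shifted
-- values can be 0 or 1 again only if p - 1 divides 2. Teichmüller representatives are needed
-- because the integers 1, ..., p - 1 are not closed under multiplication modulo a. The condition n
-- ≥ 2 is what gives aG a non-zero point.

-- Primes, divisibility and coprimality

prime≥2 : ∀ {q} → Prime q → 2 ≤ q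
prime≥2 {suc (suc q)} _ = s≤s (s≤s z≤n)
prime≥2 {suc zero} pr with () ← prime⇒nonTrivial pr
prime≥2 {zero} pr with () ← prime⇒nonTrivial pr

prime∤1 : ∀ {q} → Prime q → q ℕ.∤ 1
prime∤1 pr q∣1 with refl ← ℕ.∣1⇒≡1 q∣1 with () ← prime⇒nonTrivial pr

prime∤! : ∀ {q} → Prime q → ∀ k → k < q → q ℕ.∤ k !
prime∤! pr zero    _   q∣1  = prime∤1 pr q∣1
prime∤! pr (suc k) k<q q∣k! with euclidsLemma (suc k) (k !) pr q∣k!
... | inj₁ q∣k+1 = ℕ.<⇒≱ k<q (ℕ.∣⇒≤ q∣k+1)
... | inj₂ q∣k!′ = prime∤! pr k (ℕ.<-trans (ℕ.n<1+n k) k<q) q∣k!′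

-- The prime divides q! = C · k! · (q - k)!, but neither of the two factorials, both being of
-- numbers below q.
prime∣C : ∀ {q k} → Prime q → 0 < k → k < q → q ℕ.∣ q C k
prime∣C {q@(suc q′)} {k@(suc k′)} pr _ k<q
  with euclidsLemma (q C k) (k ! * (q ∸ k) !) pr (subst (q ℕ.∣_) (sym C*≡!) (ℕ.divides (q′ !) (ℕ.*-comm q (q′ !))))
  where
  k≤q = ℕ.<⇒≤ k<q
  instance _ = ℕ.m*n≢0 (k !) ((q ∸ k) !) {{k ℕ.!≢0}} {{(q ∸ k) ℕ.!≢0}}
  C*≡! : (q C k) * (k ! * (q ∸ k) !) ≡ q !
  C*≡! = trans (cong (_* (k ! * (q ∸ k) !)) (nCk≡n!/k![n-k]! k≤q)) (ℕ.m/n*n≡m (k![n∸k]!∣n! k≤q))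
... | inj₁ q∣C = q∣C
... | inj₂ q∣!! with euclidsLemma (k !) ((q ∸ k) !) pr q∣!!
...   | inj₁ q∣k! = contradiction q∣k! (prime∤! pr k k<q)
...   | inj₂ q∣[q-k]! = contradiction q∣[q-k]! (prime∤! pr (q ∸ k) (ℕ.∸-monoʳ-< {o = 0} (s≤s z≤n) (ℕ.<⇒≤ k<q)))

prime∣prime^⇒≡ : ∀ {p q} → Prime p → Prime q → ∀ k → q ℕ.∣ p ^ k → q ≡ p
prime∣prime^⇒≡ {p} {q} p-prime q-prime zero    q∣1 = contradiction q∣1 (prime∤1 q-prime)
prime∣prime^⇒≡ {p} {q} p-prime q-prime (suc k) q∣p^ with euclidsLemma p (p ^ k) q-prime q∣p^
... | inj₂ q∣p^k = prime∣prime^⇒≡ p-prime q-prime k q∣p^k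
... | inj₁ q∣p with prime⇒irreducible p-prime q∣p
...   | inj₁ q≡1 = contradiction (subst (q ℕ.∣_) q≡1 ℕ.∣-refl) (prime∤1 q-prime)
...   | inj₂ q≡p = q≡p

coprime-from-primes : ∀ {m n} .{{_ : NonZero m}} → (∀ {q} → Prime q → q ℕ.∣ m → ¬ q ℕ.∣ n) → Coprime m n
coprime-from-primes {m} {n} no-common {zero}  (0∣m , _) = contradiction (ℕ.0∣⇒≡0 0∣m) (≢-nonZero⁻¹ m)
coprime-from-primes {m} {n} no-common {d@(suc _)} (d∣m , d∣n) with factorise d
... | record { factors = [] ; isFactorisation = d≡1 } = d≡1
... | record { factors = q ∷ qs ; isFactorisation = d≡ ; factorsPrime = pr ∷ _ } =
  contradiction (ℕ.∣-trans q∣d d∣n) (no-common pr (ℕ.∣-trans q∣d d∣m))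
  where
  q∣d : q ℕ.∣ d
  q∣d = subst (q ℕ.∣_) (sym d≡) (ℕ.m∣m*n (product qs))

prime∤⇒coprime : ∀ {q n} → Prime q → ¬ q ℕ.∣ n → Coprime q n
prime∤⇒coprime {q} {n} pr q∤n = coprime-from-primes {{prime⇒nonZero pr}} λ {l} pr′ l∣q l∣n →
  case prime⇒irreducible pr l∣q of λ where
    (inj₁ l≡1)  → prime∤1 pr′ (subst (l ℕ.∣_) l≡1 ℕ.∣-refl)
    (inj₂ refl) → q∤n l∣n

prime∣* : ∀ {q} → Prime q → ∀ a b → ℤ.+ q ∣ a ℤ.* b → (ℤ.+ q ∣ a) ⊎ (ℤ.+ q ∣ b)
prime∣* {q} pr a b q∣ab with euclidsLemma ℤ.∣ a ∣ ℤ.∣ b ∣ pr (subst (q ℕ.∣_) (ℤ.abs-* a b) (∣⇒∣ᵤ q∣ab))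
... | inj₁ q∣a = inj₁ (∣ᵤ⇒∣ q∣a)
... | inj₂ q∣b = inj₂ (∣ᵤ⇒∣ q∣b)

prime∣^ : ∀ {q} → Prime q → ∀ c n → ℤ.+ q ∣ c ℤ.^ n → ℤ.+ q ∣ c
prime∣^ pr c zero    q∣1 = contradiction (∣⇒∣ᵤ q∣1) (prime∤1 pr)
prime∣^ pr c (suc n) q∣c^ with prime∣* pr c (c ℤ.^ n) q∣c^
... | inj₁ q∣c = q∣c
... | inj₂ q∣c^n = prime∣^ pr c n q∣c^n

∣m-n∣m⇒∣n : ∀ {i m n} → i ∣ m ℤ.- n → i ∣ m → i ∣ n
∣m-n∣m⇒∣n {i} {m} {n} i∣m-n i∣m = subst (i ∣_) (ℤ.neg-involutive n) (∣m⇒∣-m (∣m+n∣m⇒∣n {m = m} i∣m-n i∣m))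

pos-^ : ∀ m n → ℤ.+ (m ^ n) ≡ (ℤ.+ m) ℤ.^ n
pos-^ m zero    = refl
pos-^ m (suc n) = trans (ℤ.pos-* m (m ^ n)) (cong (ℤ.+ m ℤ.*_) (pos-^ m n))

*-^ : ∀ m n k → (m * n) ^ k ≡ m ^ k * n ^ k
*-^ m n zero    = refl
*-^ m n (suc k) = trans (cong (m * n *_) (*-^ m n k)) (ℕ.[m*n]*[o*p]≡[m*o]*[n*p] m n (m ^ k) (n ^ k))

-- The Frobenius congruence in commutative semirings

module Frobenius {c ℓ : Level} (R : CommutativeSemiring c ℓ) where
  open CommutativeSemiring R using (Carrier; _≈_; semiring; setoid) renaming
    ( _+_ to _⊕_; _*_ to _⊛_; 0# to 0ᴿ
    ; refl to ≈-refl; sym to ≈-sym; trans to ≈-trans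
    ; +-cong to ⊕-cong; +-congˡ to ⊕-congˡ; +-congʳ to ⊕-congʳ
    ; +-identityˡ to ⊕-identityˡ; +-commutativeMonoid to ⊕-commutativeMonoid
    ; *-identityˡ to ⊛-identityˡ; *-identityʳ to ⊛-identityʳ; zeroˡ to ⊛-zeroˡ
    )
  open import Algebra.Properties.Semiring.Sum semiring using (sum; sum-cong-≋; sum-init-last)
  open import Algebra.Properties.Semiring.Mult semiring
    using (×-congˡ; ×-assocˡ; ×-homo-1) renaming (_×_ to _×ᴿ_)
  open import Algebra.Properties.CommutativeMonoid.Mult ⊕-commutativeMonoid using (×-distrib-+)
  open import Algebra.Properties.Semiring.Exp semiring using () renaming (_^_ to _^ᴿ_)
  open import Algebra.Properties.CommutativeSemiring.Binomial R using (theorem; binomialTerm)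
  open import Relation.Binary.Reasoning.Setoid setoid
  open import Algebra.Solver.CommutativeMonoid ⊕-commutativeMonoid using (solve; _⊜_) renaming (_⊕_ to _:+_)

  -- A one-sided congruence, since a semiring has no subtraction. Working in this generality serves
  -- both ℤ, for Fermat's theorem, and the group ring.
  _≈_mod_ : Carrier → Carrier → ℕ → Set _
  x ≈ y mod q = ∃ λ z → x ≈ y ⊕ (q ×ᴿ z)

  sum-× : ∀ q {n} (f : Fin n → Carrier) → sum (λ i → q ×ᴿ f i) ≈ q ×ᴿ sum f
  sum-× q {zero}  f = ≈-sym (×-zero q)
    where
    ×-zero : ∀ m → m ×ᴿ 0ᴿ ≈ 0ᴿ
    ×-zero zero    = ≈-refl
    ×-zero (suc m) = ≈-trans (⊕-identityˡ _) (×-zero m)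
  sum-× q {suc n} f = ≈-trans (⊕-congˡ (sum-× q (λ i → f (suc i)))) (≈-sym (×-distrib-+ _ _ q))

  freshman : ∀ {q} → Prime q → ∀ x y → ((x ⊕ y) ^ᴿ q) ≈ ((x ^ᴿ q) ⊕ (y ^ᴿ q)) mod q
  freshman {zero}  pr x y with () ← prime⇒nonZero pr
  freshman {suc n} pr x y = sum z , (begin
    (x ⊕ y) ^ᴿ suc n                                  ≈⟨ theorem (suc n) x y ⟩
    term zero ⊕ sum (λ i → term (suc i))              ≈⟨ ⊕-congˡ (sum-init-last (λ i → term (suc i))) ⟩
    term zero ⊕ (sum (λ i → term (suc (inject₁ i))) ⊕ term (suc (fromℕ n)))
      ≈⟨ ⊕-cong first (⊕-cong (≈-trans (sum-cong-≋ middle) (sum-× (suc n) z)) final) ⟩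
    (y ^ᴿ suc n) ⊕ ((suc n ×ᴿ sum z) ⊕ (x ^ᴿ suc n))
      ≈⟨ solve 3 (λ a b c → (a :+ (b :+ c)) ⊜ ((c :+ a) :+ b)) ≈-refl _ _ _ ⟩
    ((x ^ᴿ suc n) ⊕ (y ^ᴿ suc n)) ⊕ (suc n ×ᴿ sum z)  ∎)
    where
    term : Fin (suc (suc n)) → Carrier
    term = binomialTerm x y (suc n)
    first : term zero ≈ y ^ᴿ suc n
    first = ≈-trans (×-homo-1 _) (⊛-identityˡ _)
    final : term (suc (fromℕ n)) ≈ x ^ᴿ suc n
    final rewrite Fin.toℕ-fromℕ n | nCn≡1 (suc n) | ℕ.n∸n≡0 n = ≈-trans (×-homo-1 _) (⊛-identityʳ _)
    index : Fin n → ℕ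
    index i = toℕ (suc (inject₁ i))
    index<q : ∀ i → index i < suc n
    index<q i = s≤s (subst (_< n) (sym (Fin.toℕ-inject₁ i)) (Fin.toℕ<n i))
    q∣C : ∀ i → suc n ℕ.∣ suc n C index i
    q∣C i = prime∣C pr (s≤s z≤n) (index<q i)
    z : Fin n → Carrier
    z i = ℕ._∣_.quotient (q∣C i) ×ᴿ ((x ^ᴿ index i) ⊛ (y ^ᴿ (suc n ∸ index i)))
    -- Only the two outer binomial coefficients are prime to q; each inner term is q times the
    -- corresponding `z i`.
    middle : ∀ i → term (suc (inject₁ i)) ≈ suc n ×ᴿ z i
    middle i = ≈-trans
      (×-congˡ (trans (ℕ._∣_.equality (q∣C i)) (ℕ.*-comm (ℕ._∣_.quotient (q∣C i)) (suc n))))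
      (≈-sym (×-assocˡ _ (suc n) (ℕ._∣_.quotient (q∣C i))))

  sum^q : ∀ {q} → Prime q → ∀ {n} (f : Fin n → Carrier) → ((sum f) ^ᴿ q) ≈ sum (λ i → f i ^ᴿ q) mod q
  sum^q {q} pr {zero}  f = 0ᴿ , ≈-trans (0^q pr) (≈-sym (≈-trans (⊕-identityˡ _) (≈-sym (sum-× q {0} (λ ())))))
    where
    0^q : ∀ {m} → Prime m → 0ᴿ ^ᴿ m ≈ 0ᴿ
    0^q {zero}  pr with () ← prime⇒nonZero pr
    0^q {suc m} _  = ⊛-zeroˡ _
  sum^q {q} pr {suc n} f with freshman pr (f zero) (sum (λ i → f (suc i))) | sum^q pr (λ i → f (suc i))
  ... | a , eqa | b , eqb = a ⊕ b , (begin
    sum f ^ᴿ q                                                 ≈⟨ eqa ⟩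
    ((f zero ^ᴿ q) ⊕ (sum (λ i → f (suc i)) ^ᴿ q)) ⊕ (q ×ᴿ a)  ≈⟨ ⊕-congʳ (⊕-congˡ eqb) ⟩
    ((f zero ^ᴿ q) ⊕ (sum (λ i → f (suc i) ^ᴿ q) ⊕ (q ×ᴿ b))) ⊕ (q ×ᴿ a)
      ≈⟨ solve 4 (λ u s b a → ((u :+ (s :+ b)) :+ a) ⊜ ((u :+ s) :+ (a :+ b))) ≈-refl _ _ _ _ ⟩
    sum (λ i → f i ^ᴿ q) ⊕ ((q ×ᴿ a) ⊕ (q ×ᴿ b))               ≈⟨ ⊕-congˡ (×-distrib-+ a b q) ⟨
    sum (λ i → f i ^ᴿ q) ⊕ (q ×ᴿ (a ⊕ b))                      ∎)

-- Integer sums over finite sets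

δ : ∀ {n} → Fin n → Fin n → ℤ
δ x y = if ⌊ x Fin.≟ y ⌋ then 1ℤ else 0ℤ

δ-view : ∀ {n} (x y : Fin n) → (x ≡ y × δ x y ≡ 1ℤ) ⊎ (x ≢ y × δ x y ≡ 0ℤ)
δ-view x y with x Fin.≟ y
... | yes x≡y = inj₁ (x≡y , refl)
... | no  x≢y = inj₂ (x≢y , refl)

δ-≡ : ∀ {n} {x y : Fin n} → x ≡ y → δ x y ≡ 1ℤ
δ-≡ {x = x} {y} x≡y with δ-view x y
... | inj₁ (_ , eq)  = eq
... | inj₂ (x≢y , _) = contradiction x≡y x≢y

δ-≢ : ∀ {n} {x y : Fin n} → x ≢ y → δ x y ≡ 0ℤ
δ-≢ {x = x} {y} x≢y with δ-view x y
... | inj₁ (x≡y , _) = contradiction x≡y x≢y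
... | inj₂ (_ , eq)  = eq

δ-⇔ : ∀ {m n} {x y : Fin m} {x′ y′ : Fin n} → (x ≡ y → x′ ≡ y′) → (x′ ≡ y′ → x ≡ y) → δ x y ≡ δ x′ y′
δ-⇔ {x = x} {y} to from with δ-view x y
... | inj₁ (x≡y , eq) = trans eq (sym (δ-≡ (to x≡y)))
... | inj₂ (x≢y , eq) = trans eq (sym (δ-≢ (x≢y ∘ from)))

opaque
  -- Sealing the sum lets unification recover the summand.
  ∑ : ∀ {n} → (Fin n → ℤ) → ℤ
  ∑ = Sum.sum

  ∑-def : ∀ {n} (f : Fin n → ℤ) → ∑ f ≡ Sum.sum f
  ∑-def f = refl

  ∑-cong : ∀ {n} {f g : Fin n → ℤ} → f ≗ g → ∑ f ≡ ∑ g
  ∑-cong = Sum.sum-cong-≗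

  ∑-+ : ∀ {n} (f g : Fin n → ℤ) → ∑ (λ i → f i ℤ.+ g i) ≡ ∑ f ℤ.+ ∑ g
  ∑-+ = Sum.∑-distrib-+

  ∑-comm : ∀ {m n} (f : Fin m → Fin n → ℤ) → ∑ (λ i → ∑ (λ j → f i j)) ≡ ∑ (λ j → ∑ (λ i → f i j))
  ∑-comm = Sum.∑-comm

  ∑-permute : ∀ {n} (f : Fin n → ℤ) (π : Perm.Permutation n n) → ∑ f ≡ ∑ (λ i → f (π Perm.⟨$⟩ʳ i))
  ∑-permute = Sum.∑-permute

  ∑-*ˡ : ∀ {n} c (f : Fin n → ℤ) → c ℤ.* ∑ f ≡ ∑ (λ i → c ℤ.* f i)
  ∑-*ˡ = Sum.*-distribˡ-sum

  ∑-*ʳ : ∀ {n} c (f : Fin n → ℤ) → ∑ f ℤ.* c ≡ ∑ (λ i → f i ℤ.* c)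
  ∑-*ʳ = Sum.*-distribʳ-sum

  ∑-zero : ∀ {n} {f : Fin n → ℤ} → (∀ i → f i ≡ 0ℤ) → ∑ f ≡ 0ℤ
  ∑-zero {n} f≗0 = trans (∑-cong f≗0) (Sum.sum-replicate-zero n)

  ∑-const : ∀ n c → ∑ {n} (λ _ → c) ≡ ℤ.+ n ℤ.* c
  ∑-const zero    c = refl
  ∑-const (suc n) c = trans (cong (λ s → c ℤ.+ s) (∑-const n c)) (sym (ℤ.suc-* (ℤ.+ n) c))

  ∑-single : ∀ {n} (f : Fin n → ℤ) x → (∀ y → y ≢ x → f y ≡ 0ℤ) → ∑ f ≡ f x
  ∑-single f zero    f≡0 = trans (cong (λ s → f zero ℤ.+ s) (∑-zero λ i → f≡0 (suc i) λ ())) (ℤ.+-identityʳ _)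
  ∑-single f (suc x) f≡0 = trans
    (cong₂ ℤ._+_ (f≡0 zero λ ()) (∑-single (f ∘ suc) x λ y y≢x → f≡0 (suc y) (y≢x ∘ Fin.suc-injective)))
    (ℤ.+-identityˡ _)

  ∑-mono-≤ : ∀ {n} {f g : Fin n → ℤ} → (∀ i → f i ℤ.≤ g i) → ∑ f ℤ.≤ ∑ g
  ∑-mono-≤ {zero}  f≤g = ℤ.≤-refl
  ∑-mono-≤ {suc n} f≤g = ℤ.+-mono-≤ (f≤g zero) (∑-mono-≤ (f≤g ∘ suc))

  ∑-≡0⇒≡0 : ∀ {n} {f : Fin n → ℤ} → (∀ i → 0ℤ ℤ.≤ f i) → ∑ f ≡ 0ℤ → ∀ i → f i ≡ 0ℤ
  ∑-≡0⇒≡0 {suc n} {f} 0≤f ∑≡0 i = go i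
    where
    0≤tail : 0ℤ ℤ.≤ ∑ (f ∘ suc)
    0≤tail = subst (ℤ._≤ ∑ (f ∘ suc)) (∑-zero {n} λ _ → refl) (∑-mono-≤ (0≤f ∘ suc))
    head≡0 : f zero ≡ 0ℤ
    head≡0 = ℤ.≤-antisym (subst (f zero ℤ.≤_) ∑≡0
      (subst (ℤ._≤ f zero ℤ.+ ∑ (f ∘ suc)) (ℤ.+-identityʳ _) (ℤ.+-monoʳ-≤ (f zero) 0≤tail))) (0≤f zero)
    go : ∀ i → f i ≡ 0ℤ
    go zero    = head≡0
    go (suc i) = ∑-≡0⇒≡0 (0≤f ∘ suc) (trans (sym (ℤ.+-identityˡ _))
      (trans (cong (ℤ._+ ∑ (f ∘ suc)) (sym head≡0)) ∑≡0)) i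

  ∑-∣ : ∀ {n} d {f : Fin n → ℤ} → (∀ i → d ∣ f i) → d ∣ ∑ f
  ∑-∣ {zero}  d d∣f = divides 0ℤ refl
  ∑-∣ {suc n} d d∣f = ∣m∣n⇒∣m+n (d∣f zero) (∑-∣ d (d∣f ∘ suc))

∑-δˡ : ∀ {n} x (f : Fin n → ℤ) → ∑ (λ y → δ x y ℤ.* f y) ≡ f x
∑-δˡ x f = trans (∑-single _ x λ y y≢x → cong (ℤ._* f y) (δ-≢ (y≢x ∘ sym)))
                   (trans (cong (ℤ._* f x) (δ-≡ {x = x} refl)) (ℤ.*-identityˡ _))

δ-nonneg : ∀ {n} (x y : Fin n) → 0ℤ ℤ.≤ δ x y
δ-nonneg x y with δ-view x y
... | inj₁ (_ , eq) = subst (0ℤ ℤ.≤_) (sym eq) (ℤ.+≤+ z≤n)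
... | inj₂ (_ , eq) = ℤ.≤-reflexive (sym eq)

∑-nonneg : ∀ {n} {f : Fin n → ℤ} → (∀ i → 0ℤ ℤ.≤ f i) → 0ℤ ℤ.≤ ∑ f
∑-nonneg {n} {f} 0≤f = subst (ℤ._≤ ∑ f) (∑-zero {n} λ _ → refl) (∑-mono-≤ 0≤f)

-- Frobenius applied to a sum of `m` ones, whose q-th powers are again ones.
fermat : ∀ {q} → Prime q → ∀ m → ℤ.+ q ∣ ((ℤ.+ m) ℤ.^ q) ℤ.- ℤ.+ m
fermat {q} pr m with Frobenius.sum^q ℤ.+-*-commutativeSemiring pr {m} (λ _ → 1ℤ)
... | z , eq = divides z (begin
  ((ℤ.+ m) ℤ.^ q) ℤ.- ℤ.+ m
    ≡⟨ cong (ℤ._- ℤ.+ m) (trans (cong (ℤ._^ q) (sym ones)) (trans (sym (^≡^ _ q)) eq)) ⟩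
  Sum.sum {m} (λ _ → 1ℤ ℤE.^ q) ℤ.+ (q ℤM.× z) ℤ.- ℤ.+ m
    ≡⟨ cong₂ (λ a b → a ℤ.+ b ℤ.- ℤ.+ m) (trans (Sum.sum-cong-≗ {m} (λ _ → trans (^≡^ 1ℤ q) (ℤ.^-zeroˡ q))) ones)
      (×≡* q z) ⟩
  ℤ.+ m ℤ.+ ℤ.+ q ℤ.* z ℤ.- ℤ.+ m  ≡⟨ cancel (ℤ.+ m) (ℤ.+ q) z ⟩
  z ℤ.* ℤ.+ q                      ∎)
  where
  open ≡-Reasoning
  module ℤE = Algebra.Properties.Semiring.Exp ℤ.+-*-semiring
  module ℤM = Algebra.Properties.Semiring.Mult ℤ.+-*-semiring
  ^≡^ : ∀ x n → x ℤE.^ n ≡ x ℤ.^ n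
  ^≡^ x zero    = refl
  ^≡^ x (suc n) = cong (x ℤ.*_) (^≡^ x n)
  ×≡* : ∀ n x → n ℤM.× x ≡ ℤ.+ n ℤ.* x
  ×≡* zero    x = refl
  ×≡* (suc n) x = trans (cong (λ s → x ℤ.+ s) (×≡* n x)) (sym (ℤ.suc-* (ℤ.+ n) x))
  ones : Sum.sum {m} (λ _ → 1ℤ) ≡ ℤ.+ m
  ones = trans (sym (∑-def {m} (λ _ → 1ℤ))) (trans (∑-const m 1ℤ) (ℤ.*-identityʳ (ℤ.+ m)))
  cancel : ∀ s q z → s ℤ.+ q ℤ.* z ℤ.- s ≡ z ℤ.* q
  cancel = solve-∀

-- The group ring ℤ[G]

module GroupRing {v : ℕ} {_∙_ : Op₂ (Fin v)} {ε : Fin v} {_⁻¹ : Op₁ (Fin v)}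
  (isAbelianGroup : IsAbelianGroup _≡_ _∙_ ε _⁻¹) where

  open IsAbelianGroup isAbelianGroup public
    using (assoc; comm; identityˡ; identityʳ; inverseˡ; inverseʳ)

  G : AbelianGroup 0ℓ 0ℓ
  G = record { isAbelianGroup = isAbelianGroup }

  open Algebra.Properties.CommutativeMonoid.Mult (AbelianGroup.commutativeMonoid G) public
    using () renaming (_×_ to _·_; ×-homo-+ to ·-+; ×-assocˡ to ·-assoc; ×-distrib-+ to ·-∙; ×-homo-1 to 1·)
  open Algebra.Properties.Group (AbelianGroup.group G) public using
    (∙-cancelˡ; ∙-cancelʳ; inverseˡ-unique; ⁻¹-injective; ⁻¹-involutive)
  open ≡-Reasoning

  infixl 7 _⋆_

  ⁻¹-cancelˡ : ∀ x y → (x ⁻¹) ∙ (x ∙ y) ≡ y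
  ⁻¹-cancelˡ x y = trans (sym (assoc _ _ _)) (trans (cong (_∙ y) (inverseˡ x)) (identityˡ y))

  ⁻¹-cancelʳ : ∀ x y → x ∙ ((x ⁻¹) ∙ y) ≡ y
  ⁻¹-cancelʳ x y = trans (sym (assoc _ _ _)) (trans (cong (_∙ y) (inverseʳ x)) (identityˡ y))

  ∑-translate : ∀ a (f : Fin v → ℤ) → ∑ (λ x → f (a ∙ x)) ≡ ∑ f
  ∑-translate a f = sym (∑-permute f (Perm.permutation (a ∙_) ((a ⁻¹) ∙_) (⁻¹-cancelʳ a) (⁻¹-cancelˡ a)))

  ∑-inverse : ∀ (f : Fin v → ℤ) → ∑ (λ x → f (x ⁻¹)) ≡ ∑ f
  ∑-inverse f = sym (∑-permute f (Perm.permutation _⁻¹ _⁻¹ ⁻¹-involutive ⁻¹-involutive))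

  -- Pairing with test functions reduces the laws of ⋆ to those of ∙, without any reindexing.
  ⟨_,_⟩ : (f φ : Fin v → ℤ) → ℤ
  ⟨ f , φ ⟩ = ∑ (λ x → f x ℤ.* φ x)

  ⟨⟩-congʳ : ∀ f {φ ψ} → φ ≗ ψ → ⟨ f , φ ⟩ ≡ ⟨ f , ψ ⟩
  ⟨⟩-congʳ f φ≗ψ = ∑-cong (λ x → cong (f x ℤ.*_) (φ≗ψ x))

  ⟨⟩-ext : ∀ {f g} → (∀ φ → ⟨ f , φ ⟩ ≡ ⟨ g , φ ⟩) → f ≗ g
  ⟨⟩-ext {f} {g} eq x = trans (sym (evaluate f)) (trans (eq (δ x)) (evaluate g))
    where
    evaluate : ∀ h → ⟨ h , δ x ⟩ ≡ h x
    evaluate h = trans (∑-cong (λ y → ℤ.*-comm (h y) (δ x y))) (∑-δˡ x h)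

  -- The product of ℤ[G], a function standing for the formal sum with these coefficients.
  _⋆_ : (f g : Fin v → ℤ) → Fin v → ℤ
  (f ⋆ g) x = ∑ (λ y → f y ℤ.* g ((y ⁻¹) ∙ x))

  -- Substituting x = y ∙ z in the inner sum removes the inverse from the convolution; this is the
  -- only place where the product has to be reindexed for the ring laws below.
  ⟨⟩-⋆ : ∀ f g φ → ⟨ f ⋆ g , φ ⟩ ≡ ⟨ f , (λ y → ⟨ g , (λ z → φ (y ∙ z)) ⟩) ⟩
  ⟨⟩-⋆ f g φ = begin
    ∑ (λ x → ∑ (λ y → f y ℤ.* g ((y ⁻¹) ∙ x)) ℤ.* φ x)  ≡⟨ ∑-cong (λ x → ∑-*ʳ (φ x) _) ⟩
    ∑ (λ x → ∑ (λ y → f y ℤ.* g ((y ⁻¹) ∙ x) ℤ.* φ x))  ≡⟨ ∑-comm (λ x y → f y ℤ.* g ((y ⁻¹) ∙ x) ℤ.* φ x) ⟩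
    ∑ (λ y → ∑ (λ x → f y ℤ.* g ((y ⁻¹) ∙ x) ℤ.* φ x))  ≡⟨ ∑-cong (λ y → sym (∑-translate y _)) ⟩
    ∑ (λ y → ∑ (λ z → f y ℤ.* g ((y ⁻¹) ∙ (y ∙ z)) ℤ.* φ (y ∙ z)))
      ≡⟨ ∑-cong (λ y → ∑-cong (λ z → trans (cong (λ w → f y ℤ.* g w ℤ.* φ (y ∙ z)) (⁻¹-cancelˡ y z))
        (ℤ.*-assoc (f y) _ _))) ⟩
    ∑ (λ y → ∑ (λ z → f y ℤ.* (g z ℤ.* φ (y ∙ z))))     ≡⟨ ∑-cong (λ y → ∑-*ˡ (f y) (λ z → g z ℤ.* φ (y ∙ z))) ⟨
    ⟨ f , (λ y → ⟨ g , (λ z → φ (y ∙ z)) ⟩) ⟩           ∎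

  ⋆-cong : ∀ {f f′ g g′} → f ≗ f′ → g ≗ g′ → f ⋆ g ≗ f′ ⋆ g′
  ⋆-cong f≗f′ g≗g′ x = ∑-cong (λ y → cong₂ ℤ._*_ (f≗f′ y) (g≗g′ _))

  ⋆-assoc : ∀ f g h → (f ⋆ g) ⋆ h ≗ f ⋆ (g ⋆ h)
  ⋆-assoc f g h = ⟨⟩-ext λ φ → begin
    ⟨ (f ⋆ g) ⋆ h , φ ⟩                                              ≡⟨ ⟨⟩-⋆ (f ⋆ g) h φ ⟩
    ⟨ f ⋆ g , (λ y → ⟨ h , (λ z → φ (y ∙ z)) ⟩) ⟩                    ≡⟨ ⟨⟩-⋆ f g _ ⟩
    ⟨ f , (λ x → ⟨ g , (λ y → ⟨ h , (λ z → φ ((x ∙ y) ∙ z)) ⟩) ⟩) ⟩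
      ≡⟨ ⟨⟩-congʳ f (λ x → ⟨⟩-congʳ g λ y → ⟨⟩-congʳ h λ z → cong φ (assoc x y z)) ⟩
    ⟨ f , (λ x → ⟨ g , (λ y → ⟨ h , (λ z → φ (x ∙ (y ∙ z))) ⟩) ⟩) ⟩  ≡⟨ ⟨⟩-congʳ f (λ x → ⟨⟩-⋆ g h _) ⟨
    ⟨ f , (λ x → ⟨ g ⋆ h , (λ y → φ (x ∙ y)) ⟩) ⟩                    ≡⟨ ⟨⟩-⋆ f (g ⋆ h) φ ⟨
    ⟨ f ⋆ (g ⋆ h) , φ ⟩                                              ∎

  ⋆-comm : ∀ f g → f ⋆ g ≗ g ⋆ f
  ⋆-comm f g = ⟨⟩-ext λ φ → begin
    ⟨ f ⋆ g , φ ⟩                                    ≡⟨ ⟨⟩-⋆ f g φ ⟩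
    ∑ (λ y → f y ℤ.* ∑ (λ z → g z ℤ.* φ (y ∙ z)))    ≡⟨ ∑-cong (λ y → ∑-*ˡ (f y) _) ⟩
    ∑ (λ y → ∑ (λ z → f y ℤ.* (g z ℤ.* φ (y ∙ z))))  ≡⟨ ∑-comm (λ y z → f y ℤ.* (g z ℤ.* φ (y ∙ z))) ⟩
    ∑ (λ z → ∑ (λ y → f y ℤ.* (g z ℤ.* φ (y ∙ z))))  ≡⟨ ∑-cong (λ z → ∑-cong (λ y → swap y z φ)) ⟩
    ∑ (λ z → ∑ (λ y → g z ℤ.* (f y ℤ.* φ (z ∙ y))))  ≡⟨ ∑-cong (λ z → ∑-*ˡ (g z) (λ y → f y ℤ.* φ (z ∙ y))) ⟨
    ∑ (λ z → g z ℤ.* ∑ (λ y → f y ℤ.* φ (z ∙ y)))    ≡⟨ ⟨⟩-⋆ g f φ ⟨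
    ⟨ g ⋆ f , φ ⟩                                    ∎
    where
    swap : ∀ y z φ → f y ℤ.* (g z ℤ.* φ (y ∙ z)) ≡ g z ℤ.* (f y ℤ.* φ (z ∙ y))
    swap y z φ = begin
      f y ℤ.* (g z ℤ.* φ (y ∙ z))  ≡⟨ ℤ.*-assoc (f y) (g z) _ ⟨
      (f y ℤ.* g z) ℤ.* φ (y ∙ z)  ≡⟨ cong₂ ℤ._*_ (ℤ.*-comm (f y) (g z)) (cong φ (comm y z)) ⟩
      (g z ℤ.* f y) ℤ.* φ (z ∙ y)  ≡⟨ ℤ.*-assoc (g z) (f y) _ ⟩
      g z ℤ.* (f y ℤ.* φ (z ∙ y))  ∎

  ε⁻¹∙ : ∀ x → (ε ⁻¹) ∙ x ≡ x
  ε⁻¹∙ x = trans (sym (identityˡ _)) (⁻¹-cancelʳ ε x)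

  ⋆-identityˡ : ∀ f → δ ε ⋆ f ≗ f
  ⋆-identityˡ f x = trans (∑-δˡ ε (λ y → f ((y ⁻¹) ∙ x))) (cong f (ε⁻¹∙ x))

  const-⋆ : ∀ c f x → ((λ _ → c) ⋆ f) x ≡ c ℤ.* ∑ f
  const-⋆ c f x = trans (sym (∑-*ˡ c (λ y → f ((y ⁻¹) ∙ x)))) (cong (c ℤ.*_)
    (trans (∑-inverse (λ y → f (y ∙ x))) (trans (∑-cong (λ y → cong f (comm y x))) (∑-translate x f))))

  ⋆-distribʳ : ∀ f g h → (λ x → g x ℤ.+ h x) ⋆ f ≗ (λ x → (g ⋆ f) x ℤ.+ (h ⋆ f) x)
  ⋆-distribʳ f g h x = trans (∑-cong (λ y → ℤ.*-distribʳ-+ (f ((y ⁻¹) ∙ x)) (g y) (h y)))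
    (∑-+ (λ y → g y ℤ.* f ((y ⁻¹) ∙ x)) (λ y → h y ℤ.* f ((y ⁻¹) ∙ x)))

  groupRing : CommutativeSemiring 0ℓ 0ℓ
  groupRing = record
    { Carrier = Fin v → ℤ
    ; _≈_ = _≗_
    ; _+_ = λ f g x → f x ℤ.+ g x
    ; _*_ = _⋆_
    ; 0# = λ _ → 0ℤ
    ; 1# = δ ε
    ; isCommutativeSemiring = isCommutativeSemiringˡ record
      { +-isCommutativeMonoid = +-isCommutativeMonoid
      ; *-isCommutativeMonoid = isCommutativeMonoidˡ record
        { isSemigroup = record
          { isMagma = record
            { isEquivalence = Pointwise.isEquivalence (Fin v) isEquivalence
            ; ∙-cong = ⋆-cong }
          ; assoc = ⋆-assoc }
        ; identityˡ = ⋆-identityˡ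
        ; comm = ⋆-comm }
      ; distribʳ = ⋆-distribʳ
      ; zeroˡ = λ f x → ∑-zero (λ y → refl)
      }
    }
    where
    +-isCommutativeMonoid : IsCommutativeMonoid _≗_ (λ (f g : Fin v → ℤ) x → f x ℤ.+ g x) (λ _ → 0ℤ)
    +-isCommutativeMonoid = Pointwise.isCommutativeMonoid (Fin v) ℤ.+-0-isCommutativeMonoid

  v≢0 : v ≢ 0
  v≢0 v≡0 with () ← subst Fin v≡0 ε

  ·-ε : ∀ n → n · ε ≡ ε
  ·-ε zero    = refl
  ·-ε (suc n) = trans (identityˡ _) (·-ε n)

  ·-⁻¹ : ∀ n x → n · (x ⁻¹) ≡ (n · x) ⁻¹
  ·-⁻¹ n x = inverseˡ-unique _ _ (trans (sym (·-∙ (x ⁻¹) x n)) (trans (cong (n ·_) (inverseˡ x)) (·-ε n)))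

  ·-comm : ∀ m n x → m · (n · x) ≡ n · (m · x)
  ·-comm m n x = trans (·-assoc x m n) (trans (cong (_· x) (ℕ.*-comm m n)) (sym (·-assoc x n m)))

  ·-multiple : ∀ m n {x} → n · x ≡ ε → (m * n) · x ≡ ε
  ·-multiple m n n·x≡ε = trans (sym (·-assoc _ m n)) (trans (cong (m ·_) n·x≡ε) (·-ε m))

  -- Translation by g permutes the group, so the product of all elements is unchanged when it is
  -- multiplied by `v · g`.
  order·≡ε : ∀ g → v · g ≡ ε
  order·≡ε g = ∙-cancelʳ (GS.sum (λ x → x)) _ _ (begin
    (v · g) ∙ GS.sum (λ x → x)               ≡⟨ cong (_∙ GS.sum (λ x → x)) (GS.sum-replicate v) ⟨
    GS.sum {v} (λ _ → g) ∙ GS.sum (λ x → x)  ≡⟨ GS.∑-distrib-+ {v} (λ _ → g) (λ x → x) ⟨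
    GS.sum (λ x → g ∙ x)
      ≡⟨ GS.sum-permute (λ x → x) (Perm.permutation (g ∙_) ((g ⁻¹) ∙_) (⁻¹-cancelʳ g) (⁻¹-cancelˡ g)) ⟨
    GS.sum (λ x → x)                         ≡⟨ identityˡ _ ⟨
    ε ∙ GS.sum (λ x → x)                     ∎)
    where module GS = Algebra.Properties.CommutativeMonoid.Sum (AbelianGroup.commutativeMonoid G)

  bézout-cancel : ∀ {g x m n} a b → 1 + b * n ≡ a * m → m · g ≡ m · x → n · g ≡ n · x → g ≡ x
  bézout-cancel {g} {x} {m} {n} a b eq mg≡mx ng≡nx = ∙-cancelʳ ((b * n) · g) _ _ (begin
    g ∙ ((b * n) · g)  ≡⟨ cong (_· g) eq ⟩
    (a * m) · g        ≡⟨ ·-assoc g a m ⟨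
    a · (m · g)        ≡⟨ cong (a ·_) mg≡mx ⟩
    a · (m · x)        ≡⟨ ·-assoc x a m ⟩
    (a * m) · x        ≡⟨ cong (_· x) eq ⟨
    x ∙ ((b * n) · x)
      ≡⟨ cong (x ∙_) (trans (sym (·-assoc x b n)) (trans (cong (b ·_) (sym ng≡nx)) (·-assoc g b n))) ⟩
    x ∙ ((b * n) · g)  ∎)

  -- Bézout recovers an element from its multiples by q and n. Over ℕ the negative term stands on
  -- the other side, whence the two orientations.
  coprime-cancel : ∀ {q n} → Coprime q n → ∀ {g x} → q · g ≡ q · x → n · g ≡ n · x → g ≡ x
  coprime-cancel q⊥n qg≡qx ng≡nx with coprime-Bézout q⊥n
  ... | Bézout.Identity.+- a b eq = bézout-cancel a b eq qg≡qx ng≡nx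
  ... | Bézout.Identity.-+ a b eq = bézout-cancel b a eq ng≡nx qg≡qx

  private
    module R = CommutativeSemiring groupRing
    module RS = Algebra.Properties.Semiring.Sum R.semiring
    module RM = Algebra.Properties.Semiring.Mult R.semiring
  open Algebra.Properties.Semiring.Exp R.semiring public using () renaming (_^_ to _^⋆_; ^-congˡ to ^⋆-cong)

  infixr 7 _•_
  _•_ : ℤ → (Fin v → ℤ) → Fin v → ℤ
  (c • f) x = c ℤ.* f x

  •-⋆ : ∀ c f g → (c • f) ⋆ g ≗ c • (f ⋆ g)
  •-⋆ c f g x = trans (∑-cong (λ y → ℤ.*-assoc c (f y) _)) (sym (∑-*ˡ c _))

  ⋆-• : ∀ c f g → f ⋆ (c • g) ≗ c • (f ⋆ g)
  ⋆-• c f g x = trans (⋆-comm f (c • g) x) (trans (•-⋆ c g f x) (cong (c ℤ.*_) (⋆-comm g f x)))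

  ^⋆-suc : ∀ c f → f ⋆ f ≗ c • f → ∀ n → f ^⋆ suc n ≗ (c ℤ.^ n) • f
  ^⋆-suc c f f²≗cf zero    x = trans (⋆-comm f (δ ε) x) (trans (⋆-identityˡ f x) (sym (ℤ.*-identityˡ (f x))))
  ^⋆-suc c f f²≗cf (suc n) x = begin
    (f ⋆ (f ^⋆ suc n)) x     ≡⟨ ⋆-cong {f} (λ _ → refl) (^⋆-suc c f f²≗cf n) x ⟩
    (f ⋆ ((c ℤ.^ n) • f)) x  ≡⟨ ⋆-• (c ℤ.^ n) f f x ⟩
    c ℤ.^ n ℤ.* (f ⋆ f) x    ≡⟨ cong (c ℤ.^ n ℤ.*_) (f²≗cf x) ⟩
    c ℤ.^ n ℤ.* (c ℤ.* f x)  ≡⟨ ℤ.*-assoc (c ℤ.^ n) c (f x) ⟨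
    c ℤ.^ n ℤ.* c ℤ.* f x    ≡⟨ cong (ℤ._* f x) (ℤ.*-comm (c ℤ.^ n) c) ⟩
    c ℤ.* c ℤ.^ n ℤ.* f x    ∎

  -- Two factors f are traded for a scalar c at each step. It is used for W³ = v W and an odd prime
  -- exponent.
  ^⋆-odd : ∀ c f → f ⋆ (f ⋆ f) ≗ c • f → ∀ n → f ^⋆ suc (n * 2) ≗ (c ℤ.^ n) • f
  ^⋆-odd c f f³≗cf zero    x = trans (⋆-comm f (δ ε) x) (trans (⋆-identityˡ f x) (sym (ℤ.*-identityˡ (f x))))
  ^⋆-odd c f f³≗cf (suc n) x = begin
    (f ⋆ (f ⋆ (f ^⋆ suc (n * 2)))) x  ≡⟨ ⋆-cong {f} (λ _ → refl) (⋆-cong {f} (λ _ → refl) (^⋆-odd c f f³≗cf n)) x ⟩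
    (f ⋆ (f ⋆ ((c ℤ.^ n) • f))) x     ≡⟨ ⋆-cong {f} (λ _ → refl) (⋆-• (c ℤ.^ n) f f) x ⟩
    (f ⋆ ((c ℤ.^ n) • (f ⋆ f))) x     ≡⟨ ⋆-• (c ℤ.^ n) f (f ⋆ f) x ⟩
    c ℤ.^ n ℤ.* (f ⋆ (f ⋆ f)) x       ≡⟨ cong (c ℤ.^ n ℤ.*_) (f³≗cf x) ⟩
    c ℤ.^ n ℤ.* (c ℤ.* f x)           ≡⟨ ℤ.*-assoc (c ℤ.^ n) c (f x) ⟨
    c ℤ.^ n ℤ.* c ℤ.* f x             ≡⟨ cong (ℤ._* f x) (ℤ.*-comm (c ℤ.^ n) c) ⟩
    c ℤ.* c ℤ.^ n ℤ.* f x             ∎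

  -- Monomials; their powers stay monomials, so Frobenius is explicit on them.
  _↑_ : ℤ → Fin v → Fin v → ℤ
  c ↑ g = c • δ g

  ⟨⟩-↑ : ∀ c g φ → ⟨ c ↑ g , φ ⟩ ≡ c ℤ.* φ g
  ⟨⟩-↑ c g φ = trans (∑-cong (λ x → ℤ.*-assoc c (δ g x) (φ x))) (trans (sym (∑-*ˡ c _)) (cong (c ℤ.*_) (∑-δˡ g φ)))

  ↑-⋆ : ∀ c d g h → (c ↑ g) ⋆ (d ↑ h) ≗ (c ℤ.* d) ↑ (g ∙ h)
  ↑-⋆ c d g h = ⟨⟩-ext λ φ → begin
    ⟨ (c ↑ g) ⋆ (d ↑ h) , φ ⟩                          ≡⟨ ⟨⟩-⋆ (c ↑ g) (d ↑ h) φ ⟩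
    ⟨ c ↑ g , (λ y → ⟨ d ↑ h , (λ z → φ (y ∙ z)) ⟩) ⟩  ≡⟨ ⟨⟩-↑ c g _ ⟩
    c ℤ.* ⟨ d ↑ h , (λ z → φ (g ∙ z)) ⟩                ≡⟨ cong (c ℤ.*_) (⟨⟩-↑ d h _) ⟩
    c ℤ.* (d ℤ.* φ (g ∙ h))                            ≡⟨ ℤ.*-assoc c d _ ⟨
    c ℤ.* d ℤ.* φ (g ∙ h)                              ≡⟨ ⟨⟩-↑ (c ℤ.* d) (g ∙ h) φ ⟨
    ⟨ (c ℤ.* d) ↑ (g ∙ h) , φ ⟩                        ∎

  ↑-^⋆ : ∀ c g n → (c ↑ g) ^⋆ n ≗ (c ℤ.^ n) ↑ (n · g)
  ↑-^⋆ c g zero    x = sym (ℤ.*-identityˡ _)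
  ↑-^⋆ c g (suc n) x = trans (⋆-cong {c ↑ g} (λ _ → refl) (↑-^⋆ c g n) x) (↑-⋆ c (c ℤ.^ n) g (n · g) x)

  ring-sum-eval : ∀ {n} (F : Fin n → Fin v → ℤ) x → RS.sum F x ≡ ∑ (λ i → F i x)
  ring-sum-eval F x = trans (eval F) (sym (∑-def _))
    where
    eval : ∀ {n} (F : Fin n → Fin v → ℤ) → RS.sum F x ≡ Sum.sum (λ i → F i x)
    eval {zero}  F = refl
    eval {suc n} F = cong (λ s → F zero x ℤ.+ s) (eval (λ i → F (suc i)))

  ring-×-eval : ∀ n f x → (n RM.× f) x ≡ ℤ.+ n ℤ.* f x
  ring-×-eval zero    f x = refl
  ring-×-eval (suc n) f x = trans (cong (λ s → f x ℤ.+ s) (ring-×-eval n f x)) (sym (ℤ.suc-* (ℤ.+ n) (f x)))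

  ↑-sum : ∀ f → RS.sum (λ g → f g ↑ g) ≗ f
  ↑-sum f x = trans (ring-sum-eval (λ g → f g ↑ g) x)
    (trans (∑-single _ x λ y y≢x → trans (cong (f y ℤ.*_) (δ-≢ y≢x)) (ℤ.*-zeroʳ (f y)))
    (trans (cong (f x ℤ.*_) (δ-≡ {x = x} refl)) (ℤ.*-identityʳ (f x))))

  -- An element is the sum of its monomials, and the q-th power of a monomial at g is a monomial at
  -- `q · g`.
  frobenius : ∀ {q} → Prime q → ∀ f x → ℤ.+ q ∣ (f ^⋆ q) x ℤ.- ∑ (λ g → f g ℤ.^ q ℤ.* δ (q · g) x)
  frobenius {q} pr f x with Frobenius.sum^q groupRing pr (λ g → f g ↑ g)
  ... | z , eq = divides (z x) (begin
    (f ^⋆ q) x ℤ.- S                       ≡⟨ cong (ℤ._- S) (^⋆-cong q (↑-sum f) x) ⟨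
    (RS.sum (λ g → f g ↑ g) ^⋆ q) x ℤ.- S  ≡⟨ cong (ℤ._- S) (eq x) ⟩
    RS.sum (λ g → (f g ↑ g) ^⋆ q) x ℤ.+ (q RM.× z) x ℤ.- S
      ≡⟨ cong₂ (λ a b → a ℤ.+ b ℤ.- S) (trans (ring-sum-eval _ x) (∑-cong (λ g → ↑-^⋆ (f g) g q x)))
        (ring-×-eval q z x) ⟩
    S ℤ.+ ℤ.+ q ℤ.* z x ℤ.- S              ≡⟨ cancel S (ℤ.+ q) (z x) ⟩
    z x ℤ.* ℤ.+ q                          ∎)
    where
    S = ∑ (λ g → f g ℤ.^ q ℤ.* δ (q · g) x)
    cancel : ∀ s q z → s ℤ.+ q ℤ.* z ℤ.- s ≡ z ℤ.* q
    cancel = solve-∀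

  -- The support lies in one coset of the n-torsion, and multiplication by q is injective there. So
  -- x is the only point of the support that contributes to the coefficient at `q · x`.
  frobenius-at : ∀ {q n} → Prime q → Coprime q n → ∀ f x → (∀ g → f g ≢ 0ℤ → n · g ≡ n · x) →
                 ℤ.+ q ∣ (f ^⋆ q) (q · x) ℤ.- f x ℤ.^ q
  frobenius-at {q} {n} pr q⊥n f x supp = subst (λ s → ℤ.+ q ∣ (f ^⋆ q) (q · x) ℤ.- s) S≡ (frobenius pr f (q · x))
    where
    off : ∀ g → g ≢ x → f g ℤ.^ q ℤ.* δ (q · g) (q · x) ≡ 0ℤ
    off g g≢x with f g ℤ.≟ 0ℤ | δ-view (q · g) (q · x)
    ... | _        | inj₂ (_ , δ≡0)     = trans (cong (f g ℤ.^ q ℤ.*_) δ≡0) (ℤ.*-zeroʳ (f g ℤ.^ q))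
    ... | yes fg≡0 | inj₁ _ rewrite fg≡0 = cong (ℤ._* δ (q · g) (q · x)) (0^ pr)
      where
      0^ : ∀ {q} → Prime q → 0ℤ ℤ.^ q ≡ 0ℤ
      0^ {suc q} _ = refl
      0^ {zero} pr with () ← prime⇒nonZero pr
    ... | no  fg≢0 | inj₁ (qg≡qx , _) = contradiction (coprime-cancel q⊥n qg≡qx (supp g fg≢0)) g≢x
    S≡ : ∑ (λ g → f g ℤ.^ q ℤ.* δ (q · g) (q · x)) ≡ f x ℤ.^ q
    S≡ = trans (∑-single _ x off) (trans (cong (f x ℤ.^ q ℤ.*_) (δ-≡ {x = q · x} refl)) (ℤ.*-identityʳ _))

  -- The endomorphism of the ring ℤ[G] induced by g ↦ n g.
  push : ℕ → (Fin v → ℤ) → Fin v → ℤ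
  push n f y = ∑ (λ g → f g ℤ.* δ (n · g) y)

  ⟨⟩-push : ∀ n f φ → ⟨ push n f , φ ⟩ ≡ ⟨ f , (λ g → φ (n · g)) ⟩
  ⟨⟩-push n f φ = begin
    ∑ (λ y → ∑ (λ g → f g ℤ.* δ (n · g) y) ℤ.* φ y)    ≡⟨ ∑-cong (λ y → ∑-*ʳ (φ y) _) ⟩
    ∑ (λ y → ∑ (λ g → f g ℤ.* δ (n · g) y ℤ.* φ y))    ≡⟨ ∑-comm (λ y g → f g ℤ.* δ (n · g) y ℤ.* φ y) ⟩
    ∑ (λ g → ∑ (λ y → f g ℤ.* δ (n · g) y ℤ.* φ y))    ≡⟨ ∑-cong (λ g → ∑-cong (λ y → ℤ.*-assoc (f g) _ (φ y))) ⟩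
    ∑ (λ g → ∑ (λ y → f g ℤ.* (δ (n · g) y ℤ.* φ y)))  ≡⟨ ∑-cong (λ g → ∑-*ˡ (f g) _) ⟨
    ∑ (λ g → f g ℤ.* ∑ (λ y → δ (n · g) y ℤ.* φ y))    ≡⟨ ∑-cong (λ g → cong (f g ℤ.*_) (∑-δˡ (n · g) φ)) ⟩
    ∑ (λ g → f g ℤ.* φ (n · g))                        ∎

  push-⋆ : ∀ n f g → push n f ⋆ push n g ≗ push n (f ⋆ g)
  push-⋆ n f g = ⟨⟩-ext λ φ → begin
    ⟨ push n f ⋆ push n g , φ ⟩                              ≡⟨ ⟨⟩-⋆ (push n f) (push n g) φ ⟩
    ⟨ push n f , (λ y → ⟨ push n g , (λ z → φ (y ∙ z)) ⟩) ⟩  ≡⟨ ⟨⟩-push n f _ ⟩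
    ⟨ f , (λ x → ⟨ push n g , (λ z → φ ((n · x) ∙ z)) ⟩) ⟩   ≡⟨ ⟨⟩-congʳ f (λ x → ⟨⟩-push n g _) ⟩
    ⟨ f , (λ x → ⟨ g , (λ z → φ ((n · x) ∙ (n · z))) ⟩) ⟩
      ≡⟨ ⟨⟩-congʳ f (λ x → ⟨⟩-congʳ g (λ z → cong φ (·-∙ x z n))) ⟨
    ⟨ f , (λ x → ⟨ g , (λ z → φ (n · (x ∙ z))) ⟩) ⟩          ≡⟨ ⟨⟩-⋆ f g (λ x → φ (n · x)) ⟨
    ⟨ f ⋆ g , (λ x → φ (n · x)) ⟩                            ≡⟨ ⟨⟩-push n (f ⋆ g) φ ⟨
    ⟨ push n (f ⋆ g) , φ ⟩                                   ∎

-- Kernels and fibres of multiplication by n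

module Kernels {v : ℕ} {_∙_ : Op₂ (Fin v)} {ε : Fin v} {_⁻¹ : Op₁ (Fin v)}
  (isAbelianGroup : IsAbelianGroup _≡_ _∙_ ε _⁻¹) where

  open GroupRing isAbelianGroup
  open ≡-Reasoning

  fibre : ℕ → Fin v → ℤ
  fibre n y = ∑ (λ g → δ (n · g) y)

  kernel : ℕ → Fin v → ℤ
  kernel n g = δ (n · g) ε

  -- A non-empty fibre is a coset of the kernel: translation by one of its points carries the kernel
  -- onto it.
  fibre-view : ∀ n y → (∃ λ x → n · x ≡ y × fibre n y ≡ fibre n ε) ⊎ ((∀ x → n · x ≢ y) × fibre n y ≡ 0ℤ)
  fibre-view n y with Fin.any? (λ x → (n · x) Fin.≟ y)
  ... | no  ∄x = inj₂ ((λ x nx≡y → ∄x (x , nx≡y)) , ∑-zero (λ g → δ-≢ (λ ng≡y → ∄x (g , ng≡y))))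
  ... | yes (x , nx≡y) = inj₁ (x , nx≡y , (begin
    ∑ (λ g → δ (n · g) y)        ≡⟨ ∑-translate x (λ g → δ (n · g) y) ⟨
    ∑ (λ g → δ (n · (x ∙ g)) y)  ≡⟨ ∑-cong (λ g → δ-⇔ (to g) (from g)) ⟩
    ∑ (λ g → δ (n · g) ε)        ∎))
    where
    n·[x∙g] : ∀ g → n · (x ∙ g) ≡ y ∙ (n · g)
    n·[x∙g] g = trans (·-∙ x g n) (cong (_∙ (n · g)) nx≡y)
    to : ∀ g → n · (x ∙ g) ≡ y → n · g ≡ ε
    to g eq = trans (sym (⁻¹-cancelˡ y (n · g)))
      (trans (cong ((y ⁻¹) ∙_) (trans (sym (n·[x∙g] g)) eq)) (inverseˡ y))
    from : ∀ g → n · g ≡ ε → n · (x ∙ g) ≡ y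
    from g ng≡ε = trans (n·[x∙g] g) (trans (cong (y ∙_) ng≡ε) (identityʳ y))

  ∑-fibre : ∀ n → ∑ (fibre n) ≡ ℤ.+ v
  ∑-fibre n = begin
    ∑ (λ y → ∑ (λ g → δ (n · g) y))  ≡⟨ ∑-comm (λ y g → δ (n · g) y) ⟩
    ∑ (λ g → ∑ (λ y → δ (n · g) y))
      ≡⟨ ∑-cong (λ g → trans (∑-cong (λ y → sym (ℤ.*-identityʳ _))) (∑-δˡ (n · g) (λ _ → 1ℤ))) ⟩
    ∑ {v} (λ g → 1ℤ)                 ≡⟨ ∑-const v 1ℤ ⟩
    ℤ.+ v ℤ.* 1ℤ                     ≡⟨ ℤ.*-identityʳ (ℤ.+ v) ⟩
    ℤ.+ v                            ∎

  kernelSize : ℕ → ℕ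
  kernelSize n = ℤ.∣ fibre n ε ∣

  +kernelSize : ∀ n → ℤ.+ kernelSize n ≡ fibre n ε
  +kernelSize n = ℤ.0≤i⇒+∣i∣≡i (∑-nonneg (λ g → δ-nonneg (n · g) ε))

  -- The fibres partition the group, and each is empty or as large as the kernel.
  kernelSize∣v : ∀ n → kernelSize n ℕ.∣ v
  kernelSize∣v n = ∣⇒∣ᵤ (subst (fibre n ε ∣_) (∑-fibre n) (∑-∣ (fibre n ε) fibre∣))
    where
    fibre∣ : ∀ y → fibre n ε ∣ fibre n y
    fibre∣ y with fibre-view n y
    ... | inj₁ (_ , _ , eq) = divides 1ℤ (trans eq (sym (ℤ.*-identityˡ _)))
    ... | inj₂ (_ , eq)     = divides 0ℤ eq

  -- The kernel is a subgroup: translation by any of its elements leaves its indicator unchanged.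
  kernel-⋆ : ∀ n → kernel n ⋆ kernel n ≗ fibre n ε • kernel n
  kernel-⋆ n x = trans (∑-cong term) (sym (∑-*ʳ (kernel n x) _))
    where
    term : ∀ y → kernel n y ℤ.* kernel n ((y ⁻¹) ∙ x) ≡ kernel n y ℤ.* kernel n x
    term y with δ-view (n · y) ε
    ... | inj₂ (_ , eq) rewrite eq = refl
    ... | inj₁ (ny≡ε , _) = cong (λ z → kernel n y ℤ.* δ z ε) (begin
      n · ((y ⁻¹) ∙ x)        ≡⟨ ·-∙ (y ⁻¹) x n ⟩
      (n · (y ⁻¹)) ∙ (n · x)  ≡⟨ cong (_∙ (n · x)) (trans (·-⁻¹ n y) (cong _⁻¹ ny≡ε)) ⟩
      (ε ⁻¹) ∙ (n · x)        ≡⟨ ε⁻¹∙ (n · x) ⟩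
      n · x                   ∎)

  -- With S the indicator of the kernel, S ⋆ S = |S| S, so q dividing |S| would make S^q vanish
  -- modulo q, while its value at the identity is 1 as soon as q acts injectively on the kernel.
  cauchy : ∀ {q} → Prime q → ∀ n → q ℕ.∣ kernelSize n → q ℕ.∣ n
  cauchy {q} pr n q∣size with q ℕ.∣? n
  ... | yes q∣n = q∣n
  ... | no  q∤n = contradiction (∣⇒∣ᵤ (subst (ℤ.+ q ∣_) (1^ q) q∣1^q)) (prime∤1 pr)
    where
    S^q : ∀ {q} → Prime q → ℤ.+ q ∣ fibre n ε → ∀ x → ℤ.+ q ∣ (kernel n ^⋆ q) x
    S^q {zero} pr with () ← prime⇒nonZero pr
    S^q {suc zero} pr = contradiction (prime≥2 pr) λ where (s≤s ())
    S^q {suc (suc l)} pr (divides c eq) x = divides (c ℤ.* (fibre n ε ℤ.^ l ℤ.* kernel n x))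
      (trans (^⋆-suc (fibre n ε) (kernel n) (kernel-⋆ n) (suc l) x)
        (trans (cong (λ a → a ℤ.* fibre n ε ℤ.^ l ℤ.* kernel n x) eq) (regroup c _ _ _)))
      where
      regroup : ∀ c q a b → c ℤ.* q ℤ.* a ℤ.* b ≡ c ℤ.* (a ℤ.* b) ℤ.* q
      regroup = solve-∀
    1^ : ∀ q → kernel n ε ℤ.^ q ≡ 1ℤ
    1^ q = trans (cong (ℤ._^ q) (δ-≡ (·-ε n))) (ℤ.^-zeroˡ q)
    support : ∀ g → kernel n g ≢ 0ℤ → n · g ≡ n · ε
    support g Sg≢0 with δ-view (n · g) ε
    ... | inj₁ (ng≡ε , _) = trans ng≡ε (sym (·-ε n))
    ... | inj₂ (_ , eq)   = contradiction eq Sg≢0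
    q∣1^q : ℤ.+ q ∣ kernel n ε ℤ.^ q
    q∣1^q = ∣m-n∣m⇒∣n (frobenius-at pr (prime∤⇒coprime pr q∤n) (kernel n) ε support)
                      (S^q pr (subst (ℤ.+ q ∣_) (+kernelSize n) (∣ᵤ⇒∣ q∣size)) (q · ε))

  -- By `cauchy` the primes dividing the size of the kernel divide a, so this size is coprime to b;
  -- as it divides a b, it divides a.
  kernelSize≤ : ∀ {a b} → Coprime a b → a * b ≡ v → kernelSize a ≤ a
  kernelSize≤ {zero}      a⊥b ab≡v = contradiction (sym ab≡v) v≢0
  kernelSize≤ {a@(suc _)} {b} a⊥b ab≡v =
    ℕ.∣⇒≤ (coprime-divisor {n = b} size⊥b
      (subst (kernelSize a ℕ.∣_) (trans (sym ab≡v) (ℕ.*-comm a b)) (kernelSize∣v a)))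
    where
    size≢0 : NonZero (kernelSize a)
    size≢0 = ≢-nonZero λ size≡0 → v≢0 (ℕ.0∣⇒≡0 (subst (ℕ._∣ v) size≡0 (kernelSize∣v a)))
    size⊥b : Coprime (kernelSize a) b
    size⊥b = coprime-from-primes {{size≢0}} λ {q} pr q∣size q∣b →
      prime∤1 pr (subst (q ℕ.∣_) (a⊥b (cauchy pr a q∣size , q∣b)) ℕ.∣-refl)

  -- The image of multiplication by a lies in the kernel of b, and each non-empty fibre has as many
  -- points as the kernel of a.
  v≤kernelSizes : ∀ {a b} → a * b ≡ v → v ≤ kernelSize a * kernelSize b
  v≤kernelSizes {a} {b} ab≡v = ℤ.drop‿+≤+ (subst₂ ℤ._≤_ (∑-fibre a) total (∑-mono-≤ bound))
    where
    bound : ∀ y → fibre a y ℤ.≤ fibre a ε ℤ.* kernel b y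
    bound y with fibre-view a y
    ... | inj₁ (x , ax≡y , eq) =
      ℤ.≤-reflexive (trans eq (sym (trans (cong (fibre a ε ℤ.*_) (δ-≡ by≡ε)) (ℤ.*-identityʳ _))))
      where
      by≡ε : b · y ≡ ε
      by≡ε = trans (cong (b ·_) (sym ax≡y)) (trans (·-assoc x b a)
               (trans (cong (_· x) (trans (ℕ.*-comm b a) ab≡v)) (order·≡ε x)))
    ... | inj₂ (_ , eq) = ℤ.≤-trans (ℤ.≤-reflexive eq)
      (subst (λ s → 0ℤ ℤ.≤ s ℤ.* kernel b y) (+kernelSize a)
        (subst (ℤ._≤ ℤ.+ kernelSize a ℤ.* kernel b y) (ℤ.*-zeroʳ (ℤ.+ kernelSize a))
        (ℤ.*-monoˡ-≤-nonNeg (ℤ.+ kernelSize a) (δ-nonneg (b · y) ε))))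
    total : ∑ (λ y → fibre a ε ℤ.* kernel b y) ≡ ℤ.+ (kernelSize a * kernelSize b)
    total = trans (sym (∑-*ˡ (fibre a ε) (kernel b)))
      (trans (cong₂ ℤ._*_ (sym (+kernelSize a)) (sym (+kernelSize b)))
        (sym (ℤ.pos-* (kernelSize a) (kernelSize b))))

  -- The kernels of a and b have at most a and b elements, while the product of their sizes is at
  -- least a b.
  kernelSize-≡ : ∀ {a b} → Coprime a b → a * b ≡ v → kernelSize a ≡ a
  kernelSize-≡ {a} {b} a⊥b ab≡v with ℕ.m≤n⇒m<n∨m≡n (kernelSize≤ a⊥b ab≡v)
  ... | inj₂ eq = eq
  ... | inj₁ lt = contradiction (ℕ.≤-<-trans (v≤kernelSizes {a} {b} ab≡v) strict) (ℕ.<-irrefl refl)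
    where
    b≢0 : NonZero b
    b≢0 = ≢-nonZero λ b≡0 → v≢0 (trans (sym ab≡v) (trans (cong (a *_) b≡0) (ℕ.*-zeroʳ a)))
    strict : kernelSize a * kernelSize b < v
    strict = subst (kernelSize a * kernelSize b <_) ab≡v
      (ℕ.≤-<-trans (ℕ.*-monoʳ-≤ (kernelSize a) (kernelSize≤ (Coprime.sym a⊥b) (trans (ℕ.*-comm b a) ab≡v)))
                   (ℕ.*-monoˡ-< b {{b≢0}} lt))

-- Free actions

-- The group (ℤ/p)^× will act through the representatives 1, ..., p - 1, so `compose` and `divide`
-- ask only for an index with the right effect and not for a group structure on the indices. The
-- weight `F` selects the points to be counted; freeness is required only on its support.
module Orbits {v n : ℕ} (τ : Fin (suc n) → Fin v → Fin v)
  (compose : ∀ c d → ∃ λ e → ∀ z → τ d (τ c z) ≡ τ e z)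
  (divide  : ∀ c d → ∃ λ e → ∀ z → τ e (τ c z) ≡ τ d z)
  (inverse : ∀ c → ∃ λ (c⁻¹ : Fin v → Fin v) → (∀ z → τ c (c⁻¹ z) ≡ z) × (∀ z → c⁻¹ (τ c z) ≡ z))
  (F : Fin v → ℤ) (invariant : ∀ c z → F (τ c z) ≡ F z)
  (free : ∀ {z c d} → F z ≢ 0ℤ → τ c z ≡ τ d z → c ≡ d)
  where

  Leader : Fin v → Set
  Leader z = ∀ d → toℕ z ≤ toℕ (τ d z)

  leader? : ∀ z → Dec (Leader z)
  leader? z = Fin.all? (λ d → toℕ z ℕ.≤? toℕ (τ d z))

  leader : Fin v → ℤ
  leader z = if ⌊ leader? z ⌋ then 1ℤ else 0ℤ

  argmin : ∀ {n} (f : Fin (suc n) → ℕ) → ∃ λ c → ∀ d → f c ≤ f d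
  argmin {zero}  f = zero , λ where zero → ℕ.≤-refl
  argmin {suc n} f with argmin (λ i → f (suc i))
  ... | c , min with ℕ.≤-total (f zero) (f (suc c))
  ...   | inj₁ f0≤ = zero , λ where
            zero    → ℕ.≤-refl
            (suc d) → ℕ.≤-trans f0≤ (min d)
  ...   | inj₂ ≤f0 = suc c , λ where
            zero    → ≤f0
            (suc d) → min d

  -- Minimality over all indices passes to the orbit of the least point through `compose`. Any other
  -- leader is compared with it through `divide`; the two coincide, and freeness identifies their
  -- indices.
  one-leader : ∀ z → F z ≢ 0ℤ → ∑ (λ c → leader (τ c z)) ≡ 1ℤ
  one-leader z Fz≢0 with argmin (λ c → toℕ (τ c z))
  ... | c₀ , min = trans (∑-single _ c₀ other) c₀-leads
    where
    c₀-leads : leader (τ c₀ z) ≡ 1ℤ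
    c₀-leads with leader? (τ c₀ z)
    ... | yes _ = refl
    ... | no ¬lead = contradiction (λ d → subst (λ w → toℕ (τ c₀ z) ≤ toℕ w) (sym (proj₂ (compose c₀ d) z))
      (min _)) ¬lead
    other : ∀ c → c ≢ c₀ → leader (τ c z) ≡ 0ℤ
    other c c≢c₀ with leader? (τ c z)
    ... | no _ = refl
    ... | yes lead = contradiction
      (free Fz≢0 (Fin.toℕ-injective (ℕ.≤-antisym
        (subst (λ w → toℕ (τ c z) ≤ toℕ w) (proj₂ (divide c c₀) z) (lead _)) (min c))))
      c≢c₀

  -- Each orbit in the support of F is free and has exactly one leader, its least element.
  orbits : ℤ.+ suc n ∣ ∑ F
  orbits = divides (∑ (λ z → F z ℤ.* leader z)) (begin
    ∑ F                                               ≡⟨ ∑-cong average ⟩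
    -- Each `τ c` is a permutation, so after exchanging the sums all `suc n` inner sums are equal.
    ∑ (λ z → ∑ (λ c → F (τ c z) ℤ.* leader (τ c z)))  ≡⟨ ∑-comm (λ z c → F (τ c z) ℤ.* leader (τ c z)) ⟩
    ∑ (λ c → ∑ (λ z → F (τ c z) ℤ.* leader (τ c z)))
      ≡⟨ ∑-cong (λ c → ∑-permute _ (Perm.permutation (τ c) (proj₁ (inverse c)) (proj₁ (proj₂ (inverse c)))
        (proj₂ (proj₂ (inverse c))))) ⟨
    ∑ {suc n} (λ c → ∑ (λ z → F z ℤ.* leader z))      ≡⟨ ∑-const (suc n) _ ⟩
    ℤ.+ suc n ℤ.* ∑ (λ z → F z ℤ.* leader z)          ≡⟨ ℤ.*-comm (ℤ.+ suc n) _ ⟩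
    ∑ (λ z → F z ℤ.* leader z) ℤ.* ℤ.+ suc n          ∎)
    where
    open ≡-Reasoning
    average : ∀ z → F z ≡ ∑ (λ c → F (τ c z) ℤ.* leader (τ c z))
    average z = begin
      F z                                     ≡⟨ weight ⟩
      F z ℤ.* ∑ (λ c → leader (τ c z))        ≡⟨ ∑-*ˡ (F z) _ ⟩
      ∑ (λ c → F z ℤ.* leader (τ c z))        ≡⟨ ∑-cong (λ c → cong (ℤ._* leader (τ c z)) (invariant c z)) ⟨
      ∑ (λ c → F (τ c z) ℤ.* leader (τ c z))  ∎
      where
      weight : F z ≡ F z ℤ.* ∑ (λ c → leader (τ c z))
      weight with F z ℤ.≟ 0ℤ
      ... | yes Fz≡0 = trans Fz≡0 (cong (ℤ._* ∑ (λ c → leader (τ c z))) (sym Fz≡0))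
      ... | no  Fz≢0 = sym (trans (cong (F z ℤ.*_) (one-leader z Fz≢0)) (ℤ.*-identityʳ (F z)))

-- Congruences

-- Congruence of natural numbers without subtraction: both sides may be raised by multiples of d.
Cong : ℕ → ℕ → ℕ → Set
Cong d m n = ∃ λ x → ∃ λ y → m + x * d ≡ n + y * d

cong-sym : ∀ {d m n} → Cong d m n → Cong d n m
cong-sym (x , y , eq) = y , x , sym eq

cong-trans : ∀ {d l m n} → Cong d l m → Cong d m n → Cong d l n
cong-trans {d} {l} {m} {n} (x , y , eq) (x′ , y′ , eq′) = x + x′ , y′ + y , (begin
  l + (x + x′) * d    ≡⟨ rearrange l x x′ d ⟩
  l + x * d + x′ * d  ≡⟨ cong (_+ x′ * d) eq ⟩
  m + y * d + x′ * d  ≡⟨ swap m (y * d) (x′ * d) ⟩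
  m + x′ * d + y * d  ≡⟨ cong (_+ y * d) eq′ ⟩
  n + y′ * d + y * d  ≡⟨ rearrange n y′ y d ⟨
  n + (y′ + y) * d    ∎)
  where
  open ≡-Reasoning
  rearrange : ∀ l x y d → l + (x + y) * d ≡ l + x * d + y * d
  rearrange = solveℕ
  swap : ∀ a b c → a + b + c ≡ a + c + b
  swap = solveℕ

cong-∣ : ∀ {d m n} → Cong d m n → d ℕ.∣ m → d ℕ.∣ n
cong-∣ {d} {m} {n} (x , y , eq) d∣m =
  ℕ.∣m+n∣m⇒∣n (subst (d ℕ.∣_) (trans eq (ℕ.+-comm n (y * d))) (ℕ.∣m∣n⇒∣m+n d∣m (ℕ.n∣m*n x))) (ℕ.n∣m*n y)

∣-⇒cong : ∀ {d m n} → ℤ.+ d ∣ ℤ.+ m ℤ.- ℤ.+ n → Cong d m n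
∣-⇒cong {d} {m} {n} (divides (ℤ.+ z) eq) = 0 , z , ℤ.+-injective (begin
  ℤ.+ (m + 0)                ≡⟨ cong ℤ.+_ (ℕ.+-identityʳ m) ⟩
  ℤ.+ m                      ≡⟨ move (ℤ.+ m) (ℤ.+ n) _ eq ⟩
  ℤ.+ n ℤ.+ ℤ.+ z ℤ.* ℤ.+ d  ≡⟨ cong (λ t → ℤ.+ n ℤ.+ t) (ℤ.pos-* z d) ⟨
  ℤ.+ (n + z * d)            ∎)
  where
  open ≡-Reasoning
  move : ∀ a b c → a ℤ.- b ≡ c → a ≡ b ℤ.+ c
  move a b _ refl = identity a b
    where
    identity : ∀ a b → a ≡ b ℤ.+ (a ℤ.- b)
    identity = solve-∀
∣-⇒cong {d} {m} {n} (divides ℤ.-[1+ z ] eq) = suc z , 0 , ℤ.+-injective (begin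
  ℤ.+ (m + suc z * d)            ≡⟨ cong (λ t → ℤ.+ m ℤ.+ t) (ℤ.pos-* (suc z) d) ⟩
  ℤ.+ m ℤ.+ ℤ.+ suc z ℤ.* ℤ.+ d  ≡⟨ move (ℤ.+ m) (ℤ.+ n) (ℤ.+ suc z) (ℤ.+ d) eq ⟩
  ℤ.+ n                          ≡⟨ cong ℤ.+_ (ℕ.+-identityʳ n) ⟨
  ℤ.+ (n + 0)                    ∎)
  where
  open ≡-Reasoning
  move : ∀ a b z d → a ℤ.- b ≡ (ℤ.- z) ℤ.* d → a ℤ.+ z ℤ.* d ≡ b
  move a b z d eq = trans (identity₁ a b z d) (trans (cong (λ t → t ℤ.+ b ℤ.+ z ℤ.* d) eq) (identity₂ b z d))
    where
    identity₁ : ∀ a b z d → a ℤ.+ z ℤ.* d ≡ a ℤ.- b ℤ.+ b ℤ.+ z ℤ.* d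
    identity₁ = solve-∀
    identity₂ : ∀ b z d → (ℤ.- z) ℤ.* d ℤ.+ b ℤ.+ z ℤ.* d ≡ b
    identity₂ = solve-∀

cong-fermat : ∀ {p} → Prime p → ∀ j c → Cong p (c ^ (p ^ j)) c
cong-fermat {p} pr zero    c = 0 , 0 , cong (_+ 0) (ℕ.^-identityʳ c)
cong-fermat {p} pr (suc j) c = cong-trans
  (subst (λ t → Cong p t (c ^ (p ^ j))) (trans (ℕ.^-*-assoc c (p ^ j) p) (cong (c ^_) (ℕ.*-comm (p ^ j) p)))
    (∣-⇒cong (subst (λ t → ℤ.+ p ∣ t ℤ.- ℤ.+ (c ^ (p ^ j))) (sym (pos-^ (c ^ (p ^ j)) p))
      (fermat pr (c ^ (p ^ j))))))
  (cong-fermat pr j c)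

-- The binomial theorem up to first order; with exponent p the linear term carries a factor p.
^-expand : ∀ m u s → ∃ λ c → (m + u) ^ suc s ≡ m ^ suc s + suc s * m ^ s * u + u * u * c
^-expand m u zero    = 0 , identity m u
  where
  identity : ∀ m u → (m + u) * 1 ≡ m * 1 + 1 * 1 * u + u * u * 0
  identity = solveℕ
^-expand m u (suc s) with ^-expand m u s
... | c , eq = suc s * m ^ s + m * c + u * c , trans (cong ((m + u) *_) eq) (identity m u (m ^ s) s c)
  where
  identity : ∀ m u M s c → (m + u) * (m * M + suc s * M * u + u * u * c)
           ≡ m * (m * M) + suc (suc s) * (m * M) * u + u * u * (suc s * M + m * c + u * c)
  identity = solveℕ

-- With u = x p d, the linear term p m^(p - 1) u and the square of u both contain the factor p · p
-- d.
^-lift : ∀ p d m x → ∃ λ c → (m + x * (p * d)) ^ p ≡ m ^ p + c * (p * (p * d))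
^-lift zero    d m x = 0 , refl
^-lift p@(suc s) d m x with ^-expand m (x * (p * d)) s
... | c , eq = m ^ s * x + x * x * d * c , trans eq (identity (m ^ suc s) p (m ^ s) x d c)
  where
  identity : ∀ A p M x d c → A + p * M * (x * (p * d)) + x * (p * d) * (x * (p * d)) * c ≡ A
    + (M * x + x * x * d * c) * (p * (p * d))
  identity = solveℕ

cong-^-lift : ∀ p d {m n} → Cong (p * d) m n → Cong (p * (p * d)) (m ^ p) (n ^ p)
cong-^-lift p d {m} {n} (x , y , eq) with ^-lift p d m x | ^-lift p d n y
... | c , eqm | c′ , eqn = c , c′ , trans (sym eqm) (trans (cong (_^ p) eq) eqn)

-- Every p-th power gains one factor p in the modulus. Hence c^(p^j) modulo p^(j + 1) depends only
-- on c modulo p and is a Teichmüller representative when p does not divide c.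
cong-teichmüller : ∀ p j {m n} → Cong p m n → Cong (p ^ suc j) (m ^ (p ^ j)) (n ^ (p ^ j))
cong-teichmüller p zero    {m} {n} (x , y , eq) = x , y ,
  trans (cong₂ _+_ (ℕ.^-identityʳ m) (cong (x *_) (ℕ.*-identityʳ p)))
    (trans eq (sym (cong₂ _+_ (ℕ.^-identityʳ n) (cong (y *_) (ℕ.*-identityʳ p)))))
cong-teichmüller p (suc j) {m} {n} m≡n =
  subst₂ (Cong (p ^ suc (suc j))) (power m) (power n) (cong-^-lift p (p ^ j) (cong-teichmüller p j m≡n))
  where
  power : ∀ m → (m ^ (p ^ j)) ^ p ≡ m ^ (p ^ suc j)
  power m = trans (ℕ.^-*-assoc m (p ^ j) p) (cong (m ^_) (ℕ.*-comm (p ^ j) p))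

-- The idempotents of the Chinese remainder theorem: e = e′ a is 0 modulo a and 1 modulo r, and f =
-- f′ r is 1 modulo a and 0 modulo r.
record Idempotents (a r : ℕ) : Set where
  field
    e′ f′ z : ℕ
    e+f≡1 : e′ * a + f′ * r ≡ 1 + z * (a * r)

idempotents : ∀ {a r} → Coprime a r → a * r ≢ 0 → Idempotents a r
idempotents {a} {r} a⊥r ar≢0 with a * r in ar≡ | coprime-Bézout a⊥r
... | zero  | _ = contradiction refl ar≢0
-- Here w = a r - 1 stands for -1 modulo a r and turns the negative Bézout coefficient into a
-- natural number.
... | suc w | Bézout.Identity.+- x y eq = record { e′ = x ; f′ = y * w ; z = y * r ; e+f≡1 = begin
  x * a + y * w * r      ≡⟨ cong (_+ y * w * r) eq ⟨
  1 + y * r + y * w * r  ≡⟨ identity y r w ⟩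
  1 + y * r * suc w      ≡⟨ cong (λ t → 1 + y * r * t) ar≡ ⟨
  1 + y * r * (a * r)    ∎ }
  where
  open ≡-Reasoning
  identity : ∀ y r w → 1 + y * r + y * w * r ≡ 1 + y * r * suc w
  identity = solveℕ
... | suc w | Bézout.Identity.-+ x y eq = record { e′ = x * w ; f′ = y ; z = x * a ; e+f≡1 = begin
  x * w * a + y * r        ≡⟨ cong (x * w * a +_) eq ⟨
  x * w * a + (1 + x * a)  ≡⟨ identity x a w ⟩
  1 + x * a * suc w        ≡⟨ cong (λ t → 1 + x * a * t) ar≡ ⟨
  1 + x * a * (a * r)      ∎ }
  where
  open ≡-Reasoning
  identity : ∀ x a w → x * w * a + (1 + x * a) ≡ 1 + x * a * suc w
  identity = solveℕ

cong-inverse : ∀ {p} → Prime p → ∀ c → ¬ p ℕ.∣ c → ∃ λ c′ → Cong p (c′ * c) 1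
cong-inverse {zero}  pr with () ← prime⇒nonZero pr
cong-inverse {p@(suc p′)} pr c p∤c with coprime-Bézout (prime∤⇒coprime pr p∤c)
-- The inverse is -y, written as y (p - 1).
... | Bézout.Identity.+- x y eq = y * p′ , x , y * c , (begin
  y * p′ * c + x * p        ≡⟨ cong (y * p′ * c +_) eq ⟨
  y * p′ * c + (1 + y * c)  ≡⟨ identity y p′ c ⟩
  1 + y * c * p             ∎)
  where
  open ≡-Reasoning
  identity : ∀ y p c → y * p * c + (1 + y * c) ≡ 1 + y * c * suc p
  identity = solveℕ
... | Bézout.Identity.-+ x y eq = y , 0 , x , trans (ℕ.+-identityʳ (y * c)) (sym eq)

residue : ∀ {p′} c → ¬ suc p′ ℕ.∣ c → ∃ λ (i : Fin p′) → Cong (suc p′) c (suc (toℕ i))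
residue {p′} c p∤c with c % suc p′ in c%p | ℕ.m≡m%n+[m/n]*n c (suc p′)
... | zero  | eq = contradiction (ℕ.divides (c / suc p′) eq) p∤c
... | suc i | eq = fromℕ< i<p′ , 0 , c / suc p′ ,
  trans (ℕ.+-identityʳ c) (trans eq (cong (λ t → suc t + c / suc p′ * suc p′) (sym (Fin.toℕ-fromℕ< i<p′))))
  where
  i<p′ : i < p′
  i<p′ = ℕ.s≤s⁻¹ (subst (_< suc p′) c%p (ℕ.m%n<n c (suc p′)))

cong-residue : ∀ {p′} (i j : Fin p′) → Cong (suc p′) (suc (toℕ i)) (suc (toℕ j)) → i ≡ j
cong-residue {p′} i j (x , y , eq) = Fin.toℕ-injective (ℕ.suc-injective (begin
  suc (toℕ i)                          ≡⟨ ℕ.m<n⇒m%n≡m (s≤s (Fin.toℕ<n i)) ⟨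
  suc (toℕ i) % suc p′                 ≡⟨ ℕ.[m+kn]%n≡m%n (suc (toℕ i)) x (suc p′) ⟨
  (suc (toℕ i) + x * suc p′) % suc p′  ≡⟨ cong (_% suc p′) eq ⟩
  (suc (toℕ j) + y * suc p′) % suc p′  ≡⟨ ℕ.[m+kn]%n≡m%n (suc (toℕ j)) y (suc p′) ⟩
  suc (toℕ j) % suc p′                 ≡⟨ ℕ.m<n⇒m%n≡m (s≤s (Fin.toℕ<n j)) ⟩
  suc (toℕ j)                          ∎))
  where open ≡-Reasoning

positive : ℤ → ℤ
positive w = if ⌊ w ℤ.≟ 1ℤ ⌋ then 1ℤ else 0ℤ

positive-01 : ∀ w → (positive w ≡ 0ℤ) ⊎ (positive w ≡ 1ℤ)
positive-01 w with w ℤ.≟ 1ℤ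
... | yes _ = inj₂ refl
... | no  _ = inj₁ refl

sign≡2positive-1 : ∀ {w} → (w ≡ 1ℤ) ⊎ (w ≡ ℤ.- 1ℤ) → w ≡ ℤ.+ 2 ℤ.* positive w ℤ.- 1ℤ
sign≡2positive-1 (inj₁ refl) = refl
sign≡2positive-1 (inj₂ refl) = refl

-- Multipliers from Teichmüller representatives

module TeichmüllerAction {v : ℕ} {_∙_ : Op₂ (Fin v)} {ε : Fin v} {_⁻¹ : Op₁ (Fin v)}
  (isAbelianGroup : IsAbelianGroup _≡_ _∙_ ε _⁻¹)
  {p : ℕ} (p-prime : Prime p) (j r : ℕ) (p∤r : ¬ p ℕ.∣ r) (a*r≡v : p ^ suc j * r ≡ v)
  where

  open GroupRing isAbelianGroup
  open ≡-Reasoning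

  a M : ℕ
  a = p ^ suc j
  M = p ^ j

  a≢0 : NonZero a
  a≢0 = ℕ.m^n≢0 p (suc j) {{prime⇒nonZero p-prime}}

  a⊥ : ∀ {n} → ¬ p ℕ.∣ n → Coprime a n
  a⊥ {n} p∤n = coprime-from-primes {{a≢0}} λ {q} pr q∣a q∣n → p∤n
    (subst (ℕ._∣ n) (prime∣prime^⇒≡ p-prime pr (suc j) q∣a) q∣n)

  ar≢0 : a * r ≢ 0
  ar≢0 ar≡0 = v≢0 (trans (sym a*r≡v) ar≡0)

  open Idempotents (idempotents (a⊥ p∤r) ar≢0)

  e f : ℕ
  e = e′ * a
  f = f′ * r

  -- s c is 1 modulo r and c^M modulo a; as M is a power of p, c^M modulo a only depends on c modulo p.
  s : ℕ → ℕ
  s c = e + f * c ^ M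

  cong-· : ∀ {m n} → Cong v m n → ∀ g → m · g ≡ n · g
  cong-· {m} {n} (x , y , eq) g = begin
    m · g            ≡⟨ drop m x ⟨
    (m + x * v) · g  ≡⟨ cong (_· g) eq ⟩
    (n + y * v) · g  ≡⟨ drop n y ⟩
    n · g            ∎
    where
    drop : ∀ m x → (m + x * v) · g ≡ m · g
    drop m x = trans (·-+ g m (x * v)) (trans (cong ((m · g) ∙_) (·-multiple x v (order·≡ε g))) (identityʳ (m · g)))

  -- The powers c^M and d^M differ by a multiple of a, which the factor r of `f` turns into a
  -- multiple of v.
  act-cong : ∀ {c d} → Cong p c d → ∀ g → s c · g ≡ s d · g
  act-cong {c} {d} c≡d with cong-teichmüller p j c≡d
  ... | x , y , eq = cong-· (subst (λ w → Cong w (s c) (s d)) a*r≡v (f′ * x , f′ * y , (begin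
    s c + f′ * x * (a * r)        ≡⟨ collect e f′ r (c ^ M) x a ⟩
    e + f′ * r * (c ^ M + x * a)  ≡⟨ cong (λ t → e + f * t) eq ⟩
    e + f′ * r * (d ^ M + y * a)  ≡⟨ collect e f′ r (d ^ M) y a ⟨
    s d + f′ * y * (a * r)        ∎)))
    where
    collect : ∀ e f′ r C x a → e + f′ * r * C + f′ * x * (a * r) ≡ e + f′ * r * (C + x * a)
    collect = solveℕ

  [e+f]· : ∀ g → (e + f) · g ≡ g
  [e+f]· g = trans (cong-· {e + f} {1} (0 , z , trans (ℕ.+-identityʳ (e + f))
    (trans e+f≡1 (cong (λ w → 1 + z * w) a*r≡v))) g) (1· g)

  split : ∀ g → (e · g) ∙ (f · g) ≡ g
  split g = trans (sym (·-+ g e f)) ([e+f]· g)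

  act-one : ∀ g → s 1 · g ≡ g
  act-one g = trans (cong (λ t → (e + f * t) · g) (ℕ.^-zeroˡ M))
    (trans (cong (λ t → (e + t) · g) (ℕ.*-identityʳ f)) ([e+f]· g))

  ar·≡ε : ∀ g → (a * r) · g ≡ ε
  ar·≡ε g = trans (cong (_· g) a*r≡v) (order·≡ε g)

  af·≡ε : ∀ g → a · (f · g) ≡ ε
  af·≡ε g = trans (·-assoc g a f) (trans (cong (_· g) (regroup a f′ r)) (·-multiple f′ (a * r) (ar·≡ε g)))
    where
    regroup : ∀ a f r → a * (f * r) ≡ f * (a * r)
    regroup = solveℕ

  ef·≡ε : ∀ g → e · (f · g) ≡ ε
  ef·≡ε g = trans (·-assoc g e f) (trans (cong (_· g) (regroup e′ a f′ r)) (·-multiple (e′ * f′) (a * r) (ar·≡ε g)))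
    where
    regroup : ∀ e a f r → e * a * (f * r) ≡ e * f * (a * r)
    regroup = solveℕ

  -- The product e f annihilates the group, so e discards the part of `s c` that involves c.
  e· : ∀ c g → e · (s c · g) ≡ e · g
  e· c g = begin
    e · (s c · g)                      ≡⟨ cong (e ·_) (·-+ g e (f * c ^ M)) ⟩
    e · ((e · g) ∙ ((f * c ^ M) · g))  ≡⟨ ·-∙ _ _ e ⟩
    (e · (e · g)) ∙ (e · ((f * c ^ M) · g))
      ≡⟨ cong ((e · (e · g)) ∙_) (trans (cong (e ·_) (sym (·-assoc g f (c ^ M)))) (ef·≡ε ((c ^ M) · g))) ⟩
    (e · (e · g)) ∙ ε                  ≡⟨ cong ((e · (e · g)) ∙_) (ef·≡ε g) ⟨
    (e · (e · g)) ∙ (e · (f · g))      ≡⟨ ·-∙ _ _ e ⟨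
    e · ((e · g) ∙ (f · g))            ≡⟨ cong (e ·_) (split g) ⟩
    e · g                              ∎

  f· : ∀ c g → f · (s c · g) ≡ (c ^ M) · (f · g)
  f· c g = begin
    f · (s c · g)                  ≡⟨ ·-comm f (s c) g ⟩
    s c · (f · g)                  ≡⟨ ·-+ (f · g) e (f * c ^ M) ⟩
    (e · (f · g)) ∙ ((f * c ^ M) · (f · g))
      ≡⟨ cong₂ _∙_ (ef·≡ε g) (trans (cong (_· (f · g)) (ℕ.*-comm f (c ^ M))) (sym (·-assoc (f · g) (c ^ M) f))) ⟩
    ε ∙ ((c ^ M) · (f · (f · g)))  ≡⟨ identityˡ _ ⟩
    (c ^ M) · (f · (f · g))        ≡⟨ cong ((c ^ M) ·_) idem ⟩
    (c ^ M) · (f · g)              ∎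
    where
    idem : f · (f · g) ≡ f · g
    idem = trans (sym (identityˡ _)) (trans (cong (_∙ (f · (f · g))) (sym (ef·≡ε g))) (split (f · g)))

  -- On the e-part all `s c` act trivially, and on the f-part the powers c^M multiply.
  act-* : ∀ c d g → s d · (s c · g) ≡ s (d * c) · g
  act-* c d g = begin
    s d · (s c · g)                              ≡⟨ ·-+ (s c · g) e (f * d ^ M) ⟩
    (e · (s c · g)) ∙ ((f * d ^ M) · (s c · g))  ≡⟨ cong₂ _∙_ (e· c g) f-part ⟩
    (e · g) ∙ ((f * (d * c) ^ M) · g)            ≡⟨ ·-+ g e (f * (d * c) ^ M) ⟨
    s (d * c) · g                                ∎
    where
    f-part : (f * d ^ M) · (s c · g) ≡ (f * (d * c) ^ M) · g
    f-part = begin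
      (f * d ^ M) · (s c · g)        ≡⟨ cong (_· (s c · g)) (ℕ.*-comm f (d ^ M)) ⟩
      (d ^ M * f) · (s c · g)        ≡⟨ ·-assoc _ (d ^ M) f ⟨
      (d ^ M) · (f · (s c · g))      ≡⟨ cong ((d ^ M) ·_) (f· c g) ⟩
      (d ^ M) · ((c ^ M) · (f · g))  ≡⟨ ·-assoc (f · g) (d ^ M) (c ^ M) ⟩
      (d ^ M * c ^ M) · (f · g)      ≡⟨ cong (_· (f · g)) (*-^ d c M) ⟨
      ((d * c) ^ M) · (f · g)        ≡⟨ ·-assoc g ((d * c) ^ M) f ⟩
      ((d * c) ^ M * f) · g          ≡⟨ cong (_· g) (ℕ.*-comm ((d * c) ^ M) f) ⟩
      (f * (d * c) ^ M) · g          ∎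

  -- The e-part of g is fixed and its f-part is killed by a. Hence the action permutes the points of
  -- each fibre of g ↦ a g.
  a· : ∀ c g → a · (s c · g) ≡ a · g
  a· c g = begin
    a · (s c · g)                            ≡⟨ cong (a ·_) (split (s c · g)) ⟨
    a · ((e · (s c · g)) ∙ (f · (s c · g)))  ≡⟨ ·-∙ _ _ a ⟩
    (a · (e · (s c · g))) ∙ (a · (f · (s c · g)))
      ≡⟨ cong₂ _∙_ (cong (a ·_) (e· c g)) (trans (af·≡ε (s c · g)) (sym (af·≡ε g))) ⟩
    (a · (e · g)) ∙ (a · (f · g))            ≡⟨ ·-∙ _ _ a ⟨
    a · ((e · g) ∙ (f · g))                  ≡⟨ cong (a ·_) (split g) ⟩
    a · g                                    ∎

  -- A prime divisor of r sees `s c` as 1, and p sees it as c^M; neither residue is 0.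
  act-coprime : ∀ {c q} → ¬ p ℕ.∣ c → Prime q → q ℕ.∣ s c → ¬ q ℕ.∣ v
  act-coprime {c} {q} p∤c pr q∣s q∣v =
    [ divides-a , divides-r ]′ (euclidsLemma a r pr (subst (q ℕ.∣_) (sym a*r≡v) q∣v))
    where
    q∣1 : q ℕ.∣ e → q ℕ.∣ f → q ℕ.∣ 1
    q∣1 q∣e q∣f = ℕ.∣m+n∣m⇒∣n (subst (q ℕ.∣_) (trans e+f≡1 (ℕ.+-comm 1 (z * (a * r)))) (ℕ.∣m∣n⇒∣m+n q∣e q∣f))
      (ℕ.∣n⇒∣m*n z (subst (q ℕ.∣_) (sym a*r≡v) q∣v))
    divides-a : ¬ q ℕ.∣ a
    divides-a q∣a = [ (λ q∣f → prime∤1 pr (q∣1 q∣e q∣f)) ,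
      (λ q∣c^M → p∤c (subst (ℕ._∣ c) (prime∣prime^⇒≡ p-prime pr (suc j) q∣a) (prime∣^ℕ M q∣c^M))) ]′
      (euclidsLemma f (c ^ M) pr (ℕ.∣m+n∣m⇒∣n q∣s q∣e))
      where
      q∣e = ℕ.∣n⇒∣m*n e′ q∣a
      prime∣^ℕ : ∀ n → q ℕ.∣ c ^ n → q ℕ.∣ c
      prime∣^ℕ zero    q∣1 = contradiction q∣1 (prime∤1 pr)
      prime∣^ℕ (suc n) q∣  = [ (λ q∣c → q∣c) , prime∣^ℕ n ]′ (euclidsLemma c (c ^ n) pr q∣)
    divides-r : ¬ q ℕ.∣ r
    divides-r q∣r = prime∤1 pr (q∣1 (ℕ.∣m+n∣m⇒∣n (subst (q ℕ.∣_) (ℕ.+-comm e (f * c ^ M)) q∣s)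
      (ℕ.∣m⇒∣m*n (c ^ M) q∣f)) q∣f)
      where
      q∣f = ℕ.∣n⇒∣m*n f′ q∣r

  act-inverse : ∀ {c} → ¬ p ℕ.∣ c → ∃ λ c′ → (∀ g → s c · (s c′ · g) ≡ g) × (∀ g → s c′ · (s c · g) ≡ g)
  act-inverse {c} p∤c with cong-inverse p-prime c p∤c
  ... | c′ , c′c≡1 = c′ ,
    (λ g → trans (act-* c′ c g) (trans (act-cong (subst (λ t → Cong p t 1) (ℕ.*-comm c′ c) c′c≡1) g) (act-one g))) ,
    (λ g → trans (act-* c c′ g) (trans (act-cong c′c≡1 g) (act-one g)))

  -- The non-zero element h = f · g is killed by a. A difference of c^M and d^M prime to p could not
  -- kill h, so these powers agree modulo p, and by Fermat so do c and d.
  act-free : ∀ {c d} g → f · g ≢ ε → s c · g ≡ s d · g → Cong p c d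
  act-free {c} {d} g fg≢ε eq =
    cong-trans (cong-sym (cong-fermat p-prime j c)) (cong-trans powers (cong-fermat p-prime j d))
    where
    h = f · g
    equal : (c ^ M) · h ≡ (d ^ M) · h
    equal = trans (sym (f· c g)) (trans (cong (f ·_) eq) (f· d g))
    ordered : ∀ {m n} → m ≤ n → m · h ≡ n · h → Cong p m n
    ordered {m} {n} m≤n mh≡nh with p ℕ.∣? (n ∸ m)
    ... | yes (ℕ.divides t n∸m≡tp) =
      t , 0 , trans (trans (cong (m +_) (sym n∸m≡tp)) (ℕ.m+[n∸m]≡n m≤n)) (sym (ℕ.+-identityʳ n))
    ... | no  p∤ = contradiction (coprime-cancel (Coprime.sym (a⊥ p∤)) (trans kills (sym (·-ε (n ∸ m))))
      (trans (af·≡ε g) (sym (·-ε a)))) fg≢ε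
      where
      kills : (n ∸ m) · h ≡ ε
      kills = ∙-cancelˡ (m · h) _ _ (begin
        (m · h) ∙ ((n ∸ m) · h)  ≡⟨ ·-+ h m (n ∸ m) ⟨
        (m + (n ∸ m)) · h        ≡⟨ cong (_· h) (ℕ.m+[n∸m]≡n m≤n) ⟩
        n · h                    ≡⟨ mh≡nh ⟨
        m · h                    ≡⟨ identityʳ (m · h) ⟨
        (m · h) ∙ ε              ∎)
    powers : Cong p (c ^ M) (d ^ M)
    powers = [ (λ le → ordered le equal) , (λ ge → cong-sym (ordered ge (sym equal))) ]′ (ℕ.≤-total (c ^ M) (d ^ M))

01-* : ∀ {a b} → (a ≡ 0ℤ) ⊎ (a ≡ 1ℤ) → (b ≡ 0ℤ) ⊎ (b ≡ 1ℤ) → (a ℤ.* b ≡ 0ℤ) ⊎ (a ℤ.* b ≡ 1ℤ)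
01-* (inj₁ refl) _           = inj₁ refl
01-* (inj₂ refl) (inj₁ refl) = inj₁ refl
01-* (inj₂ refl) (inj₂ refl) = inj₂ refl

δ-01 : ∀ {n} (x y : Fin n) → (δ x y ≡ 0ℤ) ⊎ (δ x y ≡ 1ℤ)
δ-01 x y with δ-view x y
... | inj₁ (_ , eq) = inj₂ eq
... | inj₂ (_ , eq) = inj₁ eq

-- Fibre counts modulo p - 1

module FibreCount {v : ℕ} {_∙_ : Op₂ (Fin v)} {ε : Fin v} {_⁻¹ : Op₁ (Fin v)}
  (isAbelianGroup : IsAbelianGroup _≡_ _∙_ ε _⁻¹)
  (W : Fin v → ℤ) (W≡±1 : ∀ {x} → x ≢ ε → (W x ≡ 1ℤ) ⊎ (W x ≡ ℤ.- 1ℤ))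
  {p n : ℕ} (p≡ : p ≡ suc (suc n)) (p-prime : Prime p) (j r : ℕ) (p∤r : ¬ p ℕ.∣ r) (a*r≡v : p ^ suc j * r ≡ v)
  (multiplier : ∀ {s} → (∀ {q} → Prime q → q ℕ.∣ s → ¬ q ℕ.∣ v) → ∀ x → W (GroupRing._·_ isAbelianGroup s x) ≡ W x)
  where

  open GroupRing isAbelianGroup
  open Kernels isAbelianGroup
  open TeichmüllerAction isAbelianGroup p-prime j r p∤r a*r≡v
  open Idempotents (idempotents (a⊥ p∤r) ar≢0) using (e′)
  open ≡-Reasoning

  rep : Fin (suc n) → ℕ
  rep c = suc (toℕ c)

  p∤rep : ∀ c → ¬ p ℕ.∣ rep c
  p∤rep c p∣c = ℕ.<⇒≱ (s≤s (Fin.toℕ<n c)) (subst (_≤ rep c) p≡ (ℕ.∣⇒≤ p∣c))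

  τ : Fin (suc n) → Fin v → Fin v
  τ c g = s (rep c) · g

  represent : ∀ c → ¬ p ℕ.∣ c → ∃ λ i → ∀ g → s c · g ≡ τ i g
  represent c p∤c = proj₁ c≡i , act-cong (proj₂ c≡i)
    where
    c≡i : ∃ λ (i : Fin (suc n)) → Cong p c (suc (toℕ i))
    c≡i = subst (λ p → ¬ p ℕ.∣ c → ∃ λ (i : Fin (suc n)) → Cong p c (suc (toℕ i))) (sym p≡) (residue c) p∤c

  p∤* : ∀ {c d} → ¬ p ℕ.∣ c → ¬ p ℕ.∣ d → ¬ p ℕ.∣ c * d
  p∤* {c} {d} p∤c p∤d p∣cd = [ p∤c , p∤d ]′ (euclidsLemma c d p-prime p∣cd)

  compose : ∀ c d → ∃ λ i → ∀ g → τ d (τ c g) ≡ τ i g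
  compose c d = proj₁ i , λ g → trans (act-* (rep c) (rep d) g) (proj₂ i g)
    where
    i : ∃ λ i → ∀ g → s (rep d * rep c) · g ≡ τ i g
    i = represent (rep d * rep c) (p∤* {rep d} {rep c} (p∤rep d) (p∤rep c))

  divide : ∀ c d → ∃ λ i → ∀ g → τ i (τ c g) ≡ τ d g
  divide c d = proj₁ i , λ g → begin
    τ (proj₁ i) (τ c g)     ≡⟨ proj₂ i (τ c g) ⟨
    s (rep d * c′) · τ c g  ≡⟨ act-* c′ (rep d) (τ c g) ⟨
    s (rep d) · (s c′ · τ c g)
      ≡⟨ cong (s (rep d) ·_) (trans (act-* (rep c) c′ g) (trans (act-cong c′c≡1 g) (act-one g))) ⟩
    τ d g                   ∎
    where
    c′ : ℕ
    c′ = proj₁ (cong-inverse p-prime (rep c) (p∤rep c))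
    c′c≡1 : Cong p (c′ * rep c) 1
    c′c≡1 = proj₂ (cong-inverse p-prime (rep c) (p∤rep c))
    i : ∃ λ i → ∀ g → s (rep d * c′) · g ≡ τ i g
    i = represent (rep d * c′) (p∤* {rep d} {c′} (p∤rep d) λ p∣c′ → prime∤1 p-prime
      (cong-∣ c′c≡1 (ℕ.∣m⇒∣m*n (rep c) p∣c′)))

  inverse : ∀ c → ∃ λ (c⁻¹ : Fin v → Fin v) → (∀ g → τ c (c⁻¹ g) ≡ g) × (∀ g → c⁻¹ (τ c g) ≡ g)
  inverse c = (s (proj₁ c⁻¹) ·_) , proj₂ c⁻¹
    where
    c⁻¹ = act-inverse (p∤rep c)

  -- Indicator of the points of the fibre with W = 1 whose f-part is non-zero, the condition under
  -- which the action is free.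
  free-part : Fin v → Fin v → ℤ
  free-part y g = δ (a · g) y ℤ.* positive (W g) ℤ.* (1ℤ ℤ.- δ (f · g) ε)

  -- The action preserves fibres by `a·`, preserves W because `s c` is prime to v, and commutes with
  -- multiplication by f.
  free-part-invariant : ∀ y c g → free-part y (τ c g) ≡ free-part y g
  free-part-invariant y c g = cong₂ ℤ._*_
    (cong₂ (λ h w → δ h y ℤ.* positive w) (a· (rep c) g) (multiplier (act-coprime (p∤rep c)) g))
    (cong (λ d → 1ℤ ℤ.- d) (δ-⇔ to from))
    where
    from : f · g ≡ ε → f · τ c g ≡ ε
    from fg≡ε = trans (·-comm f (s (rep c)) g) (trans (cong (s (rep c) ·_) fg≡ε) (·-ε (s (rep c))))
    to : f · τ c g ≡ ε → f · g ≡ ε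
    to eq = trans (sym (proj₂ (proj₂ (inverse c)) (f · g)))
      (trans (cong (proj₁ (inverse c)) (trans (·-comm (s (rep c)) f g) eq)) (·-ε (s _)))

  free-part-free : ∀ y {g c d} → free-part y g ≢ 0ℤ → τ c g ≡ τ d g → c ≡ d
  free-part-free y {g} {c} {d} nonzero eq =
    cong-residue c d (subst (λ p → Cong p (rep c) (rep d)) p≡ (act-free g fg≢ε eq))
    where
    fg≢ε : f · g ≢ ε
    fg≢ε fg≡ε = nonzero (trans (cong (λ d → δ (a · g) y ℤ.* positive (W g) ℤ.* (1ℤ ℤ.- d)) (δ-≡ fg≡ε))
      (ℤ.*-zeroʳ (δ (a · g) y ℤ.* positive (W g))))

  p-1∣free-part : ∀ y → ℤ.+ suc n ∣ ∑ (free-part y)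
  p-1∣free-part y = Orbits.orbits τ compose divide inverse (free-part y) (free-part-invariant y) (free-part-free y)

  -- The fibre over y has only one point killed by f, namely e′ · y, and all s c fix it.
  fixed-part : Fin v → Fin v → ℤ
  fixed-part y g = δ (a · g) y ℤ.* positive (W g) ℤ.* δ (f · g) ε

  fixed-part-01 : ∀ y → (∑ (fixed-part y) ≡ 0ℤ) ⊎ (∑ (fixed-part y) ≡ 1ℤ)
  fixed-part-01 y = subst (λ t → (t ≡ 0ℤ) ⊎ (t ≡ 1ℤ)) (sym (∑-single (fixed-part y) (e′ · y) other))
    (01-* (01-* (δ-01 (a · (e′ · y)) y) (positive-01 (W (e′ · y)))) (δ-01 (f · (e′ · y)) ε))
    where
    other : ∀ g → g ≢ e′ · y → fixed-part y g ≡ 0ℤ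
    other g g≢ with δ-view (a · g) y | δ-view (f · g) ε
    ... | _               | inj₂ (_ , eq)   =
      trans (cong (δ (a · g) y ℤ.* positive (W g) ℤ.*_) eq) (ℤ.*-zeroʳ (δ (a · g) y ℤ.* positive (W g)))
    ... | inj₂ (_ , eq)   | inj₁ _          = cong (λ d → d ℤ.* positive (W g) ℤ.* δ (f · g) ε) eq
    -- As e = e′ a, the e-part of g is determined by y; with zero f-part it is all of g.
    ... | inj₁ (ag≡y , _) | inj₁ (fg≡ε , _) = contradiction (begin
      g                  ≡⟨ split g ⟨
      (e · g) ∙ (f · g)  ≡⟨ cong₂ _∙_ (trans (sym (·-assoc g e′ a)) (cong (e′ ·_) ag≡y)) fg≡ε ⟩
      (e′ · y) ∙ ε       ≡⟨ identityʳ _ ⟩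
      e′ · y             ∎) g≢

  -- As y ≠ ε, the fibre avoids the zero of W at ε, and W is 2 · `positive` - 1 on all of it. The
  -- indicator of W = 1 is then split according to whether f kills the point.
  push-W : ∀ {y} → y ≢ ε → push a W y ≡ ℤ.+ 2 ℤ.* (∑ (fixed-part y) ℤ.+ ∑ (free-part y)) ℤ.- fibre a y
  push-W {y} y≢ε = begin
    ∑ (λ g → W g ℤ.* δ (a · g) y)                                   ≡⟨ ∑-cong term ⟩
    ∑ (λ g → ℤ.+ 2 ℤ.* (fixed-part y g ℤ.+ free-part y g) ℤ.+ ℤ.- 1ℤ ℤ.* δ (a · g) y)
      ≡⟨ ∑-+ (λ g → ℤ.+ 2 ℤ.* (fixed-part y g ℤ.+ free-part y g)) (λ g → ℤ.- 1ℤ ℤ.* δ (a · g) y) ⟩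
    ∑ (λ g → ℤ.+ 2 ℤ.* (fixed-part y g ℤ.+ free-part y g)) ℤ.+ ∑ (λ g → ℤ.- 1ℤ ℤ.* δ (a · g) y)
      ≡⟨ cong₂ ℤ._+_ (trans (sym (∑-*ˡ (ℤ.+ 2) _)) (cong (ℤ.+ 2 ℤ.*_) (∑-+ (fixed-part y) (free-part y))))
        (trans (sym (∑-*ˡ (ℤ.- 1ℤ) _)) (ℤ.-1*i≡-i (fibre a y))) ⟩
    ℤ.+ 2 ℤ.* (∑ (fixed-part y) ℤ.+ ∑ (free-part y)) ℤ.- fibre a y  ∎
    where
    regroup : ∀ w d c → (ℤ.+ 2 ℤ.* w ℤ.- 1ℤ) ℤ.* d
      ≡ ℤ.+ 2 ℤ.* (d ℤ.* w ℤ.* c ℤ.+ d ℤ.* w ℤ.* (1ℤ ℤ.- c)) ℤ.+ ℤ.- 1ℤ ℤ.* d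
    regroup = solve-∀
    vanish : ∀ w w′ c → w ℤ.* 0ℤ ≡ ℤ.+ 2 ℤ.* (0ℤ ℤ.* w′ ℤ.* c ℤ.+ 0ℤ ℤ.* w′ ℤ.* (1ℤ ℤ.- c)) ℤ.+ ℤ.- 1ℤ ℤ.* 0ℤ
    vanish = solve-∀
    term : ∀ g → W g ℤ.* δ (a · g) y ≡ ℤ.+ 2 ℤ.* (fixed-part y g ℤ.+ free-part y g) ℤ.+ ℤ.- 1ℤ ℤ.* δ (a · g) y
    term g = [ (λ where (ag≡y , _) → on-fibre ag≡y) , (λ where (_ , δ≡0) → off-fibre δ≡0) ]′ (δ-view (a · g) y)
      where
      g≢ε : a · g ≡ y → g ≢ ε
      g≢ε ag≡y g≡ε = y≢ε (trans (sym ag≡y) (trans (cong (a ·_) g≡ε) (·-ε a)))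
      w = positive (W g)
      c = δ (f · g) ε
      on-fibre : a · g ≡ y → W g ℤ.* δ (a · g) y ≡ ℤ.+ 2 ℤ.* (fixed-part y g ℤ.+ free-part y g) ℤ.+ ℤ.- 1ℤ ℤ.* δ (a · g) y
      on-fibre ag≡y = trans (cong (ℤ._* δ (a · g) y) (sign≡2positive-1 (W≡±1 (g≢ε ag≡y)))) (regroup w (δ (a · g) y) c)
      off-fibre : ∀ {d} → d ≡ 0ℤ → W g ℤ.* d ≡ ℤ.+ 2 ℤ.* (d ℤ.* w ℤ.* c ℤ.+ d ℤ.* w ℤ.* (1ℤ ℤ.- c)) ℤ.+ ℤ.- 1ℤ ℤ.* d
      off-fibre refl = vanish (W g) w c

-- The final congruence

-- Adds a known equation to an expression, so that a consequence of it becomes a polynomial identity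
-- for the ring solver.
balance : ∀ x {l r} → l ≡ r → x ≡ x ℤ.+ (l ℤ.- r)
balance x {l} refl = identity x l
  where
  identity : ∀ x l → x ≡ x ℤ.+ (l ℤ.- l)
  identity = solve-∀

-- With p = 1 + 2 h: odd powers of p are p modulo 2 (p − 1).
odd-power : ∀ h j → ∃ λ u →
  (1ℤ ℤ.+ ℤ.+ 2 ℤ.* h) ℤ.^ suc (j * 2) ≡ (1ℤ ℤ.+ ℤ.+ 2 ℤ.* h) ℤ.+ ℤ.+ 2 ℤ.* (ℤ.+ 2 ℤ.* h) ℤ.* u
odd-power h zero    = 0ℤ , identity h
  where
  identity : ∀ h → (1ℤ ℤ.+ ℤ.+ 2 ℤ.* h) ℤ.* 1ℤ ≡ (1ℤ ℤ.+ ℤ.+ 2 ℤ.* h) ℤ.+ ℤ.+ 2 ℤ.* (ℤ.+ 2 ℤ.* h) ℤ.* 0ℤ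
  identity = solve-∀
odd-power h (suc j) with odd-power h j
... | u , eq = (1ℤ ℤ.+ h) ℤ.* (1ℤ ℤ.+ ℤ.+ 2 ℤ.* h) ℤ.+ (1ℤ ℤ.+ ℤ.+ 2 ℤ.* h) ℤ.* (1ℤ ℤ.+ ℤ.+ 2 ℤ.* h) ℤ.* u ,
  trans (cong (λ P → (1ℤ ℤ.+ ℤ.+ 2 ℤ.* h) ℤ.* ((1ℤ ℤ.+ ℤ.+ 2 ℤ.* h) ℤ.* P)) eq) (identity h u)
  where
  identity : ∀ h u → let p = 1ℤ ℤ.+ ℤ.+ 2 ℤ.* h in
    p ℤ.* (p ℤ.* (p ℤ.+ ℤ.+ 2 ℤ.* (ℤ.+ 2 ℤ.* h) ℤ.* u))
    ≡ p ℤ.+ ℤ.+ 2 ℤ.* (ℤ.+ 2 ℤ.* h) ℤ.* ((1ℤ ℤ.+ h) ℤ.* p ℤ.+ p ℤ.* p ℤ.* u)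
  identity = solve-∀

2h≢4hx : ∀ h x → h ≢ 0ℤ → ℤ.+ 2 ℤ.* h ≢ ℤ.+ 2 ℤ.* (ℤ.+ 2 ℤ.* h) ℤ.* x
2h≢4hx h x h≢0 eq = prime∤1 prime[2] (∣⇒∣ᵤ (divides x 1≡x*2))
  where
  1≡x*2 : 1ℤ ≡ x ℤ.* ℤ.+ 2
  1≡x*2 = ℤ.*-cancelˡ-≡ (ℤ.+ 2 ℤ.* h) 1ℤ (x ℤ.* ℤ.+ 2)
    {{ℤ.≢-nonZero λ 2h≡0 → h≢0 (ℤ.*-cancelˡ-≡ (ℤ.+ 2) h 0ℤ 2h≡0)}}
    (trans (ℤ.*-identityʳ (ℤ.+ 2 ℤ.* h)) (trans eq (identity h x)))
    where
    identity : ∀ h x → ℤ.+ 2 ℤ.* (ℤ.+ 2 ℤ.* h) ℤ.* x ≡ ℤ.+ 2 ℤ.* h ℤ.* (x ℤ.* ℤ.+ 2)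
    identity = solve-∀

-- The number of points with W = 1 is (P² + Y)/2, which modulo 2 h is 1 + h for Y = P and h for Y =
-- -P; it must also be E. The cases (P, 1) and (-P, 0) would make h divisible by 2 h; in the other
-- two 2 h divides 2.
p-1∣2 : ∀ h j E t → h ≢ 0ℤ → (E ≡ 0ℤ) ⊎ (E ≡ 1ℤ) →
  let P = (1ℤ ℤ.+ ℤ.+ 2 ℤ.* h) ℤ.^ suc (j * 2) in ∀ {Y} → (Y ≡ P) ⊎ (Y ≡ ℤ.- P) →
  Y ≡ ℤ.+ 2 ℤ.* (E ℤ.+ t ℤ.* (ℤ.+ 2 ℤ.* h)) ℤ.- P ℤ.* P → ℤ.+ 2 ℤ.* h ∣ ℤ.+ 2
p-1∣2 h j E t h≢0 E01 Y≡±P eq = go (proj₁ (odd-power h j)) (proj₂ (odd-power h j)) E01 Y≡±P eq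
  where
  go : ∀ u {P E Y} → P ≡ (1ℤ ℤ.+ ℤ.+ 2 ℤ.* h) ℤ.+ ℤ.+ 2 ℤ.* (ℤ.+ 2 ℤ.* h) ℤ.* u →
    (E ≡ 0ℤ) ⊎ (E ≡ 1ℤ) → (Y ≡ P) ⊎ (Y ≡ ℤ.- P) →
    Y ≡ ℤ.+ 2 ℤ.* (E ℤ.+ t ℤ.* (ℤ.+ 2 ℤ.* h)) ℤ.- P ℤ.* P → ℤ.+ 2 ℤ.* h ∣ ℤ.+ 2
  -- The quotient results from expanding with P = 1 + 2 h + 4 h u; likewise in the remaining cases.
  go u refl (inj₁ refl) (inj₁ refl) eq = divides
    (ℤ.+ 2 ℤ.* t ℤ.- ℤ.+ 3 ℤ.- ℤ.+ 2 ℤ.* h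
      ℤ.- ℤ.+ 4 ℤ.* (1ℤ ℤ.+ ℤ.+ 2 ℤ.* h) ℤ.* u ℤ.- ℤ.+ 8 ℤ.* h ℤ.* u ℤ.* u ℤ.- ℤ.+ 2 ℤ.* u)
    (trans (balance (ℤ.+ 2) (sym eq)) (identity h u t))
    where
    identity : ∀ h u t → let P = (1ℤ ℤ.+ ℤ.+ 2 ℤ.* h) ℤ.+ ℤ.+ 2 ℤ.* (ℤ.+ 2 ℤ.* h) ℤ.* u in
      ℤ.+ 2 ℤ.+ (ℤ.+ 2 ℤ.* (0ℤ ℤ.+ t ℤ.* (ℤ.+ 2 ℤ.* h)) ℤ.- P ℤ.* P ℤ.- P)
      ≡ (ℤ.+ 2 ℤ.* t ℤ.- ℤ.+ 3 ℤ.- ℤ.+ 2 ℤ.* h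
        ℤ.- ℤ.+ 4 ℤ.* (1ℤ ℤ.+ ℤ.+ 2 ℤ.* h) ℤ.* u ℤ.- ℤ.+ 8 ℤ.* h ℤ.* u ℤ.* u ℤ.- ℤ.+ 2 ℤ.* u) ℤ.* (ℤ.+ 2 ℤ.* h)
    identity = solve-∀
  go u refl (inj₂ refl) (inj₁ refl) eq = contradiction
    (trans (balance (ℤ.+ 2 ℤ.* h) eq) (identity h u t)) (2h≢4hx h _ h≢0)
    where
    identity : ∀ h u t → let P = (1ℤ ℤ.+ ℤ.+ 2 ℤ.* h) ℤ.+ ℤ.+ 2 ℤ.* (ℤ.+ 2 ℤ.* h) ℤ.* u in
      ℤ.+ 2 ℤ.* h ℤ.+ (P ℤ.- (ℤ.+ 2 ℤ.* (1ℤ ℤ.+ t ℤ.* (ℤ.+ 2 ℤ.* h)) ℤ.- P ℤ.* P))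
      ≡ ℤ.+ 2 ℤ.* (ℤ.+ 2 ℤ.* h) ℤ.* (u ℤ.- t ℤ.+ h ℤ.+ ℤ.+ 2
        ℤ.+ ℤ.+ 2 ℤ.* (1ℤ ℤ.+ ℤ.+ 2 ℤ.* h) ℤ.* u ℤ.+ ℤ.+ 4 ℤ.* h ℤ.* u ℤ.* u)
    identity = solve-∀
  go u refl (inj₁ refl) (inj₂ refl) eq = contradiction
    (trans (balance (ℤ.+ 2 ℤ.* h) eq) (identity h u t)) (2h≢4hx h _ h≢0)
    where
    identity : ∀ h u t → let P = (1ℤ ℤ.+ ℤ.+ 2 ℤ.* h) ℤ.+ ℤ.+ 2 ℤ.* (ℤ.+ 2 ℤ.* h) ℤ.* u in
      ℤ.+ 2 ℤ.* h ℤ.+ (ℤ.- P ℤ.- (ℤ.+ 2 ℤ.* (0ℤ ℤ.+ t ℤ.* (ℤ.+ 2 ℤ.* h)) ℤ.- P ℤ.* P))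
      ≡ ℤ.+ 2 ℤ.* (ℤ.+ 2 ℤ.* h) ℤ.* (ℤ.- u ℤ.- t ℤ.+ 1ℤ ℤ.+ h
        ℤ.+ ℤ.+ 2 ℤ.* (1ℤ ℤ.+ ℤ.+ 2 ℤ.* h) ℤ.* u ℤ.+ ℤ.+ 4 ℤ.* h ℤ.* u ℤ.* u)
    identity = solve-∀
  go u refl (inj₂ refl) (inj₂ refl) eq = divides
    (ℤ.- (ℤ.+ 2) ℤ.* u ℤ.- ℤ.+ 2 ℤ.* t ℤ.+ 1ℤ ℤ.+ ℤ.+ 2 ℤ.* h
      ℤ.+ ℤ.+ 4 ℤ.* (1ℤ ℤ.+ ℤ.+ 2 ℤ.* h) ℤ.* u ℤ.+ ℤ.+ 8 ℤ.* h ℤ.* u ℤ.* u)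
    (trans (balance (ℤ.+ 2) eq) (identity h u t))
    where
    identity : ∀ h u t → let P = (1ℤ ℤ.+ ℤ.+ 2 ℤ.* h) ℤ.+ ℤ.+ 2 ℤ.* (ℤ.+ 2 ℤ.* h) ℤ.* u in
      ℤ.+ 2 ℤ.+ (ℤ.- P ℤ.- (ℤ.+ 2 ℤ.* (1ℤ ℤ.+ t ℤ.* (ℤ.+ 2 ℤ.* h)) ℤ.- P ℤ.* P))
      ≡ (ℤ.- (ℤ.+ 2) ℤ.* u ℤ.- ℤ.+ 2 ℤ.* t ℤ.+ 1ℤ ℤ.+ ℤ.+ 2 ℤ.* h
        ℤ.+ ℤ.+ 4 ℤ.* (1ℤ ℤ.+ ℤ.+ 2 ℤ.* h) ℤ.* u ℤ.+ ℤ.+ 8 ℤ.* h ℤ.* u ℤ.* u) ℤ.* (ℤ.+ 2 ℤ.* h)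
    identity = solve-∀

odd≡ : ∀ n → n % 2 ≡ 1 → n ≡ suc (n / 2 * 2)
odd≡ n n%2≡1 = trans (ℕ.m≡m%n+[m/n]*n n 2) (cong (_+ n / 2 * 2) n%2≡1)

odd⇒2∤ : ∀ {n} → n % 2 ≡ 1 → ¬ 2 ℕ.∣ n
odd⇒2∤ {n} n%2≡1 2∣n with () ← trans (sym n%2≡1) (ℕ.n∣m⇒m%n≡0 n 2 2∣n)

odd∧p-1∣2⇒p≡3 : ∀ {p n} → p ≡ suc (suc n) → p % 2 ≡ 1 → suc n ℕ.∣ 2 → p ≡ 3
odd∧p-1∣2⇒p≡3 {n = zero}        refl ()
odd∧p-1∣2⇒p≡3 {n = suc zero}    refl _ _ = refl
odd∧p-1∣2⇒p≡3 {n = suc (suc n)} refl _ n+3∣2 = contradiction (ℕ.∣⇒≤ n+3∣2) λ where (s≤s (s≤s ()))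

fibre-arithmetic : ∀ {p k n} → p ≡ suc (suc n) → p % 2 ≡ 1 → k % 2 ≡ 1 → ∀ {Y E F} →
  (E ≡ 0ℤ) ⊎ (E ≡ 1ℤ) → ℤ.+ suc n ∣ F → (Y ≡ ℤ.+ (p ^ k)) ⊎ (Y ≡ ℤ.- ℤ.+ (p ^ k)) →
  Y ≡ ℤ.+ 2 ℤ.* (E ℤ.+ F) ℤ.- ℤ.+ (p ^ k * p ^ k) → p ≡ 3
fibre-arithmetic {p} {k} {n} p≡ p-odd k-odd {Y} {E} {F} E01 (divides t F≡) Y≡±P eq =
  odd∧p-1∣2⇒p≡3 p≡ p-odd (∣⇒∣ᵤ (subst (_∣ ℤ.+ 2) (sym n+1≡2h) (p-1∣2 h i E t h≢0 E01 Y≡±P′ eq′)))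
  where
  h : ℤ
  h = ℤ.+ (p / 2)
  i : ℕ
  i = k / 2
  n+1≡2h : ℤ.+ suc n ≡ ℤ.+ 2 ℤ.* h
  n+1≡2h = trans (cong ℤ.+_ (ℕ.suc-injective
    (trans (sym p≡) (trans (odd≡ p p-odd) (cong suc (ℕ.*-comm (p / 2) 2)))))) (ℤ.pos-* 2 (p / 2))
  h≢0 : h ≢ 0ℤ
  h≢0 h≡0 with () ← trans n+1≡2h (cong (ℤ.+ 2 ℤ.*_) h≡0)
  P≡ : ℤ.+ (p ^ k) ≡ (1ℤ ℤ.+ ℤ.+ 2 ℤ.* h) ℤ.^ suc (i * 2)
  P≡ = trans (pos-^ p k) (cong₂ ℤ._^_ (trans (cong ℤ.+_ p≡) (cong (λ t → 1ℤ ℤ.+ t) n+1≡2h)) (odd≡ k k-odd))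
  Y≡±P′ : (Y ≡ (1ℤ ℤ.+ ℤ.+ 2 ℤ.* h) ℤ.^ suc (i * 2)) ⊎ (Y ≡ ℤ.- (1ℤ ℤ.+ ℤ.+ 2 ℤ.* h) ℤ.^ suc (i * 2))
  Y≡±P′ = [ (λ Y≡P → inj₁ (trans Y≡P P≡)) , (λ Y≡-P → inj₂ (trans Y≡-P (cong ℤ.-_ P≡))) ]′ Y≡±P
  eq′ : Y ≡ ℤ.+ 2 ℤ.* (E ℤ.+ t ℤ.* (ℤ.+ 2 ℤ.* h)) ℤ.- (1ℤ ℤ.+ ℤ.+ 2 ℤ.* h) ℤ.^ suc (i * 2)
    ℤ.* (1ℤ ℤ.+ ℤ.+ 2 ℤ.* h) ℤ.^ suc (i * 2)
  eq′ = trans eq (cong₂ (λ F Q → ℤ.+ 2 ℤ.* (E ℤ.+ F) ℤ.- Q) (trans F≡ (cong (t ℤ.*_) n+1≡2h))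
    (trans (ℤ.pos-* (p ^ k) (p ^ k)) (cong₂ ℤ._*_ P≡ P≡)))

-- Elements of the group ring with W ⋆ W = v − G

a≢0⇒1≤a² : ∀ {a : ℤ} → a ≢ 0ℤ → 1ℤ ℤ.≤ a ℤ.* a
a≢0⇒1≤a² {ℤ.+ zero}    a≢0 = contradiction refl a≢0
a≢0⇒1≤a² {ℤ.+ suc n}   _   = ℤ.+≤+ (s≤s z≤n)
a≢0⇒1≤a² {ℤ.-[1+ n ]}  _   = ℤ.+≤+ (s≤s z≤n)

a²≡1⇒a≡±1 : ∀ {a} → a ℤ.* a ≡ 1ℤ → (a ≡ 1ℤ) ⊎ (a ≡ ℤ.- 1ℤ)
a²≡1⇒a≡±1 {ℤ.+ zero} ()
a²≡1⇒a≡±1 {ℤ.+ suc zero} _ = inj₁ refl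
a²≡1⇒a≡±1 {ℤ.+ suc (suc n)} ()
a²≡1⇒a≡±1 {ℤ.-[1+ zero ]} _ = inj₂ refl
a²≡1⇒a≡±1 {ℤ.-[1+ suc n ]} ()

module PaleyElement {v : ℕ} {_∙_ : Op₂ (Fin v)} {ε : Fin v} {_⁻¹ : Op₁ (Fin v)}
  (isAbelianGroup : IsAbelianGroup _≡_ _∙_ ε _⁻¹)
  (W : Fin v → ℤ) (Wε≡0 : W ε ≡ 0ℤ) (W≡±1 : ∀ {x} → x ≢ ε → (W x ≡ 1ℤ) ⊎ (W x ≡ ℤ.- 1ℤ))
  (W-sym : ∀ x → W (x ⁻¹) ≡ W x)
  (∑W≡0 : ∑ W ≡ 0ℤ)
  (W⋆W : ∀ x → GroupRing._⋆_ isAbelianGroup W W x ≡ ℤ.+ v ℤ.* δ ε x ℤ.- 1ℤ)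
  (m : ℕ) (v≡m² : v ≡ m * m)
  where

  open GroupRing isAbelianGroup
  open Kernels isAbelianGroup
  open ≡-Reasoning

  -- Convolving W with the constant -1 gives -∑ W = 0, so only the term v of W ⋆ W survives.
  W³ : W ⋆ (W ⋆ W) ≗ ℤ.+ v • W
  W³ x = begin
    (W ⋆ (W ⋆ W)) x                         ≡⟨ ⋆-cong {W} (λ _ → refl) W⋆W x ⟩
    (W ⋆ (λ y → ℤ.+ v ℤ.* δ ε y ℤ.- 1ℤ)) x  ≡⟨ ⋆-comm W (λ y → ℤ.+ v ℤ.* δ ε y ℤ.- 1ℤ) x ⟩
    ((λ y → ℤ.+ v ℤ.* δ ε y ℤ.- 1ℤ) ⋆ W) x  ≡⟨ ⋆-distribʳ W (ℤ.+ v • δ ε) (λ _ → ℤ.- 1ℤ) x ⟩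
    ((ℤ.+ v • δ ε) ⋆ W) x ℤ.+ ((λ _ → ℤ.- 1ℤ) ⋆ W) x
      ≡⟨ cong₂ ℤ._+_ (trans (•-⋆ (ℤ.+ v) (δ ε) W x) (cong (ℤ.+ v ℤ.*_) (⋆-identityˡ W x))) const⋆W ⟩
    ℤ.+ v ℤ.* W x ℤ.+ 0ℤ                    ≡⟨ ℤ.+-identityʳ _ ⟩
    ℤ.+ v ℤ.* W x                           ∎
    where
    const⋆W : ((λ _ → ℤ.- 1ℤ) ⋆ W) x ≡ 0ℤ
    const⋆W = trans (const-⋆ (ℤ.- 1ℤ) W x) (cong (ℤ.- 1ℤ ℤ.*_) ∑W≡0)

  Sign : ℤ → Set
  Sign a = (a ≡ 0ℤ) ⊎ (a ≡ 1ℤ) ⊎ (a ≡ ℤ.- 1ℤ)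

  W-sign : ∀ x → Sign (W x)
  W-sign x with x Fin.≟ ε
  ... | yes refl = inj₁ Wε≡0
  ... | no x≢ε   = inj₂ (W≡±1 x≢ε)

  sign^odd : ∀ {a} → Sign a → ∀ n → a ℤ.^ suc (n * 2) ≡ a
  sign^odd (inj₁ refl) n = refl
  sign^odd (inj₂ (inj₁ refl)) n = ℤ.^-zeroˡ (suc (n * 2))
  sign^odd (inj₂ (inj₂ refl)) zero = refl
  sign^odd (inj₂ (inj₂ refl)) (suc n) rewrite sign^odd (inj₂ (inj₂ refl)) n = refl

  -- Distinct signs differ by 1 or 2 in absolute value, which is less than q.
  sign-congruent : ∀ {q} → 3 ≤ q → ∀ {a b} → Sign a → Sign b → ℤ.+ q ∣ a ℤ.- b → a ≡ b
  sign-congruent 3≤q (inj₁ refl)        (inj₁ refl)        _ = refl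
  sign-congruent 3≤q (inj₂ (inj₁ refl)) (inj₂ (inj₁ refl)) _ = refl
  sign-congruent 3≤q (inj₂ (inj₂ refl)) (inj₂ (inj₂ refl)) _ = refl
  sign-congruent 3≤q (inj₁ refl)        (inj₂ (inj₁ refl)) d = contradiction (∣⇒∣ᵤ d) (ℕ.>⇒∤ (ℕ.<⇒≤ 3≤q))
  sign-congruent 3≤q (inj₁ refl)        (inj₂ (inj₂ refl)) d = contradiction (∣⇒∣ᵤ d) (ℕ.>⇒∤ (ℕ.<⇒≤ 3≤q))
  sign-congruent 3≤q (inj₂ (inj₁ refl)) (inj₁ refl)        d = contradiction (∣⇒∣ᵤ d) (ℕ.>⇒∤ (ℕ.<⇒≤ 3≤q))
  sign-congruent 3≤q (inj₂ (inj₂ refl)) (inj₁ refl)        d = contradiction (∣⇒∣ᵤ d) (ℕ.>⇒∤ (ℕ.<⇒≤ 3≤q))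
  sign-congruent 3≤q (inj₂ (inj₁ refl)) (inj₂ (inj₂ refl)) d = contradiction (∣⇒∣ᵤ d) (ℕ.>⇒∤ 3≤q)
  sign-congruent 3≤q (inj₂ (inj₂ refl)) (inj₂ (inj₁ refl)) d = contradiction (∣⇒∣ᵤ d) (ℕ.>⇒∤ 3≤q)

  -- An extra factor m turns v^((q - 1)/2) into m^q, to which Fermat applies directly and without
  -- inverting m.
  v^n : ∀ n → ℤ.+ m ℤ.* (ℤ.+ v) ℤ.^ n ≡ (ℤ.+ m) ℤ.^ suc (n * 2)
  v^n zero    = refl
  v^n (suc n) = begin
    ℤ.+ m ℤ.* (ℤ.+ v ℤ.* (ℤ.+ v) ℤ.^ n)
      ≡⟨ cong (λ w → ℤ.+ m ℤ.* (w ℤ.* (ℤ.+ v) ℤ.^ n)) (trans (cong ℤ.+_ v≡m²) (ℤ.pos-* m m)) ⟩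
    ℤ.+ m ℤ.* (ℤ.+ m ℤ.* ℤ.+ m ℤ.* (ℤ.+ v) ℤ.^ n)    ≡⟨ regroup (ℤ.+ m) _ ⟩
    ℤ.+ m ℤ.* (ℤ.+ m ℤ.* (ℤ.+ m ℤ.* (ℤ.+ v) ℤ.^ n))  ≡⟨ cong (λ w → ℤ.+ m ℤ.* (ℤ.+ m ℤ.* w)) (v^n n) ⟩
    ℤ.+ m ℤ.* (ℤ.+ m ℤ.* (ℤ.+ m) ℤ.^ suc (n * 2))    ∎
    where
    regroup : ∀ m a → m ℤ.* (m ℤ.* m ℤ.* a) ≡ m ℤ.* (m ℤ.* (m ℤ.* a))
    regroup = solve-∀

  -- Frobenius gives V W(q x) ≡ W(x) modulo q. Multiplied by m, with m V = m^q ≡ m, this makes q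
  -- divide m (W(q x) - W(x)); as q does not divide m, it divides the difference of two signs.
  multiplier-prime : ∀ {q} → Prime q → 3 ≤ q → ¬ q ℕ.∣ v → ∀ V → ℤ.+ m ℤ.* V ≡ (ℤ.+ m) ℤ.^ q →
                     W ^⋆ q ≗ V • W → (∀ x → W x ℤ.^ q ≡ W x) → ∀ x → W (q · x) ≡ W x
  multiplier-prime {q} pr 3≤q q∤v V mV≡m^q W^q≗VW sign^q x =
    sign-congruent 3≤q (W-sign (q · x)) (W-sign x) q∣difference
    where
    q∤m : ¬ ℤ.+ q ∣ ℤ.+ m
    q∤m q∣m = q∤v (subst (q ℕ.∣_) (sym v≡m²) (ℕ.∣m⇒∣m*n m (∣⇒∣ᵤ q∣m)))
    W^q : ℤ.+ q ∣ V ℤ.* W (q · x) ℤ.- W x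
    W^q = subst₂ (λ a b → ℤ.+ q ∣ a ℤ.- b) (W^q≗VW (q · x)) (sign^q x)
      (frobenius-at {n = v} pr (prime∤⇒coprime pr q∤v) W x λ g _ → trans (order·≡ε g) (sym (order·≡ε x)))
    combine : ∀ m V M a b → m ℤ.* V ≡ M → m ℤ.* (V ℤ.* a ℤ.- b) ℤ.- (M ℤ.- m) ℤ.* a ≡ m ℤ.* (a ℤ.- b)
    combine m V _ a b refl = identity m V a b
      where
      identity : ∀ m V a b → m ℤ.* (V ℤ.* a ℤ.- b) ℤ.- (m ℤ.* V ℤ.- m) ℤ.* a ≡ m ℤ.* (a ℤ.- b)
      identity = solve-∀
    q∣m*difference : ℤ.+ q ∣ ℤ.+ m ℤ.* (W (q · x) ℤ.- W x)
    q∣m*difference = subst (ℤ.+ q ∣_) (combine (ℤ.+ m) V ((ℤ.+ m) ℤ.^ q) (W (q · x)) (W x) mV≡m^q)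
      (∣m∣n⇒∣m-n (∣n⇒∣m*n (ℤ.+ m) W^q) (∣m⇒∣m*n (W (q · x)) (fermat pr m)))
    q∣difference : ℤ.+ q ∣ W (q · x) ℤ.- W x
    q∣difference = [ (λ q∣m → contradiction q∣m q∤m) , (λ q∣d → q∣d) ]′
      (prime∣* pr (ℤ.+ m) (W (q · x) ℤ.- W x) q∣m*difference)

  multiplier-odd-prime : ∀ n → Prime (suc (n * 2)) → ¬ suc (n * 2) ℕ.∣ v → ∀ x → W (suc (n * 2) · x) ≡ W x
  multiplier-odd-prime zero      pr = contradiction (prime≥2 pr) λ where (s≤s ())
  multiplier-odd-prime n@(suc _) pr q∤v = multiplier-prime pr (s≤s (s≤s (s≤s z≤n))) q∤v
    ((ℤ.+ v) ℤ.^ n) (v^n n) (^⋆-odd (ℤ.+ v) W W³ n) (λ x → sign^odd (W-sign x) n)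

  multiplier-odd : ∀ {s} → ¬ 2 ℕ.∣ s → (∀ {q} → Prime q → q ℕ.∣ s → ¬ q ℕ.∣ v) → ∀ x → W (s · x) ≡ W x
  multiplier-odd {zero}      2∤s _ = contradiction (ℕ._∣0 2) 2∤s
  multiplier-odd {s@(suc _)} 2∤s s⊥v x =
    subst (λ t → W (t · x) ≡ W x) (sym (isFactorisation f)) (go (factors f) (factorsPrime f)
      (λ q∣ → 2∤s (subst (2 ℕ.∣_) (sym (isFactorisation f)) q∣))
      (λ pr q∣ → s⊥v pr (subst (_ ℕ.∣_) (sym (isFactorisation f)) q∣)))
    where
    open PrimeFactorisation
    f = factorise s
    go : ∀ qs → All Prime qs → ¬ 2 ℕ.∣ product qs → (∀ {q} → Prime q → q ℕ.∣ product qs → ¬ q ℕ.∣ v) → W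
      (product qs · x) ≡ W x
    go []       []        _  _   = cong W (1· x)
    go (q ∷ qs) (pr ∷ prs) 2∤ ⊥v with q % 2 in q%2 | ℕ.m≡m%n+[m/n]*n q 2
    ... | 0 | eq = contradiction (ℕ.∣m⇒∣m*n (product qs) (ℕ.divides (q / 2) eq)) 2∤
    ... | 1 | eq = begin
      W ((q * product qs) · x)  ≡⟨ cong W (·-assoc x q (product qs)) ⟨
      W (q · (product qs · x))  ≡⟨ odd-step (product qs · x) ⟩
      W (product qs · x)        ≡⟨ go qs prs (λ d → 2∤ (ℕ.∣n⇒∣m*n q d)) (λ pr d → ⊥v pr (ℕ.∣n⇒∣m*n q d)) ⟩
      W x                       ∎
      where
      odd-step : ∀ y → W (q · y) ≡ W y
      odd-step = subst (λ q → ∀ y → W (q · y) ≡ W y) (sym eq)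
        (multiplier-odd-prime (q / 2) (subst Prime eq pr)
          (subst (λ q → ¬ q ℕ.∣ v) eq (⊥v pr (ℕ.m∣m*n (product qs)))))
    ... | suc (suc r) | _ = contradiction (subst (_< 2) q%2 (ℕ.m%n<n q 2)) λ where (s≤s (s≤s ()))

  multiplier : ¬ 2 ℕ.∣ v → ∀ {s} → (∀ {q} → Prime q → q ℕ.∣ s → ¬ q ℕ.∣ v) → ∀ x → W (s · x) ≡ W x
  multiplier 2∤v {s} s⊥v x with 2 ℕ.∣? s
  ... | no  2∤s = multiplier-odd 2∤s s⊥v x
  -- The prime 2 cannot separate 1 from -1, so an even s is replaced by the odd number s + v, which
  -- acts in the same way.
  ... | yes 2∣s = trans (cong W (sym shift))
    (multiplier-odd (λ 2∣s+v → 2∤v (ℕ.∣m+n∣m⇒∣n 2∣s+v 2∣s))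
    (λ {q} pr q∣s+v q∣v → s⊥v pr (ℕ.∣m+n∣m⇒∣n (subst (q ℕ.∣_) (ℕ.+-comm s v) q∣s+v) q∣v) q∣v) x)
    where
    shift : (s + v) · x ≡ s · x
    shift = trans (·-+ x s v) (trans (cong ((s · x) ∙_) (order·≡ε x)) (identityʳ _))

  module Projection {p : ℕ} (p-prime : Prime p) (2∤p : ¬ 2 ℕ.∣ p) (k r : ℕ) (p∤r : ¬ p ℕ.∣ r)
    (a*r≡v : (p ^ k * p ^ k) * r ≡ v) where

    a : ℕ
    a = p ^ k * p ^ k

    prime∣a : ∀ {q} → Prime q → q ℕ.∣ a → q ≡ p
    prime∣a {q} pr q∣a = prime∣prime^⇒≡ p-prime pr (k + k) (subst (q ℕ.∣_) (sym (ℕ.^-distribˡ-+-* p k k)) q∣a)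

    a≢0 : NonZero a
    a≢0 = ≢-nonZero λ a≡0 → v≢0 (trans (sym a*r≡v) (cong (_* r) a≡0))

    a⊥r : Coprime a r
    a⊥r = coprime-from-primes {{a≢0}} λ {q} pr q∣a q∣r → p∤r (subst (ℕ._∣ r) (prime∣a pr q∣a) q∣r)

    2∤a : ¬ 2 ℕ.∣ a
    2∤a 2∣a = 2∤p (subst (2 ℕ.∣_) (prime∣a prime[2] 2∣a) ℕ.∣-refl)

    fibreε≡a : fibre a ε ≡ ℤ.+ a
    fibreε≡a = trans (sym (+kernelSize a)) (cong ℤ.+_ (kernelSize-≡ a⊥r a*r≡v))

    a∣fibre : ∀ y → ℤ.+ a ∣ fibre a y
    a∣fibre y with fibre-view a y
    ... | inj₁ (_ , _ , eq) = divides 1ℤ (trans eq (trans fibreε≡a (sym (ℤ.*-identityˡ _))))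
    ... | inj₂ (_ , eq)     = divides 0ℤ eq

    a∣v : ℤ.+ a ∣ ℤ.+ v
    a∣v = ∣ᵤ⇒∣ (subst (a ℕ.∣_) a*r≡v (ℕ.m∣m*n r))

    Y : Fin v → ℤ
    Y = push a W

    -- The image of v - G under the ring map; the sum of all group elements is mapped to the fibre
    -- sizes.
    Y⋆Y : ∀ y → (Y ⋆ Y) y ≡ ℤ.+ v ℤ.* δ ε y ℤ.- fibre a y
    Y⋆Y y = begin
      (Y ⋆ Y) y                      ≡⟨ push-⋆ a W W y ⟩
      ∑ (λ g → (W ⋆ W) g ℤ.* δ (a · g) y)
        ≡⟨ ∑-cong (λ g → trans (cong (ℤ._* δ (a · g) y) (W⋆W g)) (expand (ℤ.+ v) (δ ε g) (δ (a · g) y))) ⟩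
      ∑ (λ g → ℤ.+ v ℤ.* (δ ε g ℤ.* δ (a · g) y) ℤ.+ ℤ.- 1ℤ ℤ.* δ (a · g) y)
        ≡⟨ ∑-+ (λ g → ℤ.+ v ℤ.* (δ ε g ℤ.* δ (a · g) y)) _ ⟩
      ∑ (λ g → ℤ.+ v ℤ.* (δ ε g ℤ.* δ (a · g) y)) ℤ.+ ∑ (λ g → ℤ.- 1ℤ ℤ.* δ (a · g) y)
        ≡⟨ cong₂ ℤ._+_ (∑-*ˡ (ℤ.+ v) _) (∑-*ˡ (ℤ.- 1ℤ) _) ⟨
      ℤ.+ v ℤ.* ∑ (λ g → δ ε g ℤ.* δ (a · g) y) ℤ.+ ℤ.- 1ℤ ℤ.* fibre a y
        ≡⟨ cong₂ (λ s t → ℤ.+ v ℤ.* s ℤ.+ t) (trans (∑-δˡ ε (λ g → δ (a · g) y)) (cong (λ z → δ z y) (·-ε a)))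
          (ℤ.-1*i≡-i (fibre a y)) ⟩
      ℤ.+ v ℤ.* δ ε y ℤ.- fibre a y  ∎
      where
      expand : ∀ v d e → (v ℤ.* d ℤ.- 1ℤ) ℤ.* e ≡ v ℤ.* (d ℤ.* e) ℤ.+ ℤ.- 1ℤ ℤ.* e
      expand = solve-∀

    a∣Y⋆Y : ∀ y → ℤ.+ a ∣ (Y ⋆ Y) y
    a∣Y⋆Y y = subst (ℤ.+ a ∣_) (sym (Y⋆Y y)) (∣m∣n⇒∣m-n (∣m⇒∣m*n (δ ε y) a∣v) (a∣fibre y))

    -- Off the image of a the value is an empty sum, and the image is killed by r because a r = v.
    Y-support : ∀ y → (r · y ≡ ε) ⊎ (Y y ≡ 0ℤ)
    Y-support y with fibre-view a y
    ... | inj₁ (x , ax≡y , _) = inj₁ (trans (cong (r ·_) (sym ax≡y)) (trans (·-assoc x r a)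
            (trans (cong (_· x) (trans (ℕ.*-comm r a) a*r≡v)) (order·≡ε x))))
    ... | inj₂ (∄x , _) = inj₂ (∑-zero (λ g → trans (cong (W g ℤ.*_) (δ-≢ (∄x g))) (ℤ.*-zeroʳ (W g))))

    p^≢0 : ∀ j → ℤ.NonZero (ℤ.+ (p ^ j))
    p^≢0 j = ℕ.m^n≢0 p j {{prime⇒nonZero p-prime}}

    square : ∀ c U → Y ≗ c • U → ∀ y → (Y ⋆ Y) y ≡ c ℤ.* (c ℤ.* (U ⋆ U) y)
    square c U Y≡cU y = trans (⋆-cong Y≡cU Y≡cU y) (trans (•-⋆ c U (c • U) y) (cong (c ℤ.*_) (⋆-• c U U y)))

    -- The group algebra of the image, whose exponent r is prime to p, has no nilpotents modulo p.
    p∣U⋆U⇒p∣U : ∀ U → (∀ y → (r · y ≡ ε) ⊎ (U y ≡ 0ℤ)) → (∀ y → ℤ.+ p ∣ (U ⋆ U) y) → ∀ y → ℤ.+ p ∣ U y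
    p∣U⋆U⇒p∣U U support p∣U² y with support y
    ... | inj₂ Uy≡0 = divides 0ℤ Uy≡0
    ... | inj₁ ry≡ε = prime∣^ p-prime (U y) p (∣m-n∣m⇒∣n
      (frobenius-at p-prime (prime∤⇒coprime p-prime p∤r) U y λ g Ug≢0 → trans (kills g Ug≢0) (sym ry≡ε))
      (p∣U^ p-prime (p · y)))
      where
      kills : ∀ g → U g ≢ 0ℤ → r · g ≡ ε
      kills g Ug≢0 with support g
      ... | inj₁ rg≡ε = rg≡ε
      ... | inj₂ Ug≡0 = contradiction Ug≡0 Ug≢0
      p∣U^ : ∀ {q} → Prime q → ∀ x → ℤ.+ p ∣ (U ^⋆ q) x
      p∣U^ {zero} pr with () ← prime⇒nonZero pr
      p∣U^ {suc zero} pr = contradiction (prime≥2 pr) λ where (s≤s ())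
      p∣U^ {suc (suc n)} pr x = subst (ℤ.+ p ∣_) (⋆-assoc U U (U ^⋆ n) x)
        (∑-∣ (ℤ.+ p) (λ z → ∣m⇒∣m*n ((U ^⋆ n) ((z ⁻¹) ∙ x)) (p∣U² z)))

    -- If Y = p^j U with j < k, then a divides p^(2j) (U ⋆ U), and a still contains the factor p
    -- beyond p^(2j). So p divides U ⋆ U, hence U.
    p^j∣Y : ∀ j → j ≤ k → ∃ λ U → Y ≗ ℤ.+ (p ^ j) • U
    p^j∣Y zero    _   = Y , λ y → sym (ℤ.*-identityˡ (Y y))
    p^j∣Y (suc j) j<k with p^j∣Y j (ℕ.<⇒≤ j<k)
    ... | U , Y≡ = (λ y → _∣_.quotient (p∣U y)) , λ y → begin
      Y y                                       ≡⟨ Y≡ y ⟩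
      P ℤ.* U y                                 ≡⟨ cong (P ℤ.*_) (_∣_.equality (p∣U y)) ⟩
      P ℤ.* (_∣_.quotient (p∣U y) ℤ.* ℤ.+ p)    ≡⟨ regroup P _ (ℤ.+ p) ⟩
      ℤ.+ p ℤ.* P ℤ.* _∣_.quotient (p∣U y)      ≡⟨ cong (ℤ._* _∣_.quotient (p∣U y)) (ℤ.pos-* p (p ^ j)) ⟨
      ℤ.+ (p ^ suc j) ℤ.* _∣_.quotient (p∣U y)  ∎
      where
      P = ℤ.+ (p ^ j)
      regroup : ∀ P q p → P ℤ.* (q ℤ.* p) ≡ p ℤ.* P ℤ.* q
      regroup = solve-∀
      i = k ∸ suc j
      p^k≡ : p ^ k ≡ p ^ j * (p * p ^ i)
      p^k≡ = begin
        p ^ k                ≡⟨ cong (p ^_) (trans (sym (ℕ.m+[n∸m]≡n j<k)) (sym (ℕ.+-suc j i))) ⟩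
        p ^ (j + suc i)      ≡⟨ ℕ.^-distribˡ-+-* p j (suc i) ⟩
        p ^ j * (p * p ^ i)  ∎
      -- The cofactor of p^(2j + 1) in a.
      D = p ^ i * p ^ i * p
      a≡ : ℤ.+ a ≡ P ℤ.* (P ℤ.* (ℤ.+ D ℤ.* ℤ.+ p))
      a≡ = begin
        ℤ.+ (p ^ k * p ^ k)                                ≡⟨ cong ℤ.+_ (cong₂ _*_ p^k≡ p^k≡) ⟩
        ℤ.+ (p ^ j * (p * p ^ i) * (p ^ j * (p * p ^ i)))  ≡⟨ cong ℤ.+_ (rearrange (p ^ j) p (p ^ i)) ⟩
        ℤ.+ (p ^ j * (p ^ j * (D * p)))
          ≡⟨ trans (ℤ.pos-* (p ^ j) _) (cong (P ℤ.*_) (trans (ℤ.pos-* (p ^ j) _) (cong (P ℤ.*_) (ℤ.pos-* D p)))) ⟩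
        P ℤ.* (P ℤ.* (ℤ.+ D ℤ.* ℤ.+ p))                    ∎
        where
        rearrange : ∀ P p I → P * (p * I) * (P * (p * I)) ≡ P * (P * (I * I * p * p))
        rearrange = solveℕ
      p∣U⋆U : ∀ y → ℤ.+ p ∣ (U ⋆ U) y
      p∣U⋆U y = ∣-trans (∣n⇒∣m*n (ℤ.+ D) ∣-refl)
        (*-cancelˡ-∣ P {{p^≢0 j}} (*-cancelˡ-∣ P {{p^≢0 j}} (subst₂ _∣_ a≡ (square P U Y≡ y) (a∣Y⋆Y y))))
      U-support : ∀ y → (r · y ≡ ε) ⊎ (U y ≡ 0ℤ)
      U-support y with Y-support y
      ... | inj₁ ry≡ε = inj₁ ry≡ε
      ... | inj₂ Yy≡0 = inj₂ (ℤ.*-cancelˡ-≡ P (U y) 0ℤ {{p^≢0 j}}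
        (trans (sym (Y≡ y)) (trans Yy≡0 (sym (ℤ.*-zeroʳ P)))))
      p∣U : ∀ y → ℤ.+ p ∣ U y
      p∣U = p∣U⋆U⇒p∣U U U-support p∣U⋆U

    -- A full fibre over y ≠ ε has an odd number a of points, and W is odd at each of them.
    Y-odd : ∀ {y} → y ≢ ε → fibre a y ≡ fibre a ε → Y y ≢ 0ℤ
    Y-odd {y} y≢ε full Yy≡0 =
      2∤a (∣⇒∣ᵤ (subst (ℤ.+ 2 ∣_) (trans full fibreε≡a)
      (∣m-n∣m⇒∣n 2∣Y-fibre (subst (ℤ.+ 2 ∣_) (sym Yy≡0) (divides 0ℤ refl)))))
      where
      2∣W-1 : ∀ {g} → g ≢ ε → ℤ.+ 2 ∣ W g ℤ.- 1ℤ
      2∣W-1 g≢ε with W≡±1 g≢ε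
      ... | inj₁ eq = subst (λ w → ℤ.+ 2 ∣ w ℤ.- 1ℤ) (sym eq) (divides 0ℤ refl)
      ... | inj₂ eq = subst (λ w → ℤ.+ 2 ∣ w ℤ.- 1ℤ) (sym eq) (divides (ℤ.- 1ℤ) refl)
      2∣term : ∀ g → ℤ.+ 2 ∣ (W g ℤ.- 1ℤ) ℤ.* δ (a · g) y
      2∣term g with δ-view (a · g) y
      ... | inj₂ (_ , eq) = subst (λ d → ℤ.+ 2 ∣ (W g ℤ.- 1ℤ) ℤ.* d) (sym eq) (divides 0ℤ (ℤ.*-zeroʳ (W g ℤ.- 1ℤ)))
      ... | inj₁ (ag≡y , _) =
        ∣m⇒∣m*n (δ (a · g) y) (2∣W-1 λ g≡ε → y≢ε (trans (sym ag≡y) (trans (cong (a ·_) g≡ε) (·-ε a))))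
      2∣Y-fibre : ℤ.+ 2 ∣ Y y ℤ.- fibre a y
      2∣Y-fibre = subst (ℤ.+ 2 ∣_) (begin
        ∑ (λ g → (W g ℤ.- 1ℤ) ℤ.* δ (a · g) y)                    ≡⟨ ∑-cong (λ g → expand (W g) (δ (a · g) y)) ⟩
        ∑ (λ g → W g ℤ.* δ (a · g) y ℤ.+ ℤ.- 1ℤ ℤ.* δ (a · g) y)  ≡⟨ ∑-+ (λ g → W g ℤ.* δ (a · g) y) _ ⟩
        Y y ℤ.+ ∑ (λ g → ℤ.- 1ℤ ℤ.* δ (a · g) y)
          ≡⟨ cong (λ s → Y y ℤ.+ s) (trans (sym (∑-*ˡ (ℤ.- 1ℤ) _)) (ℤ.-1*i≡-i (fibre a y))) ⟩
        Y y ℤ.- fibre a y                                         ∎) (∑-∣ (ℤ.+ 2) 2∣term)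
        where
        expand : ∀ w d → (w ℤ.- 1ℤ) ℤ.* d ≡ w ℤ.* d ℤ.+ ℤ.- 1ℤ ℤ.* d
        expand = solve-∀

    Y-sym : ∀ y → Y (y ⁻¹) ≡ Y y
    Y-sym y = begin
      ∑ (λ g → W g ℤ.* δ (a · g) (y ⁻¹))            ≡⟨ ∑-inverse (λ g → W g ℤ.* δ (a · g) (y ⁻¹)) ⟨
      ∑ (λ g → W (g ⁻¹) ℤ.* δ (a · (g ⁻¹)) (y ⁻¹))  ≡⟨ ∑-cong (λ g → cong₂ ℤ._*_ (W-sym g) (δ-⇔ (to g) (from g))) ⟩
      ∑ (λ g → W g ℤ.* δ (a · g) y)                 ∎
      where
      to : ∀ g → a · (g ⁻¹) ≡ y ⁻¹ → a · g ≡ y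
      to g eq = ⁻¹-injective (trans (sym (·-⁻¹ a g)) eq)
      from : ∀ g → a · g ≡ y → a · (g ⁻¹) ≡ y ⁻¹
      from g eq = trans (·-⁻¹ a g) (cong _⁻¹ eq)

    -- Write Y = P U with P = p^k. The squares of U sum to v / a - 1, the number of non-zero points
    -- in the image; U is non-zero at each of these, so each square there is exactly 1.
    Y-values : ∀ {y} → y ≢ ε → fibre a y ≡ fibre a ε → (Y y ≡ ℤ.+ (p ^ k)) ⊎ (Y y ≡ ℤ.- ℤ.+ (p ^ k))
    Y-values {y} y≢ε full with p^j∣Y k ℕ.≤-refl
    ... | U , Y≡ = values
      where
      P = ℤ.+ (p ^ k)
      +a≡ : ℤ.+ a ≡ P ℤ.* P
      +a≡ = ℤ.pos-* (p ^ k) (p ^ k)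
      instance
        P≢0 = p^≢0 k
      -- Termwise non-negative, since U is odd on the non-zero points of the image, but of total 0.
      excess : Fin v → ℤ
      excess y = ℤ.+ a ℤ.* (U y ℤ.* U y) ℤ.- fibre a y ℤ.+ ℤ.+ a ℤ.* δ ε y
      U-sym : ∀ y → U (y ⁻¹) ≡ U y
      U-sym y = ℤ.*-cancelˡ-≡ P _ _ (trans (sym (Y≡ (y ⁻¹))) (trans (Y-sym y) (Y≡ y)))
      ∑-squares : ∑ (λ y → ℤ.+ a ℤ.* (U y ℤ.* U y)) ≡ ℤ.+ v ℤ.- ℤ.+ a
      ∑-squares = begin
        ∑ (λ y → ℤ.+ a ℤ.* (U y ℤ.* U y))  ≡⟨ ∑-*ˡ (ℤ.+ a) _ ⟨
        -- Symmetry of U turns the sum of squares into the value of U ⋆ U at the identity.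
        ℤ.+ a ℤ.* ∑ (λ y → U y ℤ.* U y)
          ≡⟨ cong (ℤ.+ a ℤ.*_) (∑-cong (λ y → cong (U y ℤ.*_)
            (trans (sym (U-sym y)) (cong U (sym (identityʳ (y ⁻¹))))))) ⟩
        ℤ.+ a ℤ.* (U ⋆ U) ε                ≡⟨ trans (cong (ℤ._* (U ⋆ U) ε) +a≡) (ℤ.*-assoc P P _) ⟩
        P ℤ.* (P ℤ.* (U ⋆ U) ε)            ≡⟨ square P U Y≡ ε ⟨
        (Y ⋆ Y) ε                          ≡⟨ Y⋆Y ε ⟩
        ℤ.+ v ℤ.* δ ε ε ℤ.- fibre a ε      ≡⟨ cong₂ (λ d f → ℤ.+ v ℤ.* d ℤ.- f) (δ-≡ {x = ε} refl) fibreε≡a ⟩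
        ℤ.+ v ℤ.* 1ℤ ℤ.- ℤ.+ a             ≡⟨ cong (ℤ._- ℤ.+ a) (ℤ.*-identityʳ (ℤ.+ v)) ⟩
        ℤ.+ v ℤ.- ℤ.+ a                    ∎
      ∑-excess : ∑ excess ≡ 0ℤ
      ∑-excess = begin
        ∑ excess                                 ≡⟨ ∑-+ (λ y → ℤ.+ a ℤ.* (U y ℤ.* U y) ℤ.- fibre a y) _ ⟩
        ∑ (λ y → ℤ.+ a ℤ.* (U y ℤ.* U y) ℤ.- fibre a y) ℤ.+ ∑ (λ y → ℤ.+ a ℤ.* δ ε y)
          ≡⟨ cong₂ ℤ._+_ (∑-+ (λ y → ℤ.+ a ℤ.* (U y ℤ.* U y)) _)
            (trans (∑-cong (λ y → ℤ.*-comm (ℤ.+ a) (δ ε y))) (∑-δˡ ε (λ _ → ℤ.+ a))) ⟩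
        ∑ (λ y → ℤ.+ a ℤ.* (U y ℤ.* U y)) ℤ.+ ∑ (λ y → ℤ.- fibre a y) ℤ.+ ℤ.+ a
          ≡⟨ cong₂ (λ s t → s ℤ.+ t ℤ.+ ℤ.+ a) ∑-squares ∑-neg ⟩
        ℤ.+ v ℤ.- ℤ.+ a ℤ.+ ℤ.- ℤ.+ v ℤ.+ ℤ.+ a  ≡⟨ cancel (ℤ.+ v) (ℤ.+ a) ⟩
        0ℤ                                       ∎
        where
        cancel : ∀ v a → v ℤ.- a ℤ.+ ℤ.- v ℤ.+ a ≡ 0ℤ
        cancel = solve-∀
        ∑-neg : ∑ (λ y → ℤ.- fibre a y) ≡ ℤ.- ℤ.+ v
        ∑-neg = trans (∑-cong (λ y → sym (ℤ.-1*i≡-i (fibre a y))))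
          (trans (sym (∑-*ˡ (ℤ.- 1ℤ) (fibre a))) (trans (cong (ℤ.- 1ℤ ℤ.*_) (∑-fibre a)) (ℤ.-1*i≡-i (ℤ.+ v))))
      excess-full : ∀ {y} → y ≢ ε → fibre a y ≡ fibre a ε → excess y ≡ ℤ.+ a ℤ.* (U y ℤ.* U y ℤ.- 1ℤ)
      excess-full {y} y≢ε full =
        trans (cong₂ (λ f d → ℤ.+ a ℤ.* (U y ℤ.* U y) ℤ.- f ℤ.+ ℤ.+ a ℤ.* d) (trans full fibreε≡a)
        (δ-≢ (λ e → y≢ε (sym e)))) (factor (ℤ.+ a) (U y ℤ.* U y))
        where
        factor : ∀ a u → a ℤ.* u ℤ.- a ℤ.+ a ℤ.* 0ℤ ≡ a ℤ.* (u ℤ.- 1ℤ)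
        factor = solve-∀
      U≢0 : ∀ {y} → y ≢ ε → fibre a y ≡ fibre a ε → U y ≢ 0ℤ
      U≢0 {y} y≢ε full Uy≡0 = Y-odd y≢ε full (trans (Y≡ y) (trans (cong (P ℤ.*_) Uy≡0) (ℤ.*-zeroʳ P)))
      a*-nonneg : ∀ {t} → 0ℤ ℤ.≤ t → 0ℤ ℤ.≤ ℤ.+ a ℤ.* t
      a*-nonneg {t} 0≤t = subst (ℤ._≤ ℤ.+ a ℤ.* t) (ℤ.*-zeroʳ (ℤ.+ a)) (ℤ.*-monoˡ-≤-nonNeg (ℤ.+ a) 0≤t)
      square-nonneg : ∀ t → 0ℤ ℤ.≤ t ℤ.* t
      square-nonneg (ℤ.+ zero)    = ℤ.+≤+ z≤n
      square-nonneg (ℤ.+ suc n)   = ℤ.+≤+ z≤n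
      square-nonneg ℤ.-[1+ n ]    = ℤ.+≤+ z≤n
      excess-nonneg : ∀ y → 0ℤ ℤ.≤ excess y
      excess-nonneg y with y Fin.≟ ε
      ... | yes refl = subst (0ℤ ℤ.≤_) (sym
        (trans (cong₂ (λ f d → ℤ.+ a ℤ.* (U y ℤ.* U y) ℤ.- f ℤ.+ ℤ.+ a ℤ.* d) fibreε≡a (δ-≡ {x = y} refl))
        (drop (ℤ.+ a) _))) (a*-nonneg (square-nonneg (U y)))
        where
        drop : ∀ a u → a ℤ.* u ℤ.- a ℤ.+ a ℤ.* 1ℤ ≡ a ℤ.* u
        drop = solve-∀
      ... | no y≢ε with fibre-view a y
      ...   | inj₁ (_ , _ , full) =
        subst (0ℤ ℤ.≤_) (sym (excess-full y≢ε full)) (a*-nonneg (ℤ.i≤j⇒0≤j-i (a≢0⇒1≤a² (U≢0 y≢ε full))))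
      ...   | inj₂ (_ , empty) =
        subst (0ℤ ℤ.≤_) (sym (trans (cong₂ (λ f d → ℤ.+ a ℤ.* (U y ℤ.* U y) ℤ.- f ℤ.+ ℤ.+ a ℤ.* d) empty
        (δ-≢ (λ e → y≢ε (sym e)))) (drop (ℤ.+ a) _))) (a*-nonneg (square-nonneg (U y)))
        where
        drop : ∀ a u → a ℤ.* u ℤ.- 0ℤ ℤ.+ a ℤ.* 0ℤ ≡ a ℤ.* u
        drop = solve-∀
      U²≡1 : U y ℤ.* U y ≡ 1ℤ
      U²≡1 = ℤ.i-j≡0⇒i≡j (U y ℤ.* U y) 1ℤ (ℤ.*-cancelˡ-≡ (ℤ.+ a) (U y ℤ.* U y ℤ.- 1ℤ) 0ℤ {{a≢0}}
        (trans (sym (excess-full y≢ε full)) (trans (∑-≡0⇒≡0 excess-nonneg ∑-excess y) (sym (ℤ.*-zeroʳ (ℤ.+ a))))))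
      values : (Y y ≡ P) ⊎ (Y y ≡ ℤ.- P)
      values = [ (λ eq → inj₁ (trans (Y≡ y) (trans (cong (P ℤ.*_) eq) (ℤ.*-identityʳ P))))
               , (λ eq → inj₂ (trans (Y≡ y) (trans (cong (P ℤ.*_) eq) (trans (ℤ.*-comm P (ℤ.- 1ℤ)) (ℤ.-1*i≡-i P)))))
               ]′ (a²≡1⇒a≡±1 U²≡1)

  -- No non-zero point of aG is exhibited. If p ≠ 3, every fibre over a non-zero point is empty, so
  -- the kernel is the whole group and v = a, contrary to r ≠ 1.
  p≡3 : ∀ {p} k r → Prime p → p % 2 ≡ 1 → ¬ 2 ℕ.∣ v → k % 2 ≡ 1 → ¬ p ℕ.∣ r → r ≢ 1 → (p ^ k * p ^ k) * r ≡ v →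
    p ≡ 3
  p≡3 {zero}        _          _ _  ()
  p≡3 {suc zero}    _          _ pr = contradiction pr λ pr → prime∤1 pr ℕ.∣-refl
  p≡3 {suc (suc _)} zero       _ _  _ _ ()
  p≡3 {suc (suc n)} k@(suc k′) r p-prime p-odd 2∤v k-odd p∤r r≢1 a*r≡v = main refl p-prime p-odd p∤r a*r≡v
    where
    main : ∀ {p} → p ≡ suc (suc n) → Prime p → p % 2 ≡ 1 → ¬ p ℕ.∣ r → (p ^ k * p ^ k) * r ≡ v → p ≡ 3
    main {p} p≡ p-prime p-odd p∤r a*r≡v with p ℕ.≟ 3
    ... | yes eq  = eq
    ... | no  p≢3 = contradiction r≡1 r≢1
      where
      module Proj = Projection p-prime (odd⇒2∤ p-odd) k r p∤r a*r≡v
      open Proj using (a; fibreε≡a)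
      -- The exponent parameter is 2 k - 1, one less than the exponent of p in a.
      module Count = FibreCount isAbelianGroup W W≡±1 p≡ p-prime (k′ + k) r p∤r
        (trans (cong (_* r) (ℕ.^-distribˡ-+-* p k k)) a*r≡v) (multiplier 2∤v)
      not-full : ∀ {y} → y ≢ ε → fibre a y ≢ fibre a ε
      not-full {y} y≢ε full =
        p≢3 (fibre-arithmetic {k = k} p≡ p-odd k-odd (Count.fixed-part-01 y) (Count.p-1∣free-part y)
        (Proj.Y-values y≢ε full)
        (trans (subst (λ b → push b W y
          ≡ ℤ.+ 2 ℤ.* (∑ (Count.fixed-part y) ℤ.+ ∑ (Count.free-part y)) ℤ.- fibre b y) (ℕ.^-distribˡ-+-* p k k)
          (Count.push-W y≢ε))
          (cong (λ b → ℤ.+ 2 ℤ.* (∑ (Count.fixed-part y) ℤ.+ ∑ (Count.free-part y)) ℤ.- b) (trans full fibreε≡a))))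
      empty : ∀ y → y ≢ ε → fibre a y ≡ 0ℤ
      empty y y≢ε = [ (λ where (_ , _ , full) → contradiction full (not-full y≢ε)) , proj₂ ]′ (fibre-view a y)
      v≡a : v ≡ a
      v≡a = ℤ.+-injective (trans (sym (∑-fibre a)) (trans (∑-single (fibre a) ε empty) fibreε≡a))
      r≡1 : r ≡ 1
      r≡1 = ℕ.*-cancelˡ-≡ r 1 a {{Proj.a≢0}} (trans a*r≡v (trans v≡a (sym (ℕ.*-identityʳ a))))

-- Paley type partial difference sets

-- Here w = (v - 1)/4, so the set has size 2 w, λ = w - 1 and μ = w; both counting conditions
-- together read w - d x.
module PaleySet {v : ℕ} {_∙_ : Op₂ (Fin v)} {ε : Fin v} {_⁻¹ : Op₁ (Fin v)}
  (isAbelianGroup : IsAbelianGroup _≡_ _∙_ ε _⁻¹)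
  (d : Fin v → ℤ) (d-01 : ∀ x → (d x ≡ 0ℤ) ⊎ (d x ≡ 1ℤ)) (dε≡0 : d ε ≡ 0ℤ) (d-sym : ∀ x → d (x ⁻¹) ≡ d x)
  (w : ℤ) (v≡1+4w : ℤ.+ v ≡ 1ℤ ℤ.+ ℤ.+ 4 ℤ.* w) (∑d≡2w : ∑ d ≡ ℤ.+ 2 ℤ.* w)
  (d⋆d : ∀ {x} → x ≢ ε → GroupRing._⋆_ isAbelianGroup d d x ≡ w ℤ.- d x)
  where

  open GroupRing isAbelianGroup
  open ≡-Reasoning

  W : Fin v → ℤ
  W x = ℤ.+ 2 ℤ.* d x ℤ.+ (δ ε x ℤ.+ ℤ.- 1ℤ)

  Wε≡0 : W ε ≡ 0ℤ
  Wε≡0 = cong₂ (λ d e → ℤ.+ 2 ℤ.* d ℤ.+ (e ℤ.+ ℤ.- 1ℤ)) dε≡0 (δ-≡ {x = ε} refl)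

  W≡±1 : ∀ {x} → x ≢ ε → (W x ≡ 1ℤ) ⊎ (W x ≡ ℤ.- 1ℤ)
  W≡±1 {x} x≢ε = [ (λ dx≡0 → inj₂ (value dx≡0)) , (λ dx≡1 → inj₁ (value dx≡1)) ]′ (d-01 x)
    where
    value : ∀ {a} → d x ≡ a → W x ≡ ℤ.+ 2 ℤ.* a ℤ.+ (0ℤ ℤ.+ ℤ.- 1ℤ)
    value dx≡a = cong₂ (λ d e → ℤ.+ 2 ℤ.* d ℤ.+ (e ℤ.+ ℤ.- 1ℤ)) dx≡a (δ-≢ (λ eq → x≢ε (sym eq)))

  W-sym : ∀ x → W (x ⁻¹) ≡ W x
  W-sym x = cong₂ (λ d e → ℤ.+ 2 ℤ.* d ℤ.+ (e ℤ.+ ℤ.- 1ℤ)) (d-sym x)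
    (δ-⇔ (λ ε≡x⁻¹ → trans (sym ε⁻¹≡ε) (trans (cong _⁻¹ ε≡x⁻¹) (⁻¹-involutive x)))
      (λ ε≡x → trans (sym ε⁻¹≡ε) (cong _⁻¹ ε≡x)))
    where
    ε⁻¹≡ε : ε ⁻¹ ≡ ε
    ε⁻¹≡ε = trans (sym (identityʳ _)) (ε⁻¹∙ ε)

  ∑δ : ∑ (δ ε) ≡ 1ℤ
  ∑δ = trans (∑-cong (λ x → sym (ℤ.*-identityʳ (δ ε x)))) (∑-δˡ ε (λ _ → 1ℤ))

  ∑W≡0 : ∑ W ≡ 0ℤ
  ∑W≡0 = begin
    ∑ W  ≡⟨ ∑-+ (λ x → ℤ.+ 2 ℤ.* d x) (λ x → δ ε x ℤ.+ ℤ.- 1ℤ) ⟩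
    ∑ (λ x → ℤ.+ 2 ℤ.* d x) ℤ.+ ∑ (λ x → δ ε x ℤ.+ ℤ.- 1ℤ)
      ≡⟨ cong₂ ℤ._+_ (trans (sym (∑-*ˡ (ℤ.+ 2) d)) (cong (ℤ.+ 2 ℤ.*_) ∑d≡2w))
        (trans (∑-+ (δ ε) (λ _ → ℤ.- 1ℤ))
        (cong₂ ℤ._+_ ∑δ (trans (∑-const v (ℤ.- 1ℤ)) (cong (ℤ._* ℤ.- 1ℤ) v≡1+4w)))) ⟩
    ℤ.+ 2 ℤ.* (ℤ.+ 2 ℤ.* w) ℤ.+ (1ℤ ℤ.+ (1ℤ ℤ.+ ℤ.+ 4 ℤ.* w) ℤ.* ℤ.- 1ℤ)  ≡⟨ identity w ⟩
    0ℤ   ∎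
    where
    identity : ∀ w → ℤ.+ 2 ℤ.* (ℤ.+ 2 ℤ.* w) ℤ.+ (1ℤ ℤ.+ (1ℤ ℤ.+ ℤ.+ 4 ℤ.* w) ℤ.* ℤ.- 1ℤ) ≡ 0ℤ
    identity = solve-∀

  W⋆ : ∀ f x → (W ⋆ f) x ≡ ℤ.+ 2 ℤ.* (d ⋆ f) x ℤ.+ (f x ℤ.+ ℤ.- 1ℤ ℤ.* ∑ f)
  W⋆ f x = begin
    (W ⋆ f) x                                         ≡⟨ ⋆-distribʳ f (ℤ.+ 2 • d) (λ x → δ ε x ℤ.+ ℤ.- 1ℤ) x ⟩
    ((ℤ.+ 2 • d) ⋆ f) x ℤ.+ ((λ x → δ ε x ℤ.+ ℤ.- 1ℤ) ⋆ f) x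
      ≡⟨ cong₂ ℤ._+_ (•-⋆ (ℤ.+ 2) d f x)
        (trans (⋆-distribʳ f (δ ε) (λ _ → ℤ.- 1ℤ) x) (cong₂ ℤ._+_ (⋆-identityˡ f x) (const-⋆ (ℤ.- 1ℤ) f x))) ⟩
    ℤ.+ 2 ℤ.* (d ⋆ f) x ℤ.+ (f x ℤ.+ ℤ.- 1ℤ ℤ.* ∑ f)  ∎

  W⋆W≡ : ∀ x → (W ⋆ W) x ≡ ℤ.+ 2 ℤ.* (ℤ.+ 2 ℤ.* (d ⋆ d) x ℤ.+ (d x ℤ.+ ℤ.- 1ℤ ℤ.* (ℤ.+ 2 ℤ.* w)))
    ℤ.+ (W x ℤ.+ ℤ.- 1ℤ ℤ.* 0ℤ)
  W⋆W≡ x = trans (W⋆ W x) (cong₂ (λ a s → ℤ.+ 2 ℤ.* a ℤ.+ (W x ℤ.+ ℤ.- 1ℤ ℤ.* s))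
    (trans (⋆-comm d W x) (trans (W⋆ d x)
      (cong (λ s → ℤ.+ 2 ℤ.* (d ⋆ d) x ℤ.+ (d x ℤ.+ ℤ.- 1ℤ ℤ.* s)) ∑d≡2w))) ∑W≡0)

  -- As D is closed under inverses, the coefficient at the identity counts the elements of D.
  d⋆dε : (d ⋆ d) ε ≡ ℤ.+ 2 ℤ.* w
  d⋆dε = trans (∑-cong term) ∑d≡2w
    where
    square : ∀ {a} → (a ≡ 0ℤ) ⊎ (a ≡ 1ℤ) → a ℤ.* a ≡ a
    square (inj₁ refl) = refl
    square (inj₂ refl) = refl
    term : ∀ y → d y ℤ.* d ((y ⁻¹) ∙ ε) ≡ d y
    term y = trans (cong (d y ℤ.*_) (trans (cong d (identityʳ (y ⁻¹))) (d-sym y))) (square (d-01 y))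

  W⋆W : ∀ x → (W ⋆ W) x ≡ ℤ.+ v ℤ.* δ ε x ℤ.- 1ℤ
  W⋆W x with x Fin.≟ ε
  ... | yes refl = begin
    (W ⋆ W) x                           ≡⟨ W⋆W≡ x ⟩
    _
      ≡⟨ cong₂ (λ a s → ℤ.+ 2 ℤ.* (ℤ.+ 2 ℤ.* a ℤ.+ (s ℤ.+ ℤ.- 1ℤ ℤ.* (ℤ.+ 2 ℤ.* w)))
        ℤ.+ (W x ℤ.+ ℤ.- 1ℤ ℤ.* 0ℤ)) d⋆dε dε≡0 ⟩
    _
      ≡⟨ cong (λ a → ℤ.+ 2 ℤ.* (ℤ.+ 2 ℤ.* (ℤ.+ 2 ℤ.* w) ℤ.+ (0ℤ ℤ.+ ℤ.- 1ℤ ℤ.* (ℤ.+ 2 ℤ.* w)))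
        ℤ.+ (a ℤ.+ ℤ.- 1ℤ ℤ.* 0ℤ)) Wε≡0 ⟩
    _                                   ≡⟨ identity w ⟩
    (1ℤ ℤ.+ ℤ.+ 4 ℤ.* w) ℤ.* 1ℤ ℤ.- 1ℤ  ≡⟨ cong₂ (λ a e → a ℤ.* e ℤ.- 1ℤ) v≡1+4w (δ-≡ {x = x} refl) ⟨
    ℤ.+ v ℤ.* δ x x ℤ.- 1ℤ              ∎
    where
    identity : ∀ w → ℤ.+ 2 ℤ.* (ℤ.+ 2 ℤ.* (ℤ.+ 2 ℤ.* w) ℤ.+ (0ℤ ℤ.+ ℤ.- 1ℤ ℤ.* (ℤ.+ 2 ℤ.* w)))
      ℤ.+ (0ℤ ℤ.+ ℤ.- 1ℤ ℤ.* 0ℤ) ≡ (1ℤ ℤ.+ ℤ.+ 4 ℤ.* w) ℤ.* 1ℤ ℤ.- 1ℤ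
    identity = solve-∀
  ... | no x≢ε = begin
    (W ⋆ W) x               ≡⟨ W⋆W≡ x ⟩
    _
      ≡⟨ cong₂ (λ a e → ℤ.+ 2 ℤ.* (ℤ.+ 2 ℤ.* a ℤ.+ (d x ℤ.+ ℤ.- 1ℤ ℤ.* (ℤ.+ 2 ℤ.* w)))
        ℤ.+ (ℤ.+ 2 ℤ.* d x ℤ.+ (e ℤ.+ ℤ.- 1ℤ) ℤ.+ ℤ.- 1ℤ ℤ.* 0ℤ)) (d⋆d x≢ε) δ≡0 ⟩
    _                       ≡⟨ identity w (d x) (ℤ.+ v) ⟩
    ℤ.+ v ℤ.* 0ℤ ℤ.- 1ℤ     ≡⟨ cong (λ e → ℤ.+ v ℤ.* e ℤ.- 1ℤ) δ≡0 ⟨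
    ℤ.+ v ℤ.* δ ε x ℤ.- 1ℤ  ∎
    where
    δ≡0 : δ ε x ≡ 0ℤ
    δ≡0 = δ-≢ (λ eq → x≢ε (sym eq))
    identity : ∀ w d v → ℤ.+ 2 ℤ.* (ℤ.+ 2 ℤ.* (w ℤ.- d) ℤ.+ (d ℤ.+ ℤ.- 1ℤ ℤ.* (ℤ.+ 2 ℤ.* w)))
      ℤ.+ (ℤ.+ 2 ℤ.* d ℤ.+ (0ℤ ℤ.+ ℤ.- 1ℤ) ℤ.+ ℤ.- 1ℤ ℤ.* 0ℤ) ≡ v ℤ.* 0ℤ ℤ.- 1ℤ
    identity = solve-∀

-- From subsets of an abstract group to functions on indices

indicator : Bool → ℤ
indicator b = if b then 1ℤ else 0ℤ

sum≡∑ : ∀ {n} (g : Fin n → ℕ) → ℤ.+ List.sum (map g (allFin n)) ≡ ∑ (λ i → ℤ.+ g i)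
sum≡∑ {n} g = trans (go (λ i → i)) (sym (∑-def _))
  where
  go : ∀ {m} (h : Fin m → Fin n) → ℤ.+ List.sum (map g (tabulate h)) ≡ Sum.sum (λ i → ℤ.+ g (h i))
  go {zero}  h = refl
  go {suc m} h = cong (λ s → ℤ.+ g (h zero) ℤ.+ s) (go (λ i → h (suc i)))

count≡∑ : ∀ {n} (b : Fin n → Bool) → ℤ.+ count b ≡ ∑ (λ i → indicator (b i))
count≡∑ b = trans (sum≡∑ _) (∑-cong (λ i → bit (b i)))
  where
  bit : ∀ b → ℤ.+ (if b then 1 else 0) ≡ indicator b
  bit true  = refl
  bit false = refl

count2≡∑∑ : ∀ {n} (b : Fin n → Fin n → Bool) → ℤ.+ count2 b ≡ ∑ (λ i → ∑ (λ j → indicator (b i j)))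
count2≡∑∑ b = trans (sum≡∑ _) (∑-cong (λ i → count≡∑ (b i)))

-- The group law is pulled back along the enumeration to `Fin v`, where equality is propositional
-- and sums over the group are finite sums over indices.
module Transport {c ℓ : Level} (G : AbelianGroup c ℓ) {v : ℕ} (F : FiniteOfOrder G v) (D : Subset G)
  (regular : IsRegular G F D) where

  open AbelianGroup G using (Carrier; _≈_) renaming (_∙_ to _∘ᴳ_; ε to εᴳ; _⁻¹ to _⁻¹ᴳ)
  module A = AbelianGroup G
  open FiniteOfOrder F
  open Subset D

  index : Carrier → Fin v
  index g = proj₁ (enum-surj g)

  enum-index : ∀ g → enum (index g) ≈ g
  enum-index g = proj₂ (enum-surj g)

  infixl 7 _∙_
  _∙_ : Op₂ (Fin v)
  i ∙ j = index (enum i ∘ᴳ enum j)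

  ε : Fin v
  ε = index εᴳ

  _⁻¹ : Op₁ (Fin v)
  i ⁻¹ = index (enum i ⁻¹ᴳ)

  isGroupMonomorphism : IsGroupMonomorphism (record { _≈_ = _≡_ ; _∙_ = _∙_ ; ε = ε ; _⁻¹ = _⁻¹ }) A.rawGroup enum
  isGroupMonomorphism = record
    { isGroupHomomorphism = record
      { isMonoidHomomorphism = record
        { isMagmaHomomorphism = record
          { isRelHomomorphism = record { cong = λ i≡j → A.reflexive (cong enum i≡j) }
          ; homo = λ i j → enum-index _ }
        ; ε-homo = enum-index _ }
      ; ⁻¹-homo = λ i → enum-index _ }
    ; injective = λ {i} {j} → enum-inj i j
    }

  isAbelianGroup : IsAbelianGroup _≡_ _∙_ ε _⁻¹
  isAbelianGroup = GroupMonomorphism.isAbelianGroup isGroupMonomorphism A.isAbelianGroup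

  open GroupRing isAbelianGroup using (_⋆_; inverseʳ; ⁻¹-cancelˡ; ⁻¹-cancelʳ; comm; identityʳ; assoc)
  open GroupRing isAbelianGroup using () renaming (G to Gᶠ)
  open Algebra.Properties.Group (AbelianGroup.group Gᶠ) using (⁻¹-involutive)
  open ≡-Reasoning

  d : Fin v → ℤ
  d i = indicator ⌊ mem? (enum i) ⌋

  d-view : ∀ i → (mem (enum i) × d i ≡ 1ℤ) ⊎ (¬ mem (enum i) × d i ≡ 0ℤ)
  d-view i with mem? (enum i)
  ... | yes m = inj₁ (m , refl)
  ... | no ¬m = inj₂ (¬m , refl)

  d-01 : ∀ i → (d i ≡ 0ℤ) ⊎ (d i ≡ 1ℤ)
  d-01 i = [ (λ m → inj₂ (proj₂ m)) , (λ m → inj₁ (proj₂ m)) ]′ (d-view i)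

  d-⇔ : ∀ {i j} → (mem (enum i) → mem (enum j)) → (mem (enum j) → mem (enum i)) → d i ≡ d j
  d-⇔ {i} {j} to from with d-view i | d-view j
  ... | inj₁ (_ , di)  | inj₁ (_ , dj)  = trans di (sym dj)
  ... | inj₂ (_ , di)  | inj₂ (_ , dj)  = trans di (sym dj)
  ... | inj₁ (mi , _)  | inj₂ (¬mj , _) = contradiction (to mi) ¬mj
  ... | inj₂ (¬mi , _) | inj₁ (mj , _)  = contradiction (from mj) ¬mi

  d-sym : ∀ i → d (i ⁻¹) ≡ d i
  d-sym i = d-⇔ (λ m → proj₁ (proj₂ regular) (enum i) (mem-resp (enum-index _) m))
                (λ m → mem-resp (A.sym (enum-index _)) (proj₁ regular (enum i) m))

  dε≡0 : d ε ≡ 0ℤ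
  dε≡0 with d-view ε
  ... | inj₁ (m , _) = contradiction (mem-resp (enum-index _) m) (proj₂ (proj₂ regular))
  ... | inj₂ (_ , eq) = eq

  size≡∑d : ℤ.+ size G F D ≡ ∑ d
  size≡∑d = count≡∑ (λ i → ⌊ mem? (enum i) ⌋)

  pair : Fin v → Fin v → Fin v → Bool
  pair x i j = ⌊ mem? (enum i) ⌋ ∧ ⌊ mem? (enum j) ⌋ ∧ not ⌊ enum i ≈? enum j ⌋ ∧ ⌊
    (enum i ∘ᴳ enum j ⁻¹ᴳ) ≈? enum x ⌋

  enum-quotient : ∀ i j → enum (i ∙ j ⁻¹) ≈ enum i ∘ᴳ enum j ⁻¹ᴳ
  enum-quotient i j = A.trans (enum-index _) (A.∙-congˡ (enum-index _))

  -- The requirement that the two elements differ is absorbed: equal elements have quotient ε, which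
  -- is not x.
  pair≡ : ∀ {x} → x ≢ ε → ∀ i j → indicator (pair x i j) ≡ d i ℤ.* (d j ℤ.* δ (i ∙ j ⁻¹) x)
  pair≡ {x} x≢ε i j with mem? (enum i)
  ... | no _ = refl
  ... | yes _ with mem? (enum j)
  ...   | no _ = refl
  ...   | yes _ with enum i ≈? enum j
  ...     | yes i≈j = sym (trans (ℤ.*-identityˡ _)
    (trans (ℤ.*-identityˡ _) (δ-≢ λ ij⁻¹≡x → x≢ε
    (trans (sym ij⁻¹≡x) (trans (cong (λ k → k ∙ j ⁻¹) (enum-inj i j i≈j)) (inverseʳ j))))))
  ...     | no _ with (enum i ∘ᴳ enum j ⁻¹ᴳ) ≈? enum x
  ...       | yes ij⁻¹≈x =
    sym (trans (ℤ.*-identityˡ _) (trans (ℤ.*-identityˡ _)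
    (δ-≡ (enum-inj _ _ (A.trans (enum-quotient i j) ij⁻¹≈x)))))
  ...       | no  ij⁻¹≉x =
    sym (trans (ℤ.*-identityˡ _) (trans (ℤ.*-identityˡ _)
    (δ-≢ λ eq → ij⁻¹≉x (A.trans (A.sym (enum-quotient i j)) (A.reflexive (cong enum eq))))))

  -- For given i the only j with i j⁻¹ = x is (i⁻¹ x)⁻¹, and D = D⁻¹ removes the outer inverse. This
  -- turns the count of quotients into a convolution.
  ∑-quotient : ∀ x i → ∑ (λ j → d i ℤ.* (d j ℤ.* δ (i ∙ j ⁻¹) x)) ≡ d i ℤ.* d (i ⁻¹ ∙ x)
  ∑-quotient x i = begin
    ∑ (λ j → d i ℤ.* (d j ℤ.* δ (i ∙ j ⁻¹) x))     ≡⟨ ∑-*ˡ (d i) (λ j → d j ℤ.* δ (i ∙ j ⁻¹) x) ⟨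
    d i ℤ.* ∑ (λ j → d j ℤ.* δ (i ∙ j ⁻¹) x)
      ≡⟨ cong (d i ℤ.*_) (∑-cong (λ j → trans (ℤ.*-comm (d j) (δ (i ∙ j ⁻¹) x))
        (cong (ℤ._* d j) (δ-⇔ (to j) (from j))))) ⟩
    d i ℤ.* ∑ (λ j → δ ((i ⁻¹ ∙ x) ⁻¹) j ℤ.* d j)  ≡⟨ cong (d i ℤ.*_) (∑-δˡ ((i ⁻¹ ∙ x) ⁻¹) d) ⟩
    d i ℤ.* d ((i ⁻¹ ∙ x) ⁻¹)                      ≡⟨ cong (d i ℤ.*_) (d-sym (i ⁻¹ ∙ x)) ⟩
    d i ℤ.* d (i ⁻¹ ∙ x)                           ∎
    where
    to : ∀ j → i ∙ j ⁻¹ ≡ x → (i ⁻¹ ∙ x) ⁻¹ ≡ j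
    to j eq = trans (cong (λ y → (i ⁻¹ ∙ y) ⁻¹) (sym eq)) (trans (cong _⁻¹ (⁻¹-cancelˡ i (j ⁻¹))) (⁻¹-involutive j))
    from : ∀ j → (i ⁻¹ ∙ x) ⁻¹ ≡ j → i ∙ j ⁻¹ ≡ x
    from j eq = trans (cong (λ y → i ∙ y ⁻¹) (sym eq))
      (trans (cong (i ∙_) (⁻¹-involutive (i ⁻¹ ∙ x))) (⁻¹-cancelʳ i x))

  reps≡d⋆d : ∀ {x} → x ≢ ε → ℤ.+ reps G F D (enum x) ≡ (d ⋆ d) x
  reps≡d⋆d {x} x≢ε = trans (count2≡∑∑ (pair x)) (∑-cong (λ i → trans (∑-cong (pair≡ x≢ε i)) (∑-quotient x i)))

  -- With (v - 1)/4 written as `suc w`, v is at least 5, so the subtraction in (v ∸ 5) / 4 is not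
  -- truncated and λ is w.
  module Parameters (w : ℕ) (v≡ : v ≡ 1 + suc w * 4) (paley : IsPaleyPDS G F D) where

    v∸1/2 : (v ∸ 1) / 2 ≡ suc w * 2
    v∸1/2 = trans (cong (λ v → (v ∸ 1) / 2) v≡) (trans (cong (_/ 2) (double w)) (ℕ.m*n/n≡m (suc w * 2) 2))
      where
      double : ∀ w → suc w * 4 ≡ suc w * 2 * 2
      double = solveℕ

    v∸1/4 : (v ∸ 1) / 4 ≡ suc w
    v∸1/4 = trans (cong (λ v → (v ∸ 1) / 4) v≡) (ℕ.m*n/n≡m (suc w) 4)

    v∸5/4 : (v ∸ 5) / 4 ≡ w
    v∸5/4 = trans (cong (λ v → (v ∸ 5) / 4) v≡) (ℕ.m*n/n≡m w 4)

    +v≡ : ℤ.+ v ≡ 1ℤ ℤ.+ ℤ.+ 4 ℤ.* ℤ.+ suc w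
    +v≡ = trans (cong ℤ.+_ v≡) (cong (λ t → 1ℤ ℤ.+ t) (trans (cong ℤ.+_ (ℕ.*-comm (suc w) 4)) (ℤ.pos-* 4 (suc w))))

    ∑d≡ : ∑ d ≡ ℤ.+ 2 ℤ.* ℤ.+ suc w
    ∑d≡ = trans (sym size≡∑d) (trans (cong ℤ.+_ (trans (proj₁ paley) (trans v∸1/2 (ℕ.*-comm (suc w) 2))))
      (ℤ.pos-* 2 (suc w)))

    enum≉ε : ∀ {x} → x ≢ ε → ¬ (enum x ≈ εᴳ)
    enum≉ε x≢ε eq = x≢ε (enum-inj _ _ (A.trans eq (A.sym (enum-index εᴳ))))

    d⋆d : ∀ {x} → x ≢ ε → (d ⋆ d) x ≡ ℤ.+ suc w ℤ.- d x
    d⋆d {x} x≢ε = trans (sym (reps≡d⋆d x≢ε)) ([ in-D , out-D ]′ (d-view x))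
      where
      in-D : mem (enum x) × d x ≡ 1ℤ → ℤ.+ reps G F D (enum x) ≡ ℤ.+ suc w ℤ.- d x
      in-D (m , dx≡1) = trans (cong ℤ.+_ (trans (proj₁ (proj₂ paley) (enum x) (enum≉ε x≢ε) m) v∸5/4))
        (cong (λ t → ℤ.+ suc w ℤ.- t) (sym dx≡1))
      out-D : ¬ mem (enum x) × d x ≡ 0ℤ → ℤ.+ reps G F D (enum x) ≡ ℤ.+ suc w ℤ.- d x
      out-D (¬m , dx≡0) = trans (cong ℤ.+_
        (trans (proj₂ (proj₂ paley) (enum x) (enum≉ε x≢ε) ¬m) (trans v∸1/4 (sym (ℕ.+-identityʳ (suc w))))))
        (cong (λ t → ℤ.+ suc w ℤ.- t) (sym dx≡0))

    module P = PaleySet isAbelianGroup d d-01 dε≡0 d-sym (ℤ.+ suc w) +v≡ ∑d≡ d⋆d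

    p≡3 : ∀ m → v ≡ m * m → ∀ {p} k r → Prime p → p % 2 ≡ 1 → ¬ 2 ℕ.∣ v → k % 2 ≡ 1 → ¬ p ℕ.∣ r → r ≢ 1 →
      (p ^ k * p ^ k) * r ≡ v → p ≡ 3
    p≡3 m v≡m² = PaleyElement.p≡3 isAbelianGroup P.W P.Wε≡0 P.W≡±1 P.W-sym P.∑W≡0 P.W⋆W m v≡m²

-- The prime factorisation of the order

odd-square : ∀ m → ¬ 2 ℕ.∣ m * m → m * m ≢ 1 → ∃ λ w → m * m ≡ 1 + suc w * 4
odd-square m 2∤m² m²≢1 with m % 2 in m%2 | ℕ.m≡m%n+[m/n]*n m 2 | ℕ.m%n<n m 2
... | 0 | eq | _ = contradiction (ℕ.∣m⇒∣m*n m (ℕ.divides (m / 2) eq)) 2∤m²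
... | suc (suc _) | _ | s≤s (s≤s ())
... | 1 | eq | _ with m / 2
...   | zero  = contradiction (cong (λ m → m * m) eq) m²≢1
-- For m = 2 (u + 1) + 1 the quotient (m² - 1)/4 is (u + 1)(u + 2); the witness is one less.
...   | suc u = u * u + u * 3 + 1 , trans (cong (λ m → m * m) eq) (identity u)
  where
  identity : ∀ u → (1 + suc u * 2) * (1 + suc u * 2) ≡ 1 + suc (u * u + u * 3 + 1) * 4
  identity = solveℕ

product≡Prod : ∀ {n} (f : Fin n → ℕ) → prodFin n f ≡ Prod.sum f
product≡Prod {n} f = go (λ i → i)
  where
  go : ∀ {m} (h : Fin m → Fin n) → List.product (map f (tabulate h)) ≡ Prod.sum (λ i → f (h i))
  go {zero}  h = refl
  go {suc m} h = cong (f (h zero) *_) (go (λ i → h (suc i)))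

prime∣Prod : ∀ {q} → Prime q → ∀ {n} (f : Fin n → ℕ) → q ℕ.∣ Prod.sum f → ∃ λ i → q ℕ.∣ f i
prime∣Prod pr {zero}  f q∣1 = contradiction q∣1 (prime∤1 pr)
prime∣Prod pr {suc n} f q∣  with euclidsLemma (f zero) _ pr q∣
... | inj₁ q∣f0 = zero , q∣f0
... | inj₂ q∣fs with prime∣Prod pr (λ i → f (suc i)) q∣fs
...   | i , q∣fi = suc i , q∣fi

theorem1p2 : {c ℓ : Level} (G : AbelianGroup c ℓ) (v : ℕ) (F : FiniteOfOrder G v)
    (n : ℕ) (p k : Fin n → ℕ) →
    2 ≤ n →
    Injective _≡_ _≡_ p →
    (∀ i → Prime (p i)) →
    (∀ i → p i % 2 ≡ 1) →
    (∀ i → 1 ≤ k i) →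
    v ≡ prodFin n (λ i → p i ^ (2 * k i)) →
    Σ (Subset G) (λ D → IsRegularPaleyPDS G F D) →
    ∀ i → k i % 2 ≡ 1 → p i % 4 ≡ 3
theorem1p2 G v F (suc zero) p k (s≤s ())
theorem1p2 G v F (suc (suc n)) p k _ p-injective p-prime p-odd 1≤k v≡∏ (D , regular , paley) i k-odd =
  -- The prime is in fact equal to 3, which gives the residue.
  cong (_% 4) (Transport.Parameters.p≡3 G F D regular (proj₁ odd-v) (trans v≡m² (proj₂ odd-v)) paley
    m v≡m² (k i) r (p-prime i) (p-odd i) 2∤v k-odd p∤r r≢1 (sym v≡a*r))
  where
  factor : Fin (suc (suc n)) → ℕ
  factor j = p j ^ (2 * k j)
  rest : Fin (suc n) → ℕ
  rest j = factor (Fin.punchIn i j)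
  r m : ℕ
  r = Prod.sum rest
  m = Prod.sum (λ j → p j ^ k j)
  square : ∀ p k → p ^ (2 * k) ≡ p ^ k * p ^ k
  square p k = trans (cong (λ l → p ^ (k + l)) (ℕ.+-identityʳ k)) (ℕ.^-distribˡ-+-* p k k)
  v≡Prod : v ≡ Prod.sum factor
  v≡Prod = trans v≡∏ (product≡Prod factor)
  v≡m² : v ≡ m * m
  v≡m² = trans v≡Prod (trans (Prod.sum-cong-≗ (λ j → square (p j) (k j)))
    (Prod.∑-distrib-+ (λ j → p j ^ k j) (λ j → p j ^ k j)))
  v≡a*r : v ≡ (p i ^ k i * p i ^ k i) * r
  v≡a*r = trans v≡Prod (trans (Prod.sum-remove {i = i} factor) (cong (_* r) (square (p i) (k i))))
  2∤v : ¬ 2 ℕ.∣ v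
  2∤v 2∣v with prime∣Prod prime[2] factor (subst (2 ℕ.∣_) v≡Prod 2∣v)
  ... | j , 2∣pj^ = odd⇒2∤ (p-odd j) (subst (2 ℕ.∣_) (prime∣prime^⇒≡ (p-prime j) prime[2] (2 * k j) 2∣pj^) ℕ.∣-refl)
  p∤r : ¬ p i ℕ.∣ r
  p∤r p∣r with prime∣Prod (p-prime i) rest p∣r
  ... | j , p∣pj^ = Fin.punchInᵢ≢i i j (sym
    (p-injective (prime∣prime^⇒≡ (p-prime (Fin.punchIn i j)) (p-prime i) (2 * k (Fin.punchIn i j)) p∣pj^)))
  r≢1 : r ≢ 1
  r≢1 r≡1 = prime∤1 (p-prime j) (subst (p j ℕ.∣_) r≡1 (ℕ.∣m⇒∣m*n _ (p∣p^ (k j) (1≤k j))))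
    where
    -- A second index exists because n ≥ 2; its prime divides r.
    j = Fin.punchIn i zero
    p∣p^ : ∀ k → 1 ≤ k → p j ℕ.∣ p j ^ (2 * k)
    p∣p^ (suc k) _ = ℕ.m∣m*n _
  odd-v : ∃ λ w → m * m ≡ 1 + suc w * 4
  odd-v = odd-square m (subst (λ v → ¬ 2 ℕ.∣ v) v≡m² 2∤v) λ m²≡1 → r≢1
    (ℕ.m*n≡1⇒n≡1 (p i ^ k i * p i ^ k i) r (trans (sym v≡a*r) (trans v≡m² m²≡1)))
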